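{- For every $\eta\in(0,1)$ and every $c\in\mathbb N$ there is $n_0\in\mathbb N$ such that for all $n\ge n_0$ and all $k\ge \eta n$, every oriented graph $D$ on $n$ vertices with $\delta^0(D)>(1+\eta)\frac k2$ contains (as a subdigraph) every balanced antidirected tree $T$ with $k$ edges and $\Delta(T)\le (\log n)^c$.
   Context: An oriented graph is a digraph with no loops and at most one edge between any pair of vertices; an edge $uv$ is directed from $u$ to $v$. The minimum semidegree $\delta^0(D)$ is the minimum over all vertices of $D$ of their in-degrees and out-degrees. An oriented graph is antidirected if it contains no directed path with 2 edges (equivalently every vertex has in-degree $0$ or out-degree $0$). An antidirected tree (antitree) is an antidirected oriented graph whose underlying undirected graph is a tree. It is balanced if the number of vertices with no outgoing edges equals the number of vertices with no incoming edges. $\Delta(T)$ denotes the maximum degree of the underlying undirected tree of $T$. -}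

module Defs where

import Data.Nat
open import Data.Nat using (ℕ; zero; suc; _+_; _*_)
open import Data.Bool using (Bool; true; false; if_then_else_)
open import Data.Fin using (Fin; zero; suc)
open import Data.Sum using (_⊎_)
import Data.Product
open import Data.Product using (_×_)
open import Data.Empty using (⊥)
open import Data.Integer using (+_)
import Data.Rational
open import Data.Rational using (ℚ; _/_)
open import Relation.Binary.PropositionalEquality using (_≡_)
open import Relation.Binary.Construct.Closure.ReflexiveTransitive using (Star)
open import Function.Definitions using (Injective)

toℚ : ℕ → ℚ
toℚ k = + k / 1

count : (n : ℕ) → (Fin n → Bool) → ℕ
count zero    f = 0
count (suc n) f = (if f zero then 1 else 0) + count n (λ i → f (suc i))

-- A digraph on vertex set Fin n, given by its arc relation (E u v = true iff arc u → v)
Digraph : ℕ → Set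
Digraph n = Fin n → Fin n → Bool

outdeg : {n : ℕ} → Digraph n → Fin n → ℕ
outdeg {n} E v = count n (λ w → E v w)

indeg : {n : ℕ} → Digraph n → Fin n → ℕ
indeg {n} E v = count n (λ w → E w v)

sumF : (n : ℕ) → (Fin n → ℕ) → ℕ
sumF zero    f = 0
sumF (suc n) f = f zero + sumF n (λ i → f (suc i))

arcs : {n : ℕ} → Digraph n → ℕ
arcs {n} E = sumF n (λ v → outdeg E v)

Oriented : {n : ℕ} → Digraph n → Set
Oriented {n} E = ((v : Fin n) → E v v ≡ false)
               × ((u v : Fin n) → E u v ≡ true → E v u ≡ false)

SemidegreeAbove : {n : ℕ} → Digraph n → ℚ → Set
SemidegreeAbove {n} E x = (v : Fin n) → (x Data.Rational.< toℚ (outdeg E v)) × (x Data.Rational.< toℚ (indeg E v))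

Antidirected : {n : ℕ} → Digraph n → Set
Antidirected {n} E = (u v w : Fin n) → E u v ≡ true → E v w ≡ true → ⊥

UAdj : {n : ℕ} → Digraph n → Fin n → Fin n → Set
UAdj E u v = (E u v ≡ true) ⊎ (E v u ≡ true)

udeg : {n : ℕ} → Digraph n → Fin n → ℕ
udeg E v = outdeg E v + indeg E v

Connected : {n : ℕ} → Digraph n → Set
Connected {n} E = (u v : Fin n) → Star (UAdj E) u v

-- antidirected tree with k edges on vertex set Fin (suc k):
-- oriented, antidirected, connected, with exactly k arcs (so the underlying graph is a tree)
AntiTree : (k : ℕ) → Digraph (suc k) → Set
AntiTree k T = Oriented T × Antidirected T × Connected T × (arcs T ≡ k)

isZero : ℕ → Bool
isZero zero    = true
isZero (suc _) = false

sinks : {n : ℕ} → Digraph n → ℕ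
sinks {n} E = count n (λ v → isZero (outdeg E v))

sources : {n : ℕ} → Digraph n → ℕ
sources {n} E = count n (λ v → isZero (indeg E v))

Balanced : {n : ℕ} → Digraph n → Set
Balanced E = sinks E ≡ sources E

MaxDegLe : {n : ℕ} → Digraph n → ℕ → Set
MaxDegLe {n} E d = (v : Fin n) → udeg E v Data.Nat.≤ d

Contains : {n m : ℕ} → Digraph n → Digraph m → Set
Contains {n} {m} D T = Data.Product.Σ (Fin m → Fin n) λ f →
  Injective _≡_ _≡_ f × ((u v : Fin m) → T u v ≡ true → D (f u) (f v) ≡ true)

{-# OPTIONS --safe #-}

-- A hole of a pair of classes is a rectangle of at least h × h vertices of low density. Declaring holes dead and
-- refining the classes by them kills a constant fraction of all vertex pairs whenever many live pairs of
-- equal-sized classes have a hole, so this stops after boundedly many rounds. The remaining live pairs without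
-- holes form a reduced digraph R on the classes, which inherits the semidegree of D up to a small loss. Take a
-- component of the bipartite double cover of R. A maximal set of disjoint arcs of R inside this component can be
-- enlarged by exchanging one or two arcs until it has more than about k / (2 s) arcs, where s is the class size;
-- that the component meets enough classes is where the orientation of D is used.
--
-- The tree is cut into polylogarithmically small pieces hanging below earlier vertices, and the pieces are assigned
-- to the arcs of this antimatching, every shape (number of sources, number of sinks) being spread evenly, so that
-- no class overflows. A piece is embedded by walking through the component, inside small reserved parts of the
-- classes, to its arc and bouncing along this arc from then on. Since the walks have bounded length and the
-- degrees are polylogarithmic, all walks together use only a small part of the reserve.
module Submission where

open import Defs
open import Data.Nat using (ℕ; zero; suc; _≤_; _<_; _+_; _*_; _^_; z≤n; s≤s; NonZero; >-nonZero)
open import Data.Nat.Properties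
open import Data.Nat.DivMod using (_/_; m/n*n≤m; m≡m%n+[m/n]*n; m%n<n; m≥n⇒m/n>0)
open import Data.Nat.Tactic.RingSolver using (solve-∀)
open import Data.Nat.Logarithm using (⌈log₂_⌉; ⌈log₂⌉-mono-≤; ⌈log₂2^n⌉≡n)
open import Data.Bool using (Bool; true; false; if_then_else_; not; _∧_; _∨_)
import Data.Bool
import Data.Bool.Properties
open import Data.Fin using (Fin; zero; suc; combine; remQuot; funToFin; finToFun)
import Data.Fin.Properties as Fin
import Data.Fin
open import Data.Fin.Subset.Properties using (anySubset?)
open import Data.Vec using (lookup; tabulate)
open import Data.Vec.Properties using (lookup∘tabulate)
open import Data.Maybe using (Maybe; just; nothing)
import Data.Maybe
open import Data.Maybe.Properties using (just-injective; ≡-dec)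
open import Data.List using (List; []; _∷_; _++_; map; length)
open import Data.List.Properties using (length-map; length-++; ++-assoc)
open import Data.List.Membership.Propositional using (_∈_; _∉_)
open import Data.List.Membership.Propositional.Properties using (∈-++⁺ˡ; ∈-++⁺ʳ; ∈-++⁻; ∈-map⁺; ∈-map⁻; ∈-∃++)
open import Data.List.Relation.Unary.Any using (Any; here; there)
open import Data.List.Relation.Unary.All using (All; []; _∷_)
import Data.List.Relation.Unary.All as All
import Data.List.Relation.Unary.All.Properties as Allₚ
open import Data.List.Relation.Unary.AllPairs using ([]; _∷_)
open import Data.List.Relation.Unary.Unique.Propositional using (Unique)
open import Data.List.Relation.Binary.Permutation.Propositional using (_↭_; ↭-refl; ↭-sym; ↭-trans; prep; ↭-reflexive)
import Data.List.Relation.Binary.Permutation.Propositional as Perm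
import Data.List.Relation.Binary.Permutation.Propositional.Properties as Perm
open import Data.Product using (Σ; ∃; _×_; _,_; proj₁; proj₂; Σ-syntax)
import Data.Product.Properties
open import Data.Sum using (_⊎_; inj₁; inj₂; [_,_]′)
import Data.Sum
open import Data.Empty using (⊥; ⊥-elim)
open import Data.Unit using (⊤; tt)
open import Function using (_∘_; id)
open import Function.Definitions using (Injective)
open import Relation.Nullary using (¬_; Dec; yes; no; does)
open import Relation.Nullary.Decidable using (_×-dec_; _→-dec_; ¬?; toSum; decidable-stable)
open import Relation.Binary.Construct.Closure.ReflexiveTransitive using (Star; ε; _◅_)
open import Relation.Binary.PropositionalEquality using (_≡_; _≢_; refl; sym; trans; cong; cong₂; subst; subst₂; module ≡-Reasoning)
open import Data.Rational using (ℚ; 0ℚ; 1ℚ; ½)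
import Data.Rational as ℚ
import Data.Rational.Properties as ℚ
import Data.Rational.Unnormalised as ℚᵘ
import Data.Rational.Unnormalised.Properties as ℚᵘ
import Data.Integer as ℤ
import Data.Integer.Properties as ℤ

-- Deleting holes also loses few arcs of `D`, since holes are sparse.
--
-- The double cover appears because the images of an antidirected tree alternate between moving
-- along arcs and moving against them, so one walk never leaves its component. A class may lie on
-- both sides of the component, yet its vertices can be used only once; hence what matters is the
-- size of the union of the two sides, and antimatchings are vertex-disjoint in `R` itself.
--
-- Balance enters through capacity: an arc of the antimatching offers one class to sources and one
-- to sinks, so slightly more than `k / (2 s)` arcs suffice only if neither role exceeds half of the
-- tree. Both loads must be even at the same time, which is why pieces are sorted by shape; there
-- are only polylogarithmically many shapes, so rounding is negligible.
--
-- With `m` the square of the denominator of `η`, the degree condition becomes semidegree at least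
-- `k / 2 + n / (2 m)`, and all errors are measured against `n / m`.

ind : Bool → ℕ
ind b = if b then 1 else 0

ind≤1 : ∀ b → ind b ≤ 1
ind≤1 true  = ≤-refl
ind≤1 false = z≤n

true≢false : ∀ {b} → b ≡ true → b ≡ false → ⊥
true≢false refl ()

¬true⇒false : ∀ {b} → ¬ b ≡ true → b ≡ false
¬true⇒false {true}  h = ⊥-elim (h refl)
¬true⇒false {false} h = refl

∧-intro : ∀ {a b} → a ≡ true → b ≡ true → a ∧ b ≡ true
∧-intro refl refl = refl

∧-elim : ∀ a {b} → a ∧ b ≡ true → a ≡ true × b ≡ true
∧-elim true h = refl , h

∨-introˡ : ∀ {a b} → a ≡ true → a ∨ b ≡ true
∨-introˡ refl = refl

∨-introʳ : ∀ a {b} → b ≡ true → a ∨ b ≡ true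
∨-introʳ true  h = refl
∨-introʳ false h = h

∨-elim : ∀ a {b} → a ∨ b ≡ true → a ≡ true ⊎ b ≡ true
∨-elim true  h = inj₁ refl
∨-elim false h = inj₂ h

∨-false : ∀ a {b} → a ∨ b ≡ false → a ≡ false × b ≡ false
∨-false false h = refl , h

not-intro : ∀ {a} → a ≡ false → not a ≡ true
not-intro refl = refl

not-elim : ∀ {a} → not a ≡ true → a ≡ false
not-elim {false} h = refl

bool-cases : ∀ b → b ≡ true ⊎ b ≡ false
bool-cases true  = inj₁ refl
bool-cases false = inj₂ refl

does⁺ : ∀ {P : Set} (d : Dec P) → P → does d ≡ true
does⁺ (yes _) _ = refl
does⁺ (no ¬p) p = ⊥-elim (¬p p)

does⁻ : ∀ {P : Set} (d : Dec P) → does d ≡ true → P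
does⁻ (yes p) _ = p

doesn't⁺ : ∀ {P : Set} (d : Dec P) → ¬ P → does d ≡ false
doesn't⁺ (yes p) ¬p = ⊥-elim (¬p p)
doesn't⁺ (no _)  _  = refl

doesn't⁻ : ∀ {P : Set} (d : Dec P) → does d ≡ false → ¬ P
doesn't⁻ (no ¬p) _ = ¬p

-- Finite sums

sumF-mono : ∀ n {f g : Fin n → ℕ} → (∀ i → f i ≤ g i) → sumF n f ≤ sumF n g
sumF-mono zero    h = z≤n
sumF-mono (suc n) h = +-mono-≤ (h zero) (sumF-mono n (h ∘ suc))

sumF-cong : ∀ n {f g : Fin n → ℕ} → (∀ i → f i ≡ g i) → sumF n f ≡ sumF n g
sumF-cong zero    h = refl
sumF-cong (suc n) h = cong₂ _+_ (h zero) (sumF-cong n (h ∘ suc))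

+-interchange : ∀ a b c d → (a + b) + (c + d) ≡ (a + c) + (b + d)
+-interchange = solve-∀

sumF-+ : ∀ n (f g : Fin n → ℕ) → sumF n (λ i → f i + g i) ≡ sumF n f + sumF n g
sumF-+ zero    f g = refl
sumF-+ (suc n) f g = trans (cong (f zero + g zero +_) (sumF-+ n (f ∘ suc) (g ∘ suc)))
  (+-interchange (f zero) (g zero) _ _)

sumF-* : ∀ n c (f : Fin n → ℕ) → sumF n (λ i → c * f i) ≡ c * sumF n f
sumF-* zero    c f = sym (*-zeroʳ c)
sumF-* (suc n) c f = trans (cong (c * f zero +_) (sumF-* n c (f ∘ suc))) (sym (*-distribˡ-+ c (f zero) _))

sumF-const : ∀ n c → sumF n (λ _ → c) ≡ n * c
sumF-const zero    c = refl
sumF-const (suc n) c = cong (c +_) (sumF-const n c)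

sumF-zero : ∀ n {f : Fin n → ℕ} → (∀ i → f i ≡ 0) → sumF n f ≡ 0
sumF-zero n h = trans (sumF-cong n h) (trans (sumF-const n 0) (*-zeroʳ n))

sumF-swap : ∀ m n (f : Fin m → Fin n → ℕ) →
  sumF m (λ i → sumF n (f i)) ≡ sumF n (λ j → sumF m (λ i → f i j))
sumF-swap zero    n f = sym (sumF-zero n (λ _ → refl))
sumF-swap (suc m) n f = trans (cong (sumF n (f zero) +_) (sumF-swap m n (f ∘ suc)))
  (sym (sumF-+ n (f zero) (λ j → sumF m (λ i → f (suc i) j))))

term≤sumF : ∀ n (f : Fin n → ℕ) i → f i ≤ sumF n f
term≤sumF (suc n) f zero    = m≤m+n _ _
term≤sumF (suc n) f (suc i) = ≤-trans (term≤sumF n (f ∘ suc) i) (m≤n+m _ _)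

sumF-single : ∀ n (f : Fin n → ℕ) i → (∀ j → j ≢ i → f j ≡ 0) → sumF n f ≡ f i
sumF-single (suc n) f zero    h = trans (cong (f zero +_) (sumF-zero n (λ j → h (suc j) λ ()))) (+-identityʳ _)
sumF-single (suc n) f (suc i) h =
  trans (cong (_+ sumF n (f ∘ suc)) (h zero λ ()))
        (sumF-single n (f ∘ suc) i (λ j j≢i → h (suc j) (j≢i ∘ Fin.suc-injective)))

sumF-<⇒∃ : ∀ n {f g : Fin n → ℕ} → sumF n f < sumF n g → ∃ λ i → f i < g i
sumF-<⇒∃ (suc n) {f} {g} h with f zero <? g zero
... | yes p = zero , p
... | no ¬p = let i , q = sumF-<⇒∃ n {f ∘ suc} {g ∘ suc} (+-cancelˡ-< (g zero) _ _
                            (<-≤-trans (s≤s (+-monoˡ-≤ _ (≮⇒≥ ¬p))) h)) in suc i , q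

-- Cardinalities of decidable subsets of Fin n

count≡sumF : ∀ n f → count n f ≡ sumF n (ind ∘ f)
count≡sumF zero    f = refl
count≡sumF (suc n) f = cong (ind (f zero) +_) (count≡sumF n (f ∘ suc))

count-≤-sum : ∀ n {f} {g : Fin n → ℕ} → (∀ i → ind (f i) ≤ g i) → count n f ≤ sumF n g
count-≤-sum n {f} h = ≤-trans (≤-reflexive (count≡sumF n f)) (sumF-mono n h)

ind-mono : ∀ {a b} → (a ≡ true → b ≡ true) → ind a ≤ ind b
ind-mono {true}  h rewrite h refl = ≤-refl
ind-mono {false} h = z≤n

ind-∪ : ∀ {a b c} → (a ≡ true → b ≡ true ⊎ c ≡ true) → ind a ≤ ind b + ind c
ind-∪ {true} {b} {c} h with h refl
... | inj₁ refl = s≤s z≤n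
... | inj₂ refl = m≤n+m 1 (ind b)
ind-∪ {false} h = z≤n

ind-⊎ : ∀ {a b c} → (a ≡ true → c ≡ true) → (b ≡ true → c ≡ true) → (a ≡ true → b ≡ true → ⊥) →
  ind a + ind b ≤ ind c
ind-⊎ {true}  {true}  f g h = ⊥-elim (h refl refl)
ind-⊎ {true}  {false} f g h rewrite f refl = ≤-refl
ind-⊎ {false} {b}     f g h = ind-mono g

count-mono : ∀ n {f g} → (∀ i → f i ≡ true → g i ≡ true) → count n f ≤ count n g
count-mono n {f} {g} h = ≤-trans (count-≤-sum n (ind-mono ∘ h)) (≤-reflexive (sym (count≡sumF n g)))

count-cong : ∀ n {f g : Fin n → Bool} → (∀ i → f i ≡ g i) → count n f ≡ count n g
count-cong n h = ≤-antisym (count-mono n (λ i p → trans (sym (h i)) p)) (count-mono n (λ i p → trans (h i) p))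

count-∪ : ∀ n {f g h} → (∀ i → f i ≡ true → g i ≡ true ⊎ h i ≡ true) → count n f ≤ count n g + count n h
count-∪ n {f} {g} {h} p = ≤-trans (count-≤-sum n (ind-∪ ∘ p))
  (≤-reflexive (trans (sumF-+ n _ _) (sym (cong₂ _+_ (count≡sumF n g) (count≡sumF n h)))))

count-⊎ : ∀ n {f g h} → (∀ i → f i ≡ true → h i ≡ true) → (∀ i → g i ≡ true → h i ≡ true) →
  (∀ i → f i ≡ true → g i ≡ true → ⊥) → count n f + count n g ≤ count n h
count-⊎ n {f} {g} {h} p q r = begin
  count n f + count n g                   ≡⟨ cong₂ _+_ (count≡sumF n f) (count≡sumF n g) ⟩
  sumF n (ind ∘ f) + sumF n (ind ∘ g)     ≡⟨ sumF-+ n _ _ ⟨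
  sumF n (λ i → ind (f i) + ind (g i))    ≤⟨ sumF-mono n (λ i → ind-⊎ (p i) (q i) (r i)) ⟩
  sumF n (ind ∘ h)                        ≡⟨ count≡sumF n h ⟨
  count n h                               ∎
  where open ≤-Reasoning

count-const : ∀ n → count n (λ _ → true) ≡ n
count-const n = trans (count≡sumF n _) (trans (sumF-const n 1) (*-identityʳ n))

count≤n : ∀ n f → count n f ≤ n
count≤n n f = ≤-trans (count-mono n (λ _ _ → refl)) (≤-reflexive (count-const n))

count-∅ : ∀ n {f} → (∀ i → f i ≡ true → ⊥) → count n f ≡ 0
count-∅ n {f} h = trans (count≡sumF n f) (sumF-zero n (λ i → cong ind (¬true⇒false (h i))))

count-<⇒∃ : ∀ n {f g} → count n f < count n g → ∃ λ i → g i ≡ true × f i ≡ false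
count-<⇒∃ n {f} {g} h = let i , p = sumF-<⇒∃ n (subst₂ _<_ (count≡sumF n f) (count≡sumF n g) h) in i , split _ _ p
  where
  split : ∀ a b → ind a < ind b → b ≡ true × a ≡ false
  split false true  _ = refl , refl
  split true  true  (s≤s ())

count>0⇒∃ : ∀ n {f} → 0 < count n f → ∃ λ i → f i ≡ true
count>0⇒∃ n {f} h = let i , p , _ = count-<⇒∃ n {λ _ → false} (subst (_< count n f) (sym (count-∅ n λ _ ())) h) in i , p

∃⇒count>0 : ∀ n {f} i → f i ≡ true → 0 < count n f
∃⇒count>0 n {f} i p = ≤-trans (≤-reflexive (sym (cong ind p)))
  (≤-trans (term≤sumF n (ind ∘ f) i) (≤-reflexive (sym (count≡sumF n f))))

count-complement : ∀ n f → count n f + count n (not ∘ f) ≡ n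
count-complement n f = ≤-antisym
  (≤-trans (count-⊎ n {h = λ _ → true} (λ _ _ → refl) (λ _ _ → refl) (λ i p q → true≢false p (not-elim q)))
           (≤-reflexive (count-const n)))
  (≤-trans (≤-reflexive (sym (count-const n)))
           (count-∪ n (λ i _ → Data.Sum.map₂ not-intro (bool-cases (f i)))))

count-⁅⁆ : ∀ n (v : Fin n) → count n (λ u → does (u Fin.≟ v)) ≡ 1
count-⁅⁆ n v = trans (count≡sumF n _) (trans (sumF-single n _ v (λ j j≢v → cong ind (doesn't⁺ (j Fin.≟ v) j≢v)))
  (cong ind (does⁺ (v Fin.≟ v) refl)))

subset-of-size : ∀ n f s → s ≤ count n f → ∃ λ g → (∀ i → g i ≡ true → f i ≡ true) × count n g ≡ s
subset-of-size zero    f zero z≤n = f , (λ _ p → p) , refl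
subset-of-size (suc n) f zero    _ = (λ _ → false) , (λ _ ()) , count-∅ (suc n) {λ _ → false} (λ _ ())
subset-of-size (suc n) f (suc s) h with f zero in eq
... | true  = let g , g⊆f , |g| = subset-of-size n (f ∘ suc) s (≤-pred h) in
              (λ { zero → true ; (suc i) → g i }) , (λ { zero _ → eq ; (suc i) p → g⊆f i p }) , cong suc |g|
... | false = let g , g⊆f , |g| = subset-of-size n (f ∘ suc) (suc s) h in
              (λ { zero → false ; (suc i) → g i }) , (λ { (suc i) p → g⊆f i p }) , |g|

arcs-mono : ∀ n {E F : Digraph n} → (∀ u v → E u v ≡ true → F u v ≡ true) → arcs E ≤ arcs F
arcs-mono n h = sumF-mono n (λ u → count-mono n (h u))

arcs-∪ : ∀ n {E F G : Digraph n} → (∀ u v → E u v ≡ true → F u v ≡ true ⊎ G u v ≡ true) → arcs E ≤ arcs F + arcs G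
arcs-∪ n h = ≤-trans (sumF-mono n (λ u → count-∪ n (h u))) (≤-reflexive (sumF-+ n _ _))

arcs-⊎ : ∀ n {E F G : Digraph n} → (∀ u v → E u v ≡ true → G u v ≡ true) → (∀ u v → F u v ≡ true → G u v ≡ true) →
  (∀ u v → E u v ≡ true → F u v ≡ true → ⊥) → arcs E + arcs F ≤ arcs G
arcs-⊎ n p q r = ≤-trans (≤-reflexive (sym (sumF-+ n _ _))) (sumF-mono n (λ u → count-⊎ n (p u) (q u) (r u)))

arcs≤n² : ∀ n (E : Digraph n) → arcs E ≤ n * n
arcs≤n² n E = ≤-trans (sumF-mono n (λ u → count≤n n (E u))) (≤-reflexive (sumF-const n n))

arcs-transpose : ∀ n (E : Digraph n) → arcs E ≡ arcs (λ u v → E v u)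
arcs-transpose n E = trans (sumF-cong n (λ u → count≡sumF n (E u)))
  (trans (sumF-swap n n _) (sym (sumF-cong n (λ v → count≡sumF n (λ u → E u v)))))

-- Sums over lists

total : {A : Set} → (A → ℕ) → List A → ℕ
total f []       = 0
total f (x ∷ xs) = f x + total f xs

module _ {A : Set} where

  total-++ : ∀ (f : A → ℕ) xs ys → total f (xs ++ ys) ≡ total f xs + total f ys
  total-++ f []       ys = refl
  total-++ f (x ∷ xs) ys = trans (cong (f x +_) (total-++ f xs ys)) (sym (+-assoc (f x) _ _))

  total-mono : ∀ {f g : A → ℕ} xs → (∀ x → x ∈ xs → f x ≤ g x) → total f xs ≤ total g xs
  total-mono []       h = z≤n
  total-mono (x ∷ xs) h = +-mono-≤ (h x (here refl)) (total-mono xs (λ y → h y ∘ there))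

  total-+ : ∀ (f g : A → ℕ) xs → total (λ x → f x + g x) xs ≡ total f xs + total g xs
  total-+ f g []       = refl
  total-+ f g (x ∷ xs) = trans (cong (f x + g x +_) (total-+ f g xs)) (+-interchange (f x) (g x) _ _)

  total-const : ∀ c (xs : List A) → total (λ _ → c) xs ≡ length xs * c
  total-const c []       = refl
  total-const c (x ∷ xs) = cong (c +_) (total-const c xs)

  total-<⇒∃ : ∀ {f g : A → ℕ} xs → total f xs < total g xs → ∃ λ x → x ∈ xs × f x < g x
  total-<⇒∃ {f} {g} (x ∷ xs) h with f x <? g x
  ... | yes p = x , here refl , p
  ... | no ¬p = let y , y∈ , q = total-<⇒∃ {f} {g} xs (+-cancelˡ-< (g x) _ _
                                   (<-≤-trans (s≤s (+-monoˡ-≤ _ (≮⇒≥ ¬p))) h)) in y , there y∈ , q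

  total-↭ : ∀ (f : A → ℕ) {xs ys} → xs ↭ ys → total f xs ≡ total f ys
  total-↭ f Perm.refl         = refl
  total-↭ f (prep x p)        = cong (f x +_) (total-↭ f p)
  total-↭ f (Perm.swap x y p) = trans (cong (λ t → f x + (f y + t)) (total-↭ f p)) (lemma (f x) (f y) _)
    where
    lemma : ∀ a b c → a + (b + c) ≡ b + (a + c)
    lemma = solve-∀
  total-↭ f (Perm.trans p q)  = trans (total-↭ f p) (total-↭ f q)

total-map : ∀ {A B : Set} (f : B → ℕ) (g : A → B) xs → total f (map g xs) ≡ total (f ∘ g) xs
total-map f g []       = refl
total-map f g (x ∷ xs) = cong (f (g x) +_) (total-map f g xs)

_∈?_ : ∀ {n} (v : Fin n) (l : List (Fin n)) → Dec (v ∈ l)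
v ∈? l = Data.List.Relation.Unary.Any.any? (v Fin.≟_) l

_∖_ : ∀ {n} → (Fin n → Bool) → List (Fin n) → Fin n → Bool
(f ∖ l) v = f v ∧ not (does (v ∈? l))

∖-elim : ∀ {n} (f : Fin n → Bool) l v → (f ∖ l) v ≡ true → f v ≡ true × v ∉ l
∖-elim f l v h = let p , q = ∧-elim (f v) h in p , doesn't⁻ (v ∈? l) (not-elim q)

∖-intro : ∀ {n} (f : Fin n → Bool) l v → f v ≡ true → v ∉ l → (f ∖ l) v ≡ true
∖-intro f l v p q = ∧-intro p (not-intro (doesn't⁺ (v ∈? l) q))

count-∖ : ∀ n f l → count n f ≤ count n (f ∖ l) + total (ind ∘ f) l
count-∖ n f [] = ≤-trans (count-mono n (λ i p → ∖-intro f [] i p λ ())) (m≤m+n _ _)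
count-∖ n f (x ∷ l) = begin
  count n f                                         ≤⟨ count-∖ n f l ⟩
  count n (f ∖ l) + total (ind ∘ f) l               ≤⟨ +-monoˡ-≤ _ (count-∪ n cover) ⟩
  count n (f ∖ (x ∷ l)) + count n x-part + total (ind ∘ f) l   ≤⟨ +-monoˡ-≤ _ (+-monoʳ-≤ (count n (f ∖ (x ∷ l))) x-part-small) ⟩
  count n (f ∖ (x ∷ l)) + ind (f x) + total (ind ∘ f) l        ≡⟨ +-assoc (count n (f ∖ (x ∷ l))) _ _ ⟩
  count n (f ∖ (x ∷ l)) + (ind (f x) + total (ind ∘ f) l)      ∎
  where
  open ≤-Reasoning
  x-part : Fin n → Bool
  x-part v = f v ∧ does (v Fin.≟ x)
  cover : ∀ i → (f ∖ l) i ≡ true → (f ∖ (x ∷ l)) i ≡ true ⊎ x-part i ≡ true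
  cover i p with ∖-elim f l i p | i Fin.≟ x
  ... | fi , i∉l | yes refl = inj₂ (∧-intro fi refl)
  ... | fi , i∉l | no i≢x = inj₁ (∧-intro fi (not-intro (doesn't⁺ (i ∈? l) i∉l)))
  x-part-small : count n x-part ≤ ind (f x)
  x-part-small with bool-cases (f x)
  ... | inj₁ fx rewrite fx = ≤-trans (count-mono n (λ i p → proj₂ (∧-elim (f i) p))) (≤-reflexive (count-⁅⁆ n x))
  ... | inj₂ fx = ≤-trans (≤-reflexive (count-∅ n λ i p → let a , b = ∧-elim (f i) p in
                    true≢false a (trans (cong f (does⁻ (i Fin.≟ x) b)) fx))) z≤n

count-covered : ∀ n f l → (∀ v → f v ≡ true → v ∈ l) → count n f ≤ total (ind ∘ f) l
count-covered n f l h = ≤-trans (count-∖ n f l)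
  (≤-reflexive (cong (_+ total (ind ∘ f) l) (count-∅ n (λ v p → let a , b = ∖-elim f l v p in b (h v a)))))

unique-count : ∀ n f l → Unique l → total (ind ∘ f) l ≤ count n f
unique-count n f [] _ = z≤n
unique-count n f (x ∷ l) (x∉l ∷ u) = begin
  ind (f x) + total (ind ∘ f) l             ≤⟨ +-mono-≤ x-part (total-mono l (λ y y∈l → ind-mono (λ fy →
                                                 ∧-intro fy (not-intro (doesn't⁺ (y Fin.≟ x) (λ { refl → All.lookup x∉l y∈l refl })))))) ⟩
  count n x-only + total (ind ∘ rest) l     ≤⟨ +-monoʳ-≤ (count n x-only) (unique-count n rest l u) ⟩
  count n x-only + count n rest             ≤⟨ count-⊎ n (λ i p → proj₁ (∧-elim (f i) p)) (λ i p → proj₁ (∧-elim (f i) p))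
                                                 (λ i p q → true≢false (proj₂ (∧-elim (f i) p)) (not-elim (proj₂ (∧-elim (f i) q)))) ⟩
  count n f                                 ∎
  where
  open ≤-Reasoning
  x-only rest : Fin n → Bool
  x-only v = f v ∧ does (v Fin.≟ x)
  rest   v = f v ∧ not (does (v Fin.≟ x))
  x-part : ind (f x) ≤ count n x-only
  x-part with bool-cases (f x)
  ... | inj₁ fx rewrite fx = ∃⇒count>0 n x (∧-intro fx (does⁺ (x Fin.≟ x) refl))
  ... | inj₂ fx rewrite fx = z≤n

unique-length : ∀ n (l : List (Fin n)) → Unique l → length l ≤ n
unique-length n l u = ≤-trans (≤-reflexive (sym (trans (total-const 1 l) (*-identityʳ _))))
  (≤-trans (unique-count n (λ _ → true) l u) (count≤n n _))

Unique-resp-↭ : ∀ {A : Set} {xs ys : List A} → xs ↭ ys → Unique xs → Unique ys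
Unique-resp-↭ Perm.refl u = u
Unique-resp-↭ (prep x p) (a ∷ u) = Perm.All-resp-↭ p a ∷ Unique-resp-↭ p u
Unique-resp-↭ (Perm.swap x y p) ((x≢y ∷ a) ∷ b ∷ u) =
  ((x≢y ∘ sym) ∷ Perm.All-resp-↭ p b) ∷ Perm.All-resp-↭ p a ∷ Unique-resp-↭ p u
Unique-resp-↭ (Perm.trans p q) u = Unique-resp-↭ q (Unique-resp-↭ p u)

count-⋃ : ∀ n m {f} (g : Fin m → Fin n → Bool) → (∀ v → f v ≡ true → ∃ λ l → g l v ≡ true) →
  count n f ≤ sumF m (λ l → count n (g l))
count-⋃ n m {f} g h = begin
  count n f                                   ≤⟨ count-≤-sum n pointwise ⟩
  sumF n (λ v → sumF m (λ l → ind (g l v)))   ≡⟨ sumF-swap n m _ ⟩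
  sumF m (λ l → sumF n (λ v → ind (g l v)))   ≡⟨ sumF-cong m (λ l → count≡sumF n (g l)) ⟨
  sumF m (λ l → count n (g l))                ∎
  where
  open ≤-Reasoning
  pointwise : ∀ v → ind (f v) ≤ sumF m (λ l → ind (g l v))
  pointwise v with bool-cases (f v)
  ... | inj₁ p = let l , q = h v p in
        ≤-trans (ind≤1 (f v)) (≤-trans (≤-reflexive (sym (cong ind q))) (term≤sumF m (λ l → ind (g l v)) l))
  ... | inj₂ p rewrite p = z≤n

count-⨄ : ∀ n m {f} (g : Fin m → Fin n → Bool) → (∀ l v → g l v ≡ true → f v ≡ true) →
  (∀ l l′ v → g l v ≡ true → g l′ v ≡ true → l ≡ l′) → sumF m (λ l → count n (g l)) ≤ count n f
count-⨄ n m {f} g sub disj = begin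
  sumF m (λ l → count n (g l))                ≡⟨ sumF-cong m (λ l → count≡sumF n (g l)) ⟩
  sumF m (λ l → sumF n (λ v → ind (g l v)))   ≡⟨ sumF-swap m n _ ⟩
  sumF n (λ v → sumF m (λ l → ind (g l v)))   ≤⟨ sumF-mono n pointwise ⟩
  sumF n (ind ∘ f)                            ≡⟨ count≡sumF n f ⟨
  count n f                                   ∎
  where
  open ≤-Reasoning
  pointwise : ∀ v → sumF m (λ l → ind (g l v)) ≤ ind (f v)
  pointwise v with Fin.any? (λ l → g l v Data.Bool.≟ true)
  ... | yes (l , p) = ≤-trans (≤-reflexive (sumF-single m _ l (λ l′ l′≢l →
          cong ind (¬true⇒false (λ q → l′≢l (disj l′ l v q p)))))) (ind-mono (sub l v))
  ... | no none = ≤-trans (≤-reflexive (sumF-zero m (λ l → cong ind (¬true⇒false (λ q → none (l , q)))))) z≤n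

arcs-⋃ : ∀ n m {E} (G : Fin m → Digraph n) → (∀ u v → E u v ≡ true → ∃ λ l → G l u v ≡ true) →
  arcs E ≤ sumF m (λ l → arcs (G l))
arcs-⋃ n m G h = ≤-trans (sumF-mono n (λ u → count-⋃ n m (λ l → G l u) (h u))) (≤-reflexive (sumF-swap n m _))

arcs-⨄ : ∀ n m {E} (G : Fin m → Digraph n) → (∀ l u v → G l u v ≡ true → E u v ≡ true) →
  (∀ l l′ u v → G l u v ≡ true → G l′ u v ≡ true → l ≡ l′) → sumF m (λ l → arcs (G l)) ≤ arcs E
arcs-⨄ n m G sub disj = ≤-trans (≤-reflexive (sumF-swap m n _))
  (sumF-mono n (λ u → count-⨄ n m (λ l → G l u) (λ l → sub l u) (λ l l′ → disj l l′ u)))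

rect : ∀ {n} → (Fin n → Bool) → (Fin n → Bool) → Digraph n
rect A B u v = A u ∧ B v

arcs-rect : ∀ n A B → arcs (rect {n} A B) ≡ count n A * count n B
arcs-rect n A B = begin
  sumF n (λ u → count n (λ v → A u ∧ B v))   ≡⟨ sumF-cong n row ⟩
  sumF n (λ u → count n B * ind (A u))       ≡⟨ sumF-* n (count n B) _ ⟩
  count n B * sumF n (ind ∘ A)               ≡⟨ cong (count n B *_) (count≡sumF n A) ⟨
  count n B * count n A                      ≡⟨ *-comm (count n B) _ ⟩
  count n A * count n B                      ∎
  where
  open ≡-Reasoning
  row : ∀ u → count n (λ v → A u ∧ B v) ≡ count n B * ind (A u)
  row u with A u
  ... | true  = sym (*-identityʳ _)
  ... | false = trans (count-∅ n {λ _ → false} λ _ ()) (sym (*-zeroʳ (count n B)))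

-- Partial partitions: p v ≡ nothing means that v belongs to no class

maybe-cases : ∀ {A : Set} (x : Maybe A) → x ≡ nothing ⊎ ∃ λ y → x ≡ just y
maybe-cases nothing  = inj₁ refl
maybe-cases (just y) = inj₂ (y , refl)

cls : ∀ {n q} → (Fin n → Maybe (Fin q)) → Fin q → Fin n → Bool
cls p i v = does (≡-dec Fin._≟_ (p v) (just i))

unclassified : ∀ {n q} → (Fin n → Maybe (Fin q)) → Fin n → Bool
unclassified p v = does (≡-dec Fin._≟_ (p v) nothing)

cls⁻ : ∀ {n q} (p : Fin n → Maybe (Fin q)) i v → cls p i v ≡ true → p v ≡ just i
cls⁻ p i v = does⁻ (≡-dec Fin._≟_ (p v) (just i))

cls⁺ : ∀ {n q} (p : Fin n → Maybe (Fin q)) i v → p v ≡ just i → cls p i v ≡ true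
cls⁺ p i v = does⁺ (≡-dec Fin._≟_ (p v) (just i))

cls-disjoint : ∀ {n q} (p : Fin n → Maybe (Fin q)) i j v → cls p i v ≡ true → cls p j v ≡ true → i ≡ j
cls-disjoint p i j v a b = just-injective (trans (sym (cls⁻ p i v a)) (cls⁻ p j v b))

classes-size : ∀ n {q} (p : Fin n → Maybe (Fin q)) s → (∀ i → count n (cls p i) ≡ s) → q * s ≤ n
classes-size n {q} p s h = begin
  q * s                            ≡⟨ sumF-const q s ⟨
  sumF q (λ _ → s)                 ≡⟨ sumF-cong q h ⟨
  sumF q (λ i → count n (cls p i)) ≤⟨ count-⨄ n q {λ _ → true} (cls p) (λ _ _ _ → refl) (cls-disjoint p) ⟩
  count n (λ _ → true)             ≡⟨ count-const n ⟩
  n                                ∎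
  where open ≤-Reasoning

-- Cutting the classes of a labelling into chunks of equal size s, up to fewer than s leftovers per label.
Chopped : ∀ n m s → (Fin n → Maybe (Fin m)) → Set
Chopped n m s lab = Σ[ q ∈ ℕ ] Σ[ p ∈ (Fin n → Maybe (Fin q)) ]
  (∀ i → count n (cls p i) ≡ s) ×
  (∀ u v i → p u ≡ just i → p v ≡ just i → ∃ λ l → lab u ≡ just l × lab v ≡ just l) ×
  count n (unclassified p) ≤ count n (unclassified lab) + m * s

module _ {n m s : ℕ} (lab : Fin n → Maybe (Fin m)) (s>0 : 0 < s) where

  private
    free : ∀ {q} → (Fin n → Maybe (Fin q)) → Fin m → Fin n → Bool
    free p l v = unclassified p v ∧ cls lab l v

    pick : ∀ {q} → (Fin n → Bool) → (Fin n → Maybe (Fin q)) → Fin n → Maybe (Fin (suc q))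
    pick g p v = if g v then just zero else Data.Maybe.map suc (p v)

  -- Recursion on fuel: `f` dominates the number of unclassified vertices, and each new chunk
  -- removes `s > 0` of them. It stops when every label has fewer than `s` free vertices, which is
  -- the bound on the leftovers.
  chop-from : ∀ f q (p : Fin n → Maybe (Fin q)) → (∀ i → count n (cls p i) ≡ s) →
    (∀ u v i → p u ≡ just i → p v ≡ just i → ∃ λ l → lab u ≡ just l × lab v ≡ just l) →
    count n (unclassified p) ≤ f → Chopped n m s lab
  chop-from f q p size same bound with Fin.any? (λ l → s ≤? count n (free p l))
  ... | no none = q , p , size , same , (begin
        count n (unclassified p)                      ≤⟨ count-∪ n cover ⟩
        count n (unclassified lab) + count n some     ≤⟨ +-monoʳ-≤ (count n (unclassified lab)) (count-⋃ n m (free p) (λ v → does⁻ (some? v))) ⟩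
        count n (unclassified lab) + sumF m (λ l → count n (free p l))
                                                      ≤⟨ +-monoʳ-≤ (count n (unclassified lab)) (≤-trans (sumF-mono m (λ l → <⇒≤ (≰⇒> (λ a → none (l , a))))) (≤-reflexive (sumF-const m s))) ⟩
        count n (unclassified lab) + m * s            ∎)
    where
    open ≤-Reasoning
    some? : ∀ v → Dec (∃ λ l → free p l v ≡ true)
    some? v = Fin.any? (λ l → free p l v Data.Bool.≟ true)
    some : Fin n → Bool
    some v = does (some? v)
    cover : ∀ v → unclassified p v ≡ true → unclassified lab v ≡ true ⊎ some v ≡ true
    cover v a with maybe-cases (lab v)
    ... | inj₁ eq       = inj₁ (does⁺ (≡-dec Fin._≟_ (lab v) nothing) eq)
    ... | inj₂ (l , eq) = inj₂ (does⁺ (some? v) (l , ∧-intro a (cls⁺ lab l v eq)))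
  ... | yes (l , s≤) with subset-of-size n (free p l) s s≤
  ...   | g , g⊆ , |g| = next f bound
    where
    p⁺ : Fin n → Maybe (Fin (suc q))
    p⁺ = pick g p
    g⇒ : ∀ v → g v ≡ true → p v ≡ nothing × lab v ≡ just l
    g⇒ v a = let b , c = ∧-elim (unclassified p v) (g⊆ v a) in does⁻ (≡-dec Fin._≟_ (p v) nothing) b , cls⁻ lab l v c
    new⇒g : ∀ v → p⁺ v ≡ just zero → g v ≡ true
    new⇒g v a with g v
    ... | true = refl
    ... | false with p v
    new⇒g v () | false | just _
    new⇒g v () | false | nothing
    old⇒ : ∀ v i → p⁺ v ≡ just (suc i) → p v ≡ just i
    old⇒ v i a with g v
    old⇒ v i () | true
    ... | false with p v
    old⇒ v i refl | false | just _ = refl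
    ⇒old : ∀ v i → p v ≡ just i → p⁺ v ≡ just (suc i)
    ⇒old v i a with g v in eq
    ... | false rewrite a = refl
    ... | true with trans (sym a) (proj₁ (g⇒ v eq))
    ... | ()
    ⇒new : ∀ v → g v ≡ true → p⁺ v ≡ just zero
    ⇒new v a rewrite a = refl
    unc : ∀ v → unclassified p⁺ v ≡ true → unclassified p v ≡ true × g v ≡ false
    unc v a with g v
    unc v () | true
    ... | false with p v
    unc v () | false | just _
    ... | nothing = refl , refl
    size⁺ : ∀ i → count n (cls p⁺ i) ≡ s
    size⁺ zero    = trans (≤-antisym (count-mono n (λ v a → new⇒g v (cls⁻ p⁺ zero v a)))
                                     (count-mono n (λ v a → cls⁺ p⁺ zero v (⇒new v a)))) |g|
    size⁺ (suc i) = trans (≤-antisym (count-mono n (λ v a → cls⁺ p i v (old⇒ v i (cls⁻ p⁺ (suc i) v a))))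
                                     (count-mono n (λ v a → cls⁺ p⁺ (suc i) v (⇒old v i (cls⁻ p i v a))))) (size i)
    same⁺ : ∀ u v i → p⁺ u ≡ just i → p⁺ v ≡ just i → ∃ λ l → lab u ≡ just l × lab v ≡ just l
    same⁺ u v zero    a b = l , proj₂ (g⇒ u (new⇒g u a)) , proj₂ (g⇒ v (new⇒g v b))
    same⁺ u v (suc i) a b = same u v i (old⇒ u i a) (old⇒ v i b)
    fewer : count n (unclassified p⁺) + s ≤ count n (unclassified p)
    fewer = ≤-trans (≤-reflexive (cong (count n (unclassified p⁺) +_) (sym |g|)))
      (count-⊎ n (λ v → proj₁ ∘ unc v) (λ v a → does⁺ (≡-dec Fin._≟_ (p v) nothing) (proj₁ (g⇒ v a)))
                 (λ v a b → true≢false b (proj₂ (unc v a))))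
    next : ∀ f → count n (unclassified p) ≤ f → Chopped n m s lab
    next zero    b = ⊥-elim (<-irrefl refl (<-≤-trans s>0 (≤-trans (m≤n+m s _) (≤-trans fewer b))))
    next (suc f) b = chop-from f (suc q) p⁺ size⁺ same⁺
      (≤-pred (≤-trans (≤-trans (≤-reflexive (+-comm 1 _)) (+-monoʳ-≤ _ s>0)) (≤-trans fewer b)))

  chop : Chopped n m s lab
  chop = chop-from n 0 (λ _ → nothing) (λ ()) (λ _ _ ()) (count≤n n _)

-- Sparse rectangles

IsHole : ∀ {n} → Digraph n → ℕ → ℕ → (V W A B : Fin n → Bool) → Set
IsHole {n} D dd h V W A B =
  (∀ u → A u ≡ true → V u ≡ true) × (∀ v → B v ≡ true → W v ≡ true) ×
  h ≤ count n A × h ≤ count n B ×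
  dd * arcs (λ u v → rect A B u v ∧ D u v) ≤ count n A * count n B

HasHole : ∀ {n} → Digraph n → ℕ → ℕ → (V W : Fin n → Bool) → Set
HasHole {n} D dd h V W = Σ[ A ∈ (Fin n → Bool) ] Σ[ B ∈ (Fin n → Bool) ] IsHole D dd h V W A B

isHole? : ∀ {n} (D : Digraph n) dd h V W A B → Dec (IsHole D dd h V W A B)
isHole? {n} D dd h V W A B =
  (Fin.all? λ u → (A u Data.Bool.≟ true) →-dec (V u Data.Bool.≟ true)) ×-dec
  (Fin.all? λ u → (B u Data.Bool.≟ true) →-dec (W u Data.Bool.≟ true)) ×-dec
  (h ≤? count n A) ×-dec (h ≤? count n B) ×-dec
  (dd * arcs (λ u v → rect A B u v ∧ D u v) ≤? count n A * count n B)

-- Subsets are searched as vectors, whose lookups agree with a given predicate only pointwise; this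
-- carries a hole from one to the other.
isHole-cong : ∀ {n} (D : Digraph n) dd h V W {A A′ B B′} → (∀ u → A′ u ≡ A u) → (∀ u → B′ u ≡ B u) →
  IsHole D dd h V W A B → IsHole D dd h V W A′ B′
isHole-cong {n} D dd h V W {A} {A′} {B} {B′} eA eB (a , b , c , d , e) =
  (λ u x → a u (trans (sym (eA u)) x)) , (λ u x → b u (trans (sym (eB u)) x)) ,
  ≤-trans c (≤-reflexive (sym |A|)) , ≤-trans d (≤-reflexive (sym |B|)) ,
  ≤-trans (*-monoʳ-≤ dd (arcs-mono n (λ u v x → trans (cong₂ (λ s t → (s ∧ t) ∧ D u v) (sym (eA u)) (sym (eB v))) x)))
    (≤-trans e (≤-reflexive (sym (cong₂ _*_ |A| |B|))))
  where
  |A| : count n A′ ≡ count n A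
  |A| = count-cong n eA
  |B| : count n B′ ≡ count n B
  |B| = count-cong n eB

hasHole? : ∀ {n} (D : Digraph n) dd h V W → Dec (HasHole D dd h V W)
hasHole? D dd h V W with anySubset? (λ a → anySubset? (λ b → isHole? D dd h V W (lookup a) (lookup b)))
... | yes (a , b , x) = yes (lookup a , lookup b , x)
... | no none = no λ { (A , B , x) → none (tabulate A , tabulate B ,
        isHole-cong D dd h V W (lookup∘tabulate A) (lookup∘tabulate B) x) }

module _ (n m : ℕ) {E : Digraph n} (G : Fin m → Fin m → Digraph n) where

  private
    some? : ∀ i u v → Dec (∃ λ j → G i j u v ≡ true)
    some? i u v = Fin.any? (λ j → G i j u v Data.Bool.≟ true)
    row : Fin m → Digraph n
    row i u v = does (some? i u v)

  arcs-⋃₂ : (∀ u v → E u v ≡ true → ∃ λ i → ∃ λ j → G i j u v ≡ true) →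
    arcs E ≤ sumF m (λ i → sumF m (λ j → arcs (G i j)))
  arcs-⋃₂ h = ≤-trans (arcs-⋃ n m row (λ u v e → let i , g = h u v e in i , does⁺ (some? i u v) g))
    (sumF-mono m (λ i → arcs-⋃ n m (G i) (λ u v → does⁻ (some? i u v))))

  arcs-⨄₂ : (∀ i j u v → G i j u v ≡ true → E u v ≡ true) →
    (∀ i j i′ j′ u v → G i j u v ≡ true → G i′ j′ u v ≡ true → i ≡ i′ × j ≡ j′) →
    sumF m (λ i → sumF m (λ j → arcs (G i j))) ≤ arcs E
  arcs-⨄₂ sub disj = ≤-trans
    (sumF-mono m (λ i → arcs-⨄ n m (G i) (λ j u v g → does⁺ (some? i u v) (j , g))
      (λ j j′ u v a b → proj₂ (disj i j i j′ u v a b))))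
    (arcs-⨄ n m row (λ i u v r → let j , g = does⁻ (some? i u v) r in sub i j u v g)
      (λ i i′ u v a b → let j , g = does⁻ (some? i u v) a ; j′ , g′ = does⁻ (some? i′ u v) b in
        proj₁ (disj i j i′ j′ u v g g′)))

-- One cleaning step: H is the union of one hole for each live pair of classes that has one.
module Clean {n : ℕ} (D : Digraph n) (dd h : ℕ) {q : ℕ} (p : Fin n → Maybe (Fin q)) (L : Digraph n) where

  Live : Fin q → Fin q → Set
  Live i j = Σ[ u ∈ Fin n ] Σ[ v ∈ Fin n ] p u ≡ just i × p v ≡ just j × L u v ≡ true

  live? : ∀ i j → Dec (Live i j)
  live? i j = Fin.any? λ u → Fin.any? λ v →
    ≡-dec Fin._≟_ (p u) (just i) ×-dec ≡-dec Fin._≟_ (p v) (just j) ×-dec (L u v Data.Bool.≟ true)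

  Bad : Fin q → Fin q → Set
  Bad i j = Live i j × HasHole D dd h (cls p i) (cls p j)

  abstract
    bad? : ∀ i j → Dec (Bad i j)
    bad? i j = live? i j ×-dec hasHole? D dd h (cls p i) (cls p j)

  bad : Digraph q
  bad i j = does (bad? i j)

  -- The sides of the chosen hole. They are empty when the pair is not bad, so that sums and unions
  -- can range over all pairs.
  tail head : ∀ {i j} → Dec (Bad i j) → Fin n → Bool
  tail (yes (_ , A , _)) = A
  tail (no _)            = λ _ → false
  head (yes (_ , _ , B , _)) = B
  head (no _)                = λ _ → false

  A B : Fin q → Fin q → Fin n → Bool
  A i j = tail (bad? i j)
  B i j = head (bad? i j)

  A⇒ : ∀ i j u → A i j u ≡ true → p u ≡ just i × Live i j
  A⇒ i j u a with bad? i j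
  ... | yes (l , _ , _ , A⊆ , _) = cls⁻ p i u (A⊆ u a) , l

  B⇒ : ∀ i j u → B i j u ≡ true → p u ≡ just j
  B⇒ i j u a with bad? i j
  ... | yes (l , _ , _ , _ , B⊆ , _) = cls⁻ p j u (B⊆ u a)

  bad-size : ∀ i j → ind (bad i j) * (h * h) ≤ count n (A i j) * count n (B i j)
  bad-size i j with bad? i j
  ... | yes (_ , _ , _ , _ , _ , a , b , _) = ≤-trans (≤-reflexive (*-identityˡ _)) (*-mono-≤ a b)
  ... | no _ = z≤n

  sparse : ∀ i j → dd * arcs (λ u v → rect (A i j) (B i j) u v ∧ D u v) ≤ count n (A i j) * count n (B i j)
  sparse i j with bad? i j
  ... | yes (_ , _ , _ , _ , _ , _ , _ , x) = x
  ... | no _ = ≤-trans (≤-reflexive (trans (cong (dd *_) (sumF-zero n (λ u → count-∅ n {λ _ → false} λ _ ()))) (*-zeroʳ dd))) z≤n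

  H? : ∀ u v → Dec (∃ λ i → ∃ λ j → rect (A i j) (B i j) u v ≡ true)
  H? u v = Fin.any? λ i → Fin.any? λ j → rect (A i j) (B i j) u v Data.Bool.≟ true

  H : Digraph n
  H u v = does (H? u v)

  rects-disjoint : ∀ i j i′ j′ u v → rect (A i j) (B i j) u v ≡ true → rect (A i′ j′) (B i′ j′) u v ≡ true → i ≡ i′ × j ≡ j′
  rects-disjoint i j i′ j′ u v x y =
    let a , b = ∧-elim (A i j u) x ; a′ , b′ = ∧-elim (A i′ j′ u) y in
    just-injective (trans (sym (proj₁ (A⇒ i j u a))) (proj₁ (A⇒ i′ j′ u a′))) ,
    just-injective (trans (sym (B⇒ i j v b)) (B⇒ i′ j′ v b′))

  H-area : sumF q (λ i → sumF q (λ j → count n (A i j) * count n (B i j))) ≤ arcs H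
  H-area = ≤-trans (≤-reflexive (sumF-cong q (λ i → sumF-cong q (λ j → sym (arcs-rect n (A i j) (B i j))))))
    (arcs-⨄₂ n q (λ i j → rect (A i j) (B i j)) (λ i j u v r → does⁺ (H? u v) (i , j , r)) rects-disjoint)

  -- The rectangles of different pairs are disjoint because the classes are, and each bad pair
  -- contributes an area of at least `h * h`.
  H-large : arcs bad * (h * h) ≤ arcs H
  H-large = begin
    arcs bad * (h * h)                                            ≡⟨ *-comm (arcs bad) _ ⟩
    h * h * sumF q (λ i → count q (bad i))                        ≡⟨ sumF-* q (h * h) _ ⟨
    sumF q (λ i → h * h * count q (bad i))                        ≡⟨ sumF-cong q (λ i → trans (cong (h * h *_) (count≡sumF q (bad i)))
                                                                       (sym (sumF-* q (h * h) _))) ⟩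
    sumF q (λ i → sumF q (λ j → h * h * ind (bad i j)))           ≤⟨ sumF-mono q (λ i → sumF-mono q (λ j →
                                                                       ≤-trans (≤-reflexive (*-comm (h * h) _)) (bad-size i j))) ⟩
    sumF q (λ i → sumF q (λ j → count n (A i j) * count n (B i j))) ≤⟨ H-area ⟩
    arcs H                                                        ∎
    where open ≤-Reasoning

  -- By disjointness the sparsity of the single holes adds up. This is the price of a cleaning step:
  -- arcs of `D` are lost at a rate of at most `1 / dd` of the pairs killed.
  H-sparse : dd * arcs (λ u v → H u v ∧ D u v) ≤ arcs H
  H-sparse = begin
    dd * arcs (λ u v → H u v ∧ D u v)                             ≤⟨ *-monoʳ-≤ dd (arcs-⋃₂ n q _ (λ u v x →
                                                                       let a , b = ∧-elim (H u v) x ; i , j , r = does⁻ (H? u v) a in i , j , ∧-intro r b)) ⟩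
    dd * sumF q (λ i → sumF q (λ j → arcs (λ u v → rect (A i j) (B i j) u v ∧ D u v)))
                                                                  ≡⟨ trans (sym (sumF-* q dd _)) (sumF-cong q (λ i → sym (sumF-* q dd _))) ⟩
    sumF q (λ i → sumF q (λ j → dd * arcs (λ u v → rect (A i j) (B i j) u v ∧ D u v)))
                                                                  ≤⟨ sumF-mono q (λ i → sumF-mono q (sparse i)) ⟩
    sumF q (λ i → sumF q (λ j → count n (A i j) * count n (B i j))) ≤⟨ H-area ⟩
    arcs H                                                        ∎
    where open ≤-Reasoning

  -- The number of membership patterns of a vertex in the `q * q` tails and the `q * q` heads.
  Lb : ℕ
  Lb = (2 ^ q) ^ q * (2 ^ q) ^ q

  bit : Bool → Fin 2
  bit true  = suc zero
  bit false = zero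

  bit-injective : ∀ {a b} → bit a ≡ bit b → a ≡ b
  bit-injective {true}  {true}  _ = refl
  bit-injective {false} {false} _ = refl

  funToFin-injective : ∀ {m k} (f g : Fin m → Fin k) → funToFin f ≡ funToFin g → ∀ i → f i ≡ g i
  funToFin-injective f g e i = trans (sym (Fin.finToFun-funToFin f i))
    (trans (cong (λ x → finToFun x i) e) (Fin.finToFun-funToFin g i))

  code : (Fin q → Fin q → Fin n → Bool) → Fin n → Fin ((2 ^ q) ^ q)
  code S u = funToFin (λ i → funToFin (λ j → bit (S i j u)))

  code-injective : ∀ S u v → code S u ≡ code S v → ∀ i j → S i j u ≡ S i j v
  code-injective S u v e i j = bit-injective (funToFin-injective _ _ (funToFin-injective _ _ e i) j)

  lab : Fin n → Maybe (Fin (q * Lb))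
  lab u = Data.Maybe.map (λ i → combine i (combine (code A u) (code B u))) (p u)

  lab-same : ∀ u v l → lab u ≡ just l → lab v ≡ just l →
    ∃ λ i → p u ≡ just i × p v ≡ just i × (∀ i j → A i j u ≡ A i j v) × (∀ i j → B i j u ≡ B i j v)
  lab-same u v l a b with p u | p v
  ... | just i | just i′ =
    let e₁ , e₂ = Fin.combine-injective i (combine (code A u) (code B u)) i′ (combine (code A v) (code B v))
                    (just-injective (trans a (sym b)))
        e₃ , e₄ = Fin.combine-injective (code A u) (code B u) (code A v) (code B v) e₂
    in i , refl , cong just (sym e₁) , code-injective A u v e₃ , code-injective B u v e₄

  unclassified-lab : ∀ v → unclassified lab v ≡ true → unclassified p v ≡ true
  unclassified-lab v a with p v
  ... | nothing = refl

  -- `H` is thus a union of rectangles between labels, so after refining by `lab` the remaining live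
  -- pairs are again constant on pairs of classes.
  H-cong : ∀ u u′ v v′ → (∀ i j → A i j u ≡ A i j u′) → (∀ i j → B i j v ≡ B i j v′) → H u v ≡ true → H u′ v′ ≡ true
  H-cong u u′ v v′ a b x = let i , j , r = does⁻ (H? u v) x in
    does⁺ (H? u′ v′) (i , j , trans (sym (cong₂ _∧_ (a i j) (b i j))) r)

-- A regularity lemma for holes

blk : ∀ {q} → Digraph q → Maybe (Fin q) → Maybe (Fin q) → Bool
blk R (just i) (just j) = R i j
blk R _        _        = false

-- `S` will not depend on `n`, so `n≤S*h` says that holes have linear size. `small` makes rounding
-- to whole classes cheap, and `missing` bounds the arcs of `D` that `R` does not account for.
record Regular {n : ℕ} (D : Digraph n) (dd hh ξ S Q : ℕ) : Set where
  field
    q h     : ℕ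
    p       : Fin n → Maybe (Fin q)
    R       : Digraph q
    size    : ∀ i → count n (cls p i) ≡ hh * h
    n≤S*h   : n ≤ S * h
    small   : Q * (hh * h) ≤ n
    irrefl  : ∀ i → R i i ≡ false
    no-hole : ∀ i j → R i j ≡ true → ¬ HasHole D dd h (cls p i) (cls p j)
    missing : ξ * arcs (λ u v → D u v ∧ not (blk R (p u) (p v))) ≤ n * n

arcs-∪₄ : ∀ n {E E₁ E₂ E₃ E₄ : Digraph n} →
  (∀ u v → E u v ≡ true → (E₁ u v ≡ true ⊎ E₂ u v ≡ true) ⊎ (E₃ u v ≡ true ⊎ E₄ u v ≡ true)) →
  arcs E ≤ (arcs E₁ + arcs E₂) + (arcs E₃ + arcs E₄)
arcs-∪₄ n {E} {E₁} {E₂} {E₃} {E₄} h = ≤-trans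
  (arcs-∪ n {E} {λ u v → E₁ u v ∨ E₂ u v} {λ u v → E₃ u v ∨ E₄ u v}
    (λ u v e → Data.Sum.map [ ∨-introˡ , ∨-introʳ (E₁ u v) ]′ [ ∨-introˡ , ∨-introʳ (E₃ u v) ]′ (h u v e)))
  (+-mono-≤ (arcs-∪ n (λ u v → ∨-elim (E₁ u v))) (arcs-∪ n (λ u v → ∨-elim (E₃ u v))))

div-bounds : ∀ c h → 0 < c → c ≤ h → Σ[ h′ ∈ ℕ ] 0 < h′ × c * h′ ≤ h × h ≤ 2 * c * h′
div-bounds c h c>0 c≤h = h / c , h′>0 , ≤-trans (≤-reflexive (*-comm c _)) (m/n*n≤m h c) , (begin
  h                     ≡⟨ m≡m%n+[m/n]*n h c ⟩
  _ + h / c * c         ≤⟨ +-monoˡ-≤ _ (<⇒≤ (m%n<n h c)) ⟩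
  c + h / c * c         ≡⟨ cong (_+ h / c * c) (*-identityˡ c) ⟨
  1 * c + h / c * c     ≤⟨ +-monoˡ-≤ _ (*-monoˡ-≤ c h′>0) ⟩
  h / c * c + h / c * c ≡⟨ eq (h / c) c ⟩
  2 * c * (h / c)       ∎)
  where
  open ≤-Reasoning
  instance
    nz : NonZero c
    nz = >-nonZero c>0
  h′>0 : 0 < h / c
  h′>0 = m≥n⇒m/n>0 c≤h
  eq : ∀ a b → a * b + a * b ≡ 2 * b * a
  eq = solve-∀

*-cancelˡ-≤′ : ∀ {m n} o → 0 < o → o * m ≤ o * n → m ≤ n
*-cancelˡ-≤′ o o>0 h = *-cancelˡ-≤ o {{>-nonZero o>0}} h

factor>0 : ∀ {n h} S → 0 < n → n ≤ S * h → 0 < S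
factor>0 zero    n>0 n≤ = ≤-trans n>0 n≤
factor>0 (suc S) _   _  = s≤s z≤n

labels : ℕ → ℕ
labels q = (2 ^ q) ^ q * (2 ^ q) ^ q

labels-mono : ∀ {q r} → q ≤ r → labels q ≤ labels r
labels-mono {q} {r} h = *-mono-≤ x x
  where
  x : (2 ^ q) ^ q ≤ (2 ^ r) ^ r
  x = ≤-trans (^-monoˡ-≤ q (^-monoʳ-≤ 2 h)) (^-monoʳ-≤ (2 ^ r) {{m^n≢0 2 r}} h)

labels>0 : ∀ q → 0 < labels q
labels>0 q = *-mono-≤ x x
  where
  x : 0 < (2 ^ q) ^ q
  x = m^n>0 (2 ^ q) {{m^n≢0 2 q}} q

-- The bound for n / h after f further steps, starting from n ≤ S * h.
Sfin : ℕ → ℕ → ℕ → ℕ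
Sfin K zero    S = S
Sfin K (suc f) S = Sfin K f (S * (2 * (K * labels S)))

S≤Sfin : ∀ K → 0 < K → ∀ f S → S ≤ Sfin K f S
S≤Sfin K K>0 zero    S = ≤-refl
S≤Sfin K K>0 (suc f) S = ≤-trans
  (≤-trans (≤-reflexive (sym (*-identityʳ S))) (*-monoʳ-≤ S (*-mono-≤ {1} {2} (s≤s z≤n) (*-mono-≤ K>0 (labels>0 S)))))
  (S≤Sfin K K>0 f _)

module RegularityLoop {n : ℕ} (D : Digraph n) (ξ hh Q : ℕ) (hh>0 : 0 < hh) (ξ>0 : 0 < ξ) (n>0 : 0 < n) where

  -- A round that does not stop kills more than `n * n / F` pairs, so `F` rounds are enough. Each
  -- partition wastes at most `n / K` vertices; the first summand of `K` keeps the total waste below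
  -- `n / (10 * ξ)`, and `Q` enters for the sake of `small`.
  dd F K : ℕ
  dd = 5 * ξ
  F  = dd * (hh * hh)
  K  = 10 * ξ * suc F + Q

  K>0 : 0 < K
  K>0 = ≤-trans (*-mono-≤ {1} {10 * ξ} (≤-trans ξ>0 (m≤n*m ξ 10)) (s≤s z≤n)) (m≤m+n _ Q)

  Respects : ∀ {q} → (Fin n → Maybe (Fin q)) → Digraph n → Set
  Respects p L = ∀ u u′ v v′ i j → p u ≡ just i → p u′ ≡ just i → p v ≡ just j → p v′ ≡ just j →
    L u v ≡ true → L u′ v′ ≡ true

  Loopless : ∀ {q} → (Fin n → Maybe (Fin q)) → Digraph n → Set
  Loopless p L = ∀ u v i → p u ≡ just i → p v ≡ just i → L u v ≡ true → ⊥

  miss : Digraph n → ℕ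
  miss L = arcs (λ u v → D u v ∧ not (L u v))

  private
    -- After multiplication by 5, unclassified tails and heads cost `n * n`, arcs inside the initial
    -- classes and arcs in deleted holes cost `n * n` each, and the remaining bad blocks cost
    -- `n * n`. The fifth `n * n` is spare.
    sum-bound : ∀ x g m b s₀ l → 5 * x * m + l ≤ 5 * x * (n * s₀) + n * n → K * s₀ ≤ n → 10 * x ≤ K →
      5 * x * b ≤ n * n → 10 * x * g ≤ n → x * ((g * n + n * g) + (m + b)) ≤ n * n
    sum-bound x g m b s₀ l e₁ e₂ e₃ e₄ e₅ = *-cancelˡ-≤′ 5 (s≤s z≤n) (begin
      5 * (x * ((g * n + n * g) + (m + b)))                ≡⟨ eq₁ x g m b n ⟩
      10 * x * g * n + (5 * x * m + 5 * x * b)             ≤⟨ +-mono-≤ (*-monoˡ-≤ n e₅) (+-mono-≤ (≤-trans (m≤m+n _ l) e₁) e₄) ⟩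
      n * n + (5 * x * (n * s₀) + n * n + n * n)           ≤⟨ +-monoʳ-≤ (n * n) (+-monoˡ-≤ (n * n) (+-monoˡ-≤ (n * n) (begin
        5 * x * (n * s₀)      ≡⟨ eq₂ x n s₀ ⟩
        n * (5 * x * s₀)      ≤⟨ *-monoʳ-≤ n (*-monoˡ-≤ s₀ (*-monoˡ-≤ x (m≤n+m 5 5))) ⟩
        n * (10 * x * s₀)     ≤⟨ *-monoʳ-≤ n (*-monoˡ-≤ s₀ e₃) ⟩
        n * (K * s₀)          ≤⟨ *-monoʳ-≤ n e₂ ⟩
        n * n                 ∎))) ⟩
      n * n + (n * n + n * n + n * n)                      ≤⟨ m≤m+n _ (n * n) ⟩
      n * n + (n * n + n * n + n * n) + n * n              ≡⟨ eq₃ n ⟩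
      5 * (n * n)                                          ∎)
      where
      open ≤-Reasoning
      eq₁ : ∀ x g m b n → 5 * (x * ((g * n + n * g) + (m + b))) ≡ 10 * x * g * n + (5 * x * m + 5 * x * b)
      eq₁ = solve-∀
      eq₂ : ∀ x n s → 5 * x * (n * s) ≡ n * (5 * x * s)
      eq₂ = solve-∀
      eq₃ : ∀ n → n * n + (n * n + n * n + n * n) + n * n ≡ 5 * (n * n)
      eq₃ = solve-∀

  module _ (s₀ : ℕ) (Ks₀≤n : K * s₀ ≤ n) where

    finish : ∀ S q h (p : Fin n → Maybe (Fin q)) L → (∀ i → count n (cls p i) ≡ hh * h) → Loopless p L →
      dd * miss L + arcs L ≤ dd * (n * s₀) + n * n → K * count n (unclassified p) ≤ suc F * n →
      n ≤ S * h → K * (hh * h) ≤ n → dd * (arcs (Clean.bad D dd h p L) * (hh * h * (hh * h))) ≤ n * n →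
      Regular D dd hh ξ S Q
    finish S q h p L size loopless e₁ e₃ e₄ e₆ few-bad = record
      { q = q ; h = h ; p = p ; R = R ; size = size ; n≤S*h = e₄
      ; small = ≤-trans (*-monoˡ-≤ (hh * h) (m≤n+m Q (10 * ξ * suc F))) e₆
      ; irrefl = λ i → ¬true⇒false (λ r → let (u , v , a , b , l) , _ = R⇒ i i r in loopless u v i a b l)
      ; no-hole = λ i j r → proj₂ (R⇒ i j r)
      ; missing = begin
          ξ * arcs (λ u v → D u v ∧ not (blk R (p u) (p v)))    ≤⟨ *-monoʳ-≤ ξ (arcs-∪₄ n cover) ⟩
          ξ * ((arcs (rect U all) + arcs (rect all U)) + (miss L + arcs (λ u v → blk bad (p u) (p v))))
            ≤⟨ *-monoʳ-≤ ξ (+-mono-≤ (≤-reflexive (cong₂ _+_ (arcs-rect n U all) (arcs-rect n all U))) (+-monoʳ-≤ (miss L) bad-blocks)) ⟩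
          ξ * ((count n U * count n all + count n all * count n U) + (miss L + arcs bad * (hh * h * (hh * h))))
            ≡⟨ cong (λ t → ξ * ((count n U * t + t * count n U) + (miss L + arcs bad * (hh * h * (hh * h))))) (count-const n) ⟩
          ξ * ((count n U * n + n * count n U) + (miss L + arcs bad * (hh * h * (hh * h))))
            ≤⟨ sum-bound ξ (count n U) (miss L) _ s₀ (arcs L) e₁ Ks₀≤n 10ξ≤K few-bad garbage ⟩
          n * n ∎ }
      where
      open ≤-Reasoning
      open Clean D dd h p L
      U all : Fin n → Bool
      U = unclassified p
      all _ = true
      10ξ≤K : 10 * ξ ≤ K
      10ξ≤K = ≤-trans (m≤m*n (10 * ξ) (suc F)) (m≤m+n _ Q)
      garbage : 10 * ξ * count n U ≤ n
      garbage = *-cancelˡ-≤′ (suc F) (s≤s z≤n) (≤-trans (≤-trans (≤-reflexive (eq (suc F) (10 * ξ) (count n U)))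
        (*-monoˡ-≤ (count n U) (m≤m+n (10 * ξ * suc F) Q))) e₃)
        where
        eq : ∀ a b c → a * (b * c) ≡ b * a * c
        eq = solve-∀
      good? : ∀ i j → Dec (Live i j × ¬ HasHole D dd h (cls p i) (cls p j))
      good? i j = live? i j ×-dec ¬? (hasHole? D dd h (cls p i) (cls p j))
      R : Digraph q
      R i j = does (good? i j)
      R⇒ : ∀ i j → R i j ≡ true → Live i j × ¬ HasHole D dd h (cls p i) (cls p j)
      R⇒ i j = does⁻ (good? i j)
      cover′ : ∀ u v i j → p u ≡ just i → p v ≡ just j → D u v ≡ true → R i j ≡ false →
        (D u v ∧ not (L u v)) ≡ true ⊎ bad i j ≡ true
      cover′ u v i j a b d r with bool-cases (L u v) | toSum (hasHole? D dd h (cls p i) (cls p j))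
      ... | inj₂ l | _      = inj₁ (∧-intro d (not-intro l))
      ... | inj₁ l | inj₁ x = inj₂ (does⁺ (bad? i j) ((u , v , a , b , l) , x))
      ... | inj₁ l | inj₂ ¬x = ⊥-elim (doesn't⁻ (good? i j) r ((u , v , a , b , l) , ¬x))
      cover : ∀ u v → (D u v ∧ not (blk R (p u) (p v))) ≡ true →
        (rect U all u v ≡ true ⊎ rect all U u v ≡ true) ⊎ ((D u v ∧ not (L u v)) ≡ true ⊎ blk bad (p u) (p v) ≡ true)
      cover u v x with maybe-cases (p u) | maybe-cases (p v)
      ... | inj₁ a | _ = inj₁ (inj₁ (∧-intro (does⁺ (≡-dec Fin._≟_ (p u) nothing) a) refl))
      ... | inj₂ _ | inj₁ b = inj₁ (inj₂ (does⁺ (≡-dec Fin._≟_ (p v) nothing) b))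
      ... | inj₂ (i , a) | inj₂ (j , b) = let d , r = ∧-elim (D u v) x in
            inj₂ (Data.Sum.map₂ (trans (cong₂ (blk bad) a b))
              (cover′ u v i j a b d (trans (sym (cong₂ (blk R) a b)) (not-elim r))))
      block : Fin q → Fin q → Digraph n
      block i j u v = bad i j ∧ rect (cls p i) (cls p j) u v
      block-arcs : ∀ i j → arcs (block i j) ≤ (hh * h * (hh * h)) * ind (bad i j)
      block-arcs i j with bad i j
      ... | true  = ≤-reflexive (trans (arcs-rect n (cls p i) (cls p j)) (trans (cong₂ _*_ (size i) (size j)) (sym (*-identityʳ _))))
      ... | false = ≤-trans (≤-reflexive (sumF-zero n (λ u → count-∅ n {λ _ → false} λ _ ()))) z≤n
      in-block : ∀ u v → blk bad (p u) (p v) ≡ true → ∃ λ i → ∃ λ j → block i j u v ≡ true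
      in-block u v x with maybe-cases (p u) | maybe-cases (p v)
      ... | inj₁ a | _ rewrite a with x
      ...   | ()
      in-block u v x | inj₂ (i , a) | inj₁ b rewrite a | b with x
      ...   | ()
      in-block u v x | inj₂ (i , a) | inj₂ (j , b) =
        i , j , ∧-intro (trans (sym (cong₂ (blk bad) a b)) x) (∧-intro (cls⁺ p i u a) (cls⁺ p j v b))
      bad-blocks : arcs (λ u v → blk bad (p u) (p v)) ≤ arcs bad * (hh * h * (hh * h))
      bad-blocks = begin
        arcs (λ u v → blk bad (p u) (p v))                ≤⟨ arcs-⋃₂ n q block in-block ⟩
        sumF q (λ i → sumF q (λ j → arcs (block i j)))    ≤⟨ sumF-mono q (λ i → sumF-mono q (block-arcs i)) ⟩
        sumF q (λ i → sumF q (λ j → (hh * h * (hh * h)) * ind (bad i j)))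
          ≡⟨ sumF-cong q (λ i → trans (sumF-* q (hh * h * (hh * h)) _) (cong (hh * h * (hh * h) *_) (sym (count≡sumF q (bad i))))) ⟩
        sumF q (λ i → (hh * h * (hh * h)) * count q (bad i)) ≡⟨ sumF-* q (hh * h * (hh * h)) _ ⟩
        (hh * h * (hh * h)) * arcs bad                    ≡⟨ *-comm (hh * h * (hh * h)) _ ⟩
        arcs bad * (hh * h * (hh * h))                    ∎

    -- Three budgets. `dd * miss L + arcs L` never grows, since deleting `H` loses at most
    -- `arcs H / dd` arcs of `D`; `F * arcs L` drops by more than `n * n` per round, which `f` pays
    -- for; and each round may waste another `n / K` vertices.
    loop : ∀ f S q h (p : Fin n → Maybe (Fin q)) L → (∀ i → count n (cls p i) ≡ hh * h) →
      Respects p L → Loopless p L →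
      dd * miss L + arcs L ≤ dd * (n * s₀) + n * n → F * arcs L ≤ f * (n * n) →
      K * count n (unclassified p) + f * n ≤ suc F * n →
      n ≤ S * h → Sfin K f S ≤ n → K * (hh * h) ≤ n → Regular D dd hh ξ (Sfin K f S) Q
    loop f S q h p L size resp loopless e₁ e₂ e₃ e₄ e₅ e₆
      with dd * (arcs (Clean.bad D dd h p L) * (hh * h * (hh * h))) ≤? n * n
    ... | yes few-bad = finish (Sfin K f S) q h p L size loopless e₁ (≤-trans (m≤m+n _ _) e₃)
                          (≤-trans e₄ (*-monoˡ-≤ h (S≤Sfin K K>0 f S))) e₆ few-bad
    ... | no many-bad = go f e₂ e₃ e₅
      where
      open ≤-Reasoning
      open Clean D dd h p L
      -- The failed test says that bad blocks cover more than `n * n / dd` pairs, and a hole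
      -- occupies at least a fraction `1 / (hh * hh)` of its block.
      big : n * n < F * arcs H
      big = begin-strict
        n * n                                        <⟨ ≰⇒> many-bad ⟩
        dd * (arcs bad * (hh * h * (hh * h)))        ≡⟨ eq dd (arcs bad) hh h ⟩
        F * (arcs bad * (h * h))                     ≤⟨ *-monoʳ-≤ F H-large ⟩
        F * arcs H                                   ∎
        where
        eq : ∀ d a c h → d * (a * (c * h * (c * h))) ≡ d * (c * c) * (a * (h * h))
        eq = solve-∀
      H⊆L : ∀ u v → H u v ≡ true → L u v ≡ true
      H⊆L u v x = let i , j , r = does⁻ (H? u v) x
                      a , b = ∧-elim (A i j u) r
                      pu , (u′ , v′ , a′ , b′ , l) = A⇒ i j u a
                  in resp u′ u v′ v i j a′ pu b′ (B⇒ i j v b) l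
      L⁺ : Digraph n
      L⁺ u v = L u v ∧ not (H u v)
      shrink : arcs L⁺ + arcs H ≤ arcs L
      shrink = arcs-⊎ n (λ u v x → proj₁ (∧-elim (L u v) x)) H⊆L
        (λ u v x y → true≢false y (not-elim (proj₂ (∧-elim (L u v) x))))
      miss⁺ : dd * miss L⁺ + arcs L⁺ ≤ dd * (n * s₀) + n * n
      miss⁺ = begin
        dd * miss L⁺ + arcs L⁺                                            ≤⟨ +-monoˡ-≤ _ (*-monoʳ-≤ dd (arcs-∪ n {G = λ u v → H u v ∧ D u v} cover)) ⟩
        dd * (miss L + arcs (λ u v → H u v ∧ D u v)) + arcs L⁺            ≡⟨ eq dd (miss L) (arcs (λ u v → H u v ∧ D u v)) (arcs L⁺) ⟩
        dd * miss L + (arcs L⁺ + dd * arcs (λ u v → H u v ∧ D u v))       ≤⟨ +-monoʳ-≤ (dd * miss L) (+-monoʳ-≤ (arcs L⁺) H-sparse) ⟩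
        dd * miss L + (arcs L⁺ + arcs H)                                  ≤⟨ +-monoʳ-≤ (dd * miss L) shrink ⟩
        dd * miss L + arcs L                                              ≤⟨ e₁ ⟩
        dd * (n * s₀) + n * n                                             ∎
        where
        eq : ∀ d m x l → d * (m + x) + l ≡ d * m + (l + d * x)
        eq = solve-∀
        cover : ∀ u v → (D u v ∧ not (L⁺ u v)) ≡ true → (D u v ∧ not (L u v)) ≡ true ⊎ (H u v ∧ D u v) ≡ true
        cover u v x with ∧-elim (D u v) x
        ... | d , l with L u v | H u v
        ... | true  | true  = inj₂ d
        ... | false | _     = inj₁ (∧-intro d refl)
      q≤S : h ≡ 0 ⊎ q ≤ S
      q≤S with h ≟ 0
      ... | yes z = inj₁ z
      ... | no ¬z = inj₂ (*-cancelˡ-≤′ h (n≢0⇒n>0 ¬z) (begin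
        h * q          ≤⟨ *-monoʳ-≤ h (m≤m*n q hh {{>-nonZero hh>0}}) ⟩
        h * (q * hh)   ≡⟨ eq h q hh ⟩
        q * (hh * h)   ≤⟨ classes-size n p (hh * h) size ⟩
        n              ≤⟨ e₄ ⟩
        S * h          ≡⟨ *-comm S h ⟩
        h * S          ∎))
        where
        eq : ∀ h q c → h * (q * c) ≡ q * (c * h)
        eq = solve-∀
      go : ∀ f → F * arcs L ≤ f * (n * n) → K * count n (unclassified p) + f * n ≤ suc F * n →
        Sfin K f S ≤ n → Regular D dd hh ξ (Sfin K f S) Q
      go zero e₂ _ _ = ⊥-elim (n≮0 (<-≤-trans big (≤-trans (*-monoʳ-≤ F (≤-trans (m≤n+m _ _) shrink)) e₂)))
      go (suc f) e₂ e₃ e₅ with q≤S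
      ... | inj₁ refl = ⊥-elim (<-irrefl refl (<-≤-trans n>0 (≤-trans e₄ (≤-reflexive (*-zeroʳ S)))))
      -- Dividing `h` by `K * labels q` keeps the leftovers small: `q * labels q` labels, each
      -- leaving fewer than `hh * h′` vertices, waste at most `q * (hh * h) / K ≤ n / K`.
      ... | inj₂ q≤S with div-bounds (K * labels q) h (*-mono-≤ K>0 (labels>0 q)) (≤-trans c≤ 2c≤h)
        where
        c≤ : K * labels q ≤ 2 * (K * labels S)
        c≤ = ≤-trans (*-monoʳ-≤ K (labels-mono q≤S)) (m≤n*m _ 2)
        2c≤h : 2 * (K * labels S) ≤ h
        2c≤h = *-cancelˡ-≤′ S (factor>0 S n>0 e₄) (≤-trans (≤-trans (S≤Sfin K K>0 f _) e₅) e₄)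
      ... | h′ , h′>0 , ch′≤h , h≤2ch′ with chop {n} {q * labels q} {hh * h′} lab (*-mono-≤ hh>0 h′>0)
      ... | q′ , p′ , size′ , same , garbage =
        loop f (S * (2 * (K * labels S))) q′ h′ p′ L⁺ size′ resp′ loopless′ miss⁺ fuel garbage′ n≤ e₅
          (≤-trans (*-monoʳ-≤ K (*-monoʳ-≤ hh h′≤h)) e₆)
        where
        instance
          nzc : NonZero (K * labels q)
          nzc = >-nonZero (*-mono-≤ K>0 (labels>0 q))
        h′≤h : h′ ≤ h
        h′≤h = ≤-trans (m≤n*m h′ (K * labels q)) ch′≤h
        resp′ : Respects p′ L⁺
        resp′ u u′ v v′ i j a a′ b b′ x with same u u′ i a a′ | same v v′ j b b′
        ... | l , lu , lu′ | m , lv , lv′ with lab-same u u′ l lu lu′ | lab-same v v′ m lv lv′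
        ... | i′ , pu , pu′ , eA , _ | j′ , pv , pv′ , _ , eB = let x₁ , x₂ = ∧-elim (L u v) x in
              ∧-intro (resp u u′ v v′ i′ j′ pu pu′ pv pv′ x₁)
                (not-intro (¬true⇒false (λ y → true≢false (H-cong u′ u v′ v (λ i j → sym (eA i j)) (λ i j → sym (eB i j)) y) (not-elim x₂))))
        loopless′ : Loopless p′ L⁺
        loopless′ u v i a b x with same u v i a b
        ... | l , lu , lv with lab-same u v l lu lv
        ... | i′ , pu , pv , _ = loopless u v i′ pu pv (proj₁ (∧-elim (L u v) x))
        fuel : F * arcs L⁺ ≤ f * (n * n)
        fuel = +-cancelˡ-≤ (n * n) _ _ (begin
          n * n + F * arcs L⁺          ≤⟨ +-monoˡ-≤ _ (<⇒≤ big) ⟩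
          F * arcs H + F * arcs L⁺     ≡⟨ trans (+-comm (F * arcs H) _) (sym (*-distribˡ-+ F (arcs L⁺) (arcs H))) ⟩
          F * (arcs L⁺ + arcs H)       ≤⟨ *-monoʳ-≤ F shrink ⟩
          F * arcs L                   ≤⟨ e₂ ⟩
          n * n + f * (n * n)          ∎)
        garbage′ : K * count n (unclassified p′) + f * n ≤ suc F * n
        garbage′ = begin
          K * count n (unclassified p′) + f * n
            ≤⟨ +-monoˡ-≤ (f * n) (*-monoʳ-≤ K garbage) ⟩
          K * (count n (unclassified lab) + q * labels q * (hh * h′)) + f * n
            ≤⟨ +-monoˡ-≤ (f * n) (*-monoʳ-≤ K (+-monoˡ-≤ (q * labels q * (hh * h′)) (count-mono n unclassified-lab))) ⟩
          K * (count n (unclassified p) + q * labels q * (hh * h′)) + f * n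
            ≡⟨ eq K (count n (unclassified p)) q (labels q) hh h′ (f * n) ⟩
          K * count n (unclassified p) + (q * (hh * (K * labels q * h′)) + f * n)
            ≤⟨ +-monoʳ-≤ (K * count n (unclassified p)) (+-monoˡ-≤ (f * n) (≤-trans (*-monoʳ-≤ q (*-monoʳ-≤ hh ch′≤h)) (classes-size n p (hh * h) size))) ⟩
          K * count n (unclassified p) + (n + f * n)
            ≤⟨ e₃ ⟩
          suc F * n ∎
          where
          eq : ∀ K g q l c h x → K * (g + q * l * (c * h)) + x ≡ K * g + (q * (c * (K * l * h)) + x)
          eq = solve-∀
        n≤ : n ≤ S * (2 * (K * labels S)) * h′
        n≤ = begin
          n                                   ≤⟨ e₄ ⟩
          S * h                               ≤⟨ *-monoʳ-≤ S h≤2ch′ ⟩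
          S * (2 * (K * labels q) * h′)       ≤⟨ *-monoʳ-≤ S (*-monoˡ-≤ h′ (*-monoʳ-≤ 2 (*-monoʳ-≤ K (labels-mono q≤S)))) ⟩
          S * (2 * (K * labels S) * h′)       ≡⟨ *-assoc S _ h′ ⟨
          S * (2 * (K * labels S)) * h′       ∎

regularity : ∀ ξ hh Q → 0 < ξ → 0 < hh → Σ[ S ∈ ℕ ] ∀ n → S ≤ n → (D : Digraph n) → Regular D (5 * ξ) hh ξ S Q
regularity ξ hh Q ξ>0 hh>0 = S , result
  where
  F K S₀ S : ℕ
  F  = 5 * ξ * (hh * hh)
  K  = 10 * ξ * suc F + Q
  S₀ = 2 * (hh * K)
  S  = Sfin K F S₀
  K>0 : 0 < K
  K>0 = ≤-trans (*-mono-≤ {1} {10 * ξ} (≤-trans ξ>0 (m≤n*m ξ 10)) (s≤s z≤n)) (m≤m+n _ Q)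
  c>0 : 0 < hh * K
  c>0 = *-mono-≤ hh>0 K>0
  result : ∀ n → S ≤ n → (D : Digraph n) → Regular D (5 * ξ) hh ξ S Q
  result n S≤n D with div-bounds (hh * K) n c>0 (≤-trans (m≤n*m _ 2) (≤-trans (S≤Sfin K K>0 F S₀) S≤n))
  ... | h , h>0 , ch≤n , n≤2ch with chop {n} {1} {hh * h} (λ _ → just zero) (*-mono-≤ hh>0 h>0)
  ... | q , p , size , _ , garbage = loop (hh * h) Ks≤n F S₀ q h p L size resp loopless miss₀ (*-monoʳ-≤ F (arcs≤n² n L)) garb n≤2ch S≤n Ks≤n
    where
    open ≤-Reasoning
    n>0 : 0 < n
    n>0 = ≤-trans (*-mono-≤ c>0 h>0) ch≤n
    open RegularityLoop D ξ hh Q hh>0 ξ>0 n>0 using (loop; Respects; Loopless; miss)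
    Ks≤n : K * (hh * h) ≤ n
    Ks≤n = ≤-trans (≤-reflexive (eq K hh h)) ch≤n
      where
      eq : ∀ a b c → a * (b * c) ≡ b * a * c
      eq = solve-∀
    -- Pairs inside a class are dead from the start, which keeps `R` loopless. The unclassified
    -- vertices behave like one more class, of at most the same size, so a vertex loses at most
    -- `hh * h` arcs here.
    L : Digraph n
    L u v = not (does (≡-dec Fin._≟_ (p u) (p v)))
    resp : Respects p L
    resp u u′ v v′ i j a a′ b b′ x =
      trans (cong₂ (λ s t → not (does (≡-dec Fin._≟_ s t))) (trans a′ (sym a)) (trans b′ (sym b))) x
    loopless : Loopless p L
    loopless u v i a b x = doesn't⁻ (≡-dec Fin._≟_ (p u) (p v)) (not-elim x) (trans a (sym b))
    unc≤ : count n (unclassified p) ≤ hh * h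
    unc≤ = ≤-trans garbage (≤-reflexive (trans (cong (_+ (hh * h + 0)) (count-∅ n {unclassified {n} {1} (λ _ → just zero)} λ _ ())) (+-identityʳ _)))
    garb : K * count n (unclassified p) + F * n ≤ suc F * n
    garb = +-monoˡ-≤ (F * n) (≤-trans (*-monoʳ-≤ K unc≤) Ks≤n)
    same-class : ∀ u → count n (λ v → D u v ∧ not (L u v)) ≤ hh * h
    same-class u with maybe-cases (p u)
    ... | inj₁ a = ≤-trans (count-mono n (λ v x → does⁺ (≡-dec Fin._≟_ (p v) nothing)
                     (trans (sym (same-as v x)) a))) unc≤
      where
      same-as : ∀ v → (D u v ∧ not (L u v)) ≡ true → p u ≡ p v
      same-as v x = does⁻ (≡-dec Fin._≟_ (p u) (p v)) (trans (sym (Data.Bool.Properties.not-involutive _)) (proj₂ (∧-elim (D u v) x)))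
    ... | inj₂ (i , a) = ≤-trans (count-mono n (λ v x → cls⁺ p i v
                     (trans (sym (same-as v x)) a))) (≤-reflexive (size i))
      where
      same-as : ∀ v → (D u v ∧ not (L u v)) ≡ true → p u ≡ p v
      same-as v x = does⁻ (≡-dec Fin._≟_ (p u) (p v)) (trans (sym (Data.Bool.Properties.not-involutive _)) (proj₂ (∧-elim (D u v) x)))
    miss₀ : 5 * ξ * miss L + arcs L ≤ 5 * ξ * (n * (hh * h)) + n * n
    miss₀ = +-mono-≤ (*-monoʳ-≤ (5 * ξ) (≤-trans (sumF-mono n same-class) (≤-reflexive (sumF-const n (hh * h))))) (arcs≤n² n L)

-- Antimatchings: vertex-disjoint arcs whose tails lie in X and whose heads lie in Y

verts : ∀ {q} → List (Fin q × Fin q) → List (Fin q)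
verts []            = []
verts ((a , b) ∷ M) = a ∷ b ∷ verts M

record AntiMatching {q : ℕ} (R : Digraph q) (X Y : Fin q → Bool) (M : List (Fin q × Fin q)) : Set where
  constructor antiMatching
  field
    disjoint : Unique (verts M)
    valid    : All (λ e → R (proj₁ e) (proj₂ e) ≡ true × X (proj₁ e) ≡ true × Y (proj₂ e) ≡ true) M

total-verts : ∀ {q} (f : Fin q → ℕ) M → total f (verts M) ≡ total (λ e → f (proj₁ e) + f (proj₂ e)) M
total-verts f []            = refl
total-verts f ((a , b) ∷ M) = trans (cong (λ t → f a + (f b + t)) (total-verts f M)) (sym (+-assoc (f a) (f b) _))

length-verts : ∀ {q} (M : List (Fin q × Fin q)) → length (verts M) ≡ 2 * length M
length-verts []      = refl
length-verts (_ ∷ M) = trans (cong (λ l → suc (suc l)) (length-verts M)) (two (length M))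
  where
  two : ∀ l → suc (suc (2 * l)) ≡ 2 * suc l
  two = solve-∀

verts-↭ : ∀ {q} {M N : List (Fin q × Fin q)} → M ↭ N → verts M ↭ verts N
verts-↭ Perm.refl = ↭-refl
verts-↭ (prep (a , b) p) = prep a (prep b (verts-↭ p))
verts-↭ (Perm.swap (a , b) (c , d) p) = ↭-trans (Perm.shifts (a ∷ b ∷ []) (c ∷ d ∷ []))
  (prep c (prep d (prep a (prep b (verts-↭ p)))))
verts-↭ (Perm.trans p q) = ↭-trans (verts-↭ p) (verts-↭ q)

∈⇒↭ : ∀ {A : Set} {x : A} {xs} → x ∈ xs → ∃ λ ys → xs ↭ x ∷ ys
∈⇒↭ {x = x} x∈ with ∈-∃++ x∈
... | ys , zs , refl = ys ++ zs , Perm.shift x ys zs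

∉⇒All≢ : ∀ {A : Set} {x : A} {xs} → x ∉ xs → All (x ≢_) xs
∉⇒All≢ = Allₚ.¬Any⇒All¬ _

-- `g` marks the good vertices, the only ones with a degree bound. `closedX` and `closedY` make `X`
-- and `Y` the two sides of a union of components of the double cover; they may overlap, so `large`
-- counts their union.
record Dense {q : ℕ} (R : Digraph q) (X Y g : Fin q → Bool) (t b : ℕ) : Set where
  field
    irrefl   : ∀ i → R i i ≡ false
    closedX  : ∀ i j → X i ≡ true → R i j ≡ true → Y j ≡ true
    closedY  : ∀ i j → Y j ≡ true → R i j ≡ true → X i ≡ true
    few-bad  : count q (not ∘ g) ≤ b
    out-deg  : ∀ i → g i ≡ true → X i ≡ true → t + b < outdeg R i
    in-deg   : ∀ j → g j ≡ true → Y j ≡ true → t + b < indeg R j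
    large    : 2 * t + b + 2 ≤ count q (λ i → X i ∨ Y i)

transpose : ∀ {q} → Digraph q → Digraph q
transpose R i j = R j i

flip-arcs : ∀ {q} → List (Fin q × Fin q) → List (Fin q × Fin q)
flip-arcs []            = []
flip-arcs ((a , b) ∷ M) = (b , a) ∷ flip-arcs M

length-flip : ∀ {q} (M : List (Fin q × Fin q)) → length (flip-arcs M) ≡ length M
length-flip []      = refl
length-flip (_ ∷ M) = cong suc (length-flip M)

verts-flip : ∀ {q} (M : List (Fin q × Fin q)) → verts M ↭ verts (flip-arcs M)
verts-flip []            = ↭-refl
verts-flip ((a , b) ∷ M) = Perm.swap a b (verts-flip M)

module _ {q : ℕ} {R : Digraph q} {X Y : Fin q → Bool} where

  flip-anti : ∀ {M} → AntiMatching R X Y M → AntiMatching (transpose R) Y X (flip-arcs M)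
  flip-anti {M} (antiMatching u v) = antiMatching (Unique-resp-↭ (verts-flip M) u) (go M v)
    where
    go : ∀ M → All (λ e → R (proj₁ e) (proj₂ e) ≡ true × X (proj₁ e) ≡ true × Y (proj₂ e) ≡ true) M →
      All (λ e → transpose R (proj₁ e) (proj₂ e) ≡ true × Y (proj₁ e) ≡ true × X (proj₂ e) ≡ true) (flip-arcs M)
    go []      []                  = []
    go (_ ∷ M) ((r , x , y) ∷ v) = (r , y , x) ∷ go M v

  flip-dense : ∀ {g t b} → Dense R X Y g t b → Dense (transpose R) Y X g t b
  flip-dense d = record
    { irrefl = irrefl ; closedX = λ i j → closedY j i ; closedY = λ i j → closedX j i ; few-bad = few-bad
    ; out-deg = in-deg ; in-deg = out-deg
    ; large = ≤-trans large (count-mono q (λ i → [ ∨-introʳ (Y i) , ∨-introˡ ]′ ∘ ∨-elim (X i))) }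
    where open Dense d

  resp-↭ : ∀ {M N} → M ↭ N → AntiMatching R X Y M → AntiMatching R X Y N
  resp-↭ p (antiMatching u v) = antiMatching (Unique-resp-↭ (verts-↭ p) u) (Perm.All-resp-↭ p v)

  extend : ∀ {M x y} → AntiMatching R X Y M → X x ≡ true → Y y ≡ true → R x y ≡ true → x ≢ y →
    x ∉ verts M → y ∉ verts M → AntiMatching R X Y ((x , y) ∷ M)
  extend (antiMatching u v) Xx Yy r x≢y x∉ y∉ =
    antiMatching ((x≢y ∷ ∉⇒All≢ x∉) ∷ ∉⇒All≢ y∉ ∷ u) ((r , Xx , Yy) ∷ v)

  drop-head : ∀ {e M} → AntiMatching R X Y (e ∷ M) → AntiMatching R X Y M
  drop-head (antiMatching (_ ∷ _ ∷ u) (_ ∷ v)) = antiMatching u v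

  Bigger : List (Fin q × Fin q) → Set
  Bigger M = ∃ λ M′ → AntiMatching R X Y M′ × length M′ ≡ suc (length M)

  private
    two-of-four : ∀ a b c d → 2 < (ind a + ind b) + (ind c + ind d) →
      (b ≡ true × c ≡ true) ⊎ (a ≡ true × d ≡ true)
    two-of-four a     true  true  d     _ = inj₁ (refl , refl)
    two-of-four true  b     c     true  _ = inj₂ (refl , refl)
    two-of-four true  true  false false (s≤s (s≤s ()))
    two-of-four true  false true  false (s≤s (s≤s ()))
    two-of-four true  false false false (s≤s ())
    two-of-four false true  false true  (s≤s (s≤s ()))
    two-of-four false true  false false (s≤s ())
    two-of-four false false true  true  (s≤s (s≤s ()))
    two-of-four false false true  false (s≤s ())
    two-of-four false false false true  (s≤s ())

  module Augment {g : Fin q → Bool} {t b : ℕ} (dense : Dense R X Y g t b) where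
    open Dense dense
    open ≤-Reasoning

    private
      swap₁ : ∀ {M} a c {x y} → AntiMatching R X Y ((a , c) ∷ M) → X x ≡ true → Y y ≡ true → x ≢ y →
        x ∉ a ∷ c ∷ verts M → y ∉ a ∷ c ∷ verts M → R x c ≡ true → R a y ≡ true → AntiMatching R X Y ((x , c) ∷ (a , y) ∷ M)
      swap₁ {M} a c {x} {y} A@(antiMatching ((a≢c ∷ a≢) ∷ c≢ ∷ u) ((r , Xa , Yc) ∷ v)) Xx Yy x≢y x∉ y∉ xc ay =
        extend (extend (drop-head A) Xa Yy ay (λ { refl → y∉ (here refl) }) (Allₚ.All¬⇒¬Any a≢) (λ z → y∉ (there (there z))))
          Xx Yc xc (λ { refl → x∉ (there (here refl)) })
          (λ { (here refl) → x∉ (here refl) ; (there (here refl)) → x≢y refl ; (there (there z)) → x∉ (there (there z)) })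
          (λ { (here refl) → a≢c refl ; (there (here refl)) → y∉ (there (here refl)) ; (there (there z)) → Allₚ.All¬⇒¬Any c≢ z })

      -- Here `a` turns from a tail into a head and `c` from a head into a tail. That they lie on
      -- the required sides follows from the closure of `X` and `Y` under the arcs at `x` and `y`.
      swap₂ : ∀ {M} a c {x y} → AntiMatching R X Y ((a , c) ∷ M) → X x ≡ true → Y y ≡ true → x ≢ y →
        x ∉ a ∷ c ∷ verts M → y ∉ a ∷ c ∷ verts M → R x a ≡ true → R c y ≡ true → AntiMatching R X Y ((x , a) ∷ (c , y) ∷ M)
      swap₂ {M} a c {x} {y} A@(antiMatching ((a≢c ∷ a≢) ∷ c≢ ∷ u) ((r , Xa , Yc) ∷ v)) Xx Yy x≢y x∉ y∉ xa cy =
        extend (extend (drop-head A) (closedY c y Yy cy) Yy cy (λ { refl → y∉ (there (here refl)) }) (Allₚ.All¬⇒¬Any c≢) (λ z → y∉ (there (there z))))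
          Xx (closedX x a Xx xa) xa (λ { refl → x∉ (here refl) })
          (λ { (here refl) → x∉ (there (here refl)) ; (there (here refl)) → x≢y refl ; (there (there z)) → x∉ (there (there z)) })
          (λ { (here refl) → a≢c refl ; (there (here refl)) → y∉ (here refl) ; (there (there z)) → Allₚ.All¬⇒¬Any a≢ z })

    private
      uncovered? : ∀ (f : Fin q → Bool) M → (∃ λ z → f z ≡ true × z ∉ verts M) ⊎ (∀ z → f z ≡ true → z ∈ verts M)
      uncovered? f M with Fin.any? (λ z → (f z Data.Bool.≟ true) ×-dec ¬? (z ∈? verts M))
      ... | yes x = inj₁ x
      ... | no ¬x = inj₂ λ z fz → decidable-stable (z ∈? verts M) (λ z∉ → ¬x (z , fz , z∉))

      covered-sum : ∀ f M → (∀ z → f z ≡ true → z ∈ verts M) →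
        count q f ≤ total (λ e → ind (f (proj₁ e)) + ind (f (proj₂ e))) M
      covered-sum f M h = ≤-trans (count-covered q f (verts M) h) (≤-reflexive (total-verts (ind ∘ f) M))

    -- If every neighbour is covered, the at least `2 * t` links of `x` and `y` fall on fewer than
    -- `t` arcs. Some arc then receives three of its four possible links, and any three contain two
    -- that form disjoint arcs on the four vertices.
    augment : ∀ {M x y} → AntiMatching R X Y M → length M < t → X x ≡ true → Y y ≡ true → x ≢ y →
      x ∉ verts M → y ∉ verts M → t ≤ outdeg R x → t ≤ indeg R y → Bigger M
    augment {M} {x} {y} A m<t Xx Yy x≢y x∉ y∉ dx dy with uncovered? (R x) M | uncovered? (λ z → R z y) M
    ... | inj₁ (z , r , z∉) | _ = _ , extend A Xx (closedX x z Xx r) r (λ { refl → true≢false r (irrefl x) }) x∉ z∉ , refl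
    ... | inj₂ _ | inj₁ (z , r , z∉) = _ , extend A (closedY z y Yy r) Yy r (λ { refl → true≢false r (irrefl y) }) z∉ y∉ , refl
    ... | inj₂ cx | inj₂ cy = let e , e∈ , big = total-<⇒∃ {f = λ _ → 2} {g = w} M sum-large in finish e (∈⇒↭ e∈) big
      where
      w : Fin q × Fin q → ℕ
      w (a , c) = (ind (R x a) + ind (R x c)) + (ind (R a y) + ind (R c y))
      sum-large : total (λ _ → 2) M < total w M
      sum-large = begin-strict
        total (λ _ → 2) M   ≡⟨ total-const 2 M ⟩
        length M * 2        <⟨ *-monoˡ-< 2 m<t ⟩
        t * 2               ≡⟨ trans (*-comm t 2) (cong (t +_) (+-identityʳ t)) ⟩
        t + t               ≤⟨ +-mono-≤ dx dy ⟩
        outdeg R x + indeg R y ≤⟨ +-mono-≤ (covered-sum (R x) M cx) (covered-sum (λ z → R z y) M cy) ⟩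
        _                   ≡⟨ total-+ _ _ M ⟨
        total w M           ∎
      finish : ∀ e → (∃ λ M′ → M ↭ e ∷ M′) → 2 < w e → Bigger M
      finish (a , c) (M′ , M↭) big with two-of-four (R x a) (R x c) (R a y) (R c y) big
      ... | inj₁ (xc , ay) = _ , swap₁ a c (resp-↭ M↭ A) Xx Yy x≢y (x∉ ∘ back) (y∉ ∘ back) xc ay , cong suc (sym (Perm.↭-length M↭))
        where
        back : ∀ {z} → z ∈ a ∷ c ∷ verts M′ → z ∈ verts M
        back = Perm.∈-resp-↭ (↭-sym (verts-↭ M↭))
      ... | inj₂ (xa , cy) = _ , swap₂ a c (resp-↭ M↭ A) Xx Yy x≢y (x∉ ∘ back) (y∉ ∘ back) xa cy , cong suc (sym (Perm.↭-length M↭))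
        where
        back : ∀ {z} → z ∈ a ∷ c ∷ verts M′ → z ∈ verts M
        back = Perm.∈-resp-↭ (↭-sym (verts-↭ M↭))

    -- If only vertices of X are uncovered, rerouting an arc through x uncovers a vertex of Y.
    augment-XX : ∀ {M x x′} → AntiMatching R X Y M → length M < t → X x ≡ true → X x′ ≡ true → x ≢ x′ →
      x ∉ verts M → x′ ∉ verts M → g x ≡ true → g x′ ≡ true → Bigger M
    augment-XX {M} {x} {x′} A m<t Xx Xx′ x≢x′ x∉ x′∉ gx gx′ with uncovered? (R x) M
    ... | inj₁ (z , r , z∉) = _ , extend A Xx (closedX x z Xx r) r (λ { refl → true≢false r (irrefl x) }) x∉ z∉ , refl
    ... | inj₂ cx = let e , e∈ , big = total-<⇒∃ {f = f} {g = w} M sum-large in finish e (∈⇒↭ e∈) big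
      where
      w f : Fin q × Fin q → ℕ
      w (a , c) = ind (R x a) + ind (R x c)
      -- A bad head raises the threshold to 2, the maximum of `w`. An arc above the threshold
      -- therefore has both ends adjacent to `x` and a good head, whose in-degree is then available.
      f (a , c) = 1 + ind (not (g c))
      heads-bad : total (λ e → ind (not (g (proj₂ e)))) M ≤ b
      heads-bad = begin
        total (λ e → ind (not (g (proj₂ e)))) M   ≤⟨ total-mono M (λ e _ → m≤n+m _ (ind (not (g (proj₁ e))))) ⟩
        _                                         ≡⟨ total-verts (ind ∘ not ∘ g) M ⟨
        total (ind ∘ not ∘ g) (verts M)           ≤⟨ unique-count q (not ∘ g) (verts M) (AntiMatching.disjoint A) ⟩
        count q (not ∘ g)                         ≤⟨ few-bad ⟩
        b                                         ∎
      sum-large : total f M < total w M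
      sum-large = begin-strict
        total f M                                                       ≡⟨ total-+ (λ _ → 1) _ M ⟩
        total (λ _ → 1) M + total (λ e → ind (not (g (proj₂ e)))) M     ≡⟨ cong (_+ total (λ e → ind (not (g (proj₂ e)))) M) (trans (total-const 1 M) (*-identityʳ (length M))) ⟩
        length M + total (λ e → ind (not (g (proj₂ e)))) M              ≤⟨ +-mono-≤ (<⇒≤ m<t) heads-bad ⟩
        t + b                                                           <⟨ out-deg x gx Xx ⟩
        outdeg R x                                                      ≤⟨ covered-sum (R x) M cx ⟩
        total w M                                                       ∎
      both : ∀ a c d → 1 + ind (not d) < ind a + ind c → (a ≡ true × c ≡ true) × d ≡ true
      both true  true  true  _ = (refl , refl) , refl
      both true  true  false (s≤s (s≤s ()))
      both true  false true  (s≤s ())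
      both true  false false (s≤s ())
      both false true  true  (s≤s ())
      both false true  false (s≤s ())
      finish : ∀ e → (∃ λ M′ → M ↭ e ∷ M′) → f e < w e → Bigger M
      finish (a , c) (M′ , M↭) big with both (R x a) (R x c) (g c) big | resp-↭ M↭ A
      ... | (xa , xc) , gc | A′@(antiMatching ((a≢c ∷ a≢) ∷ c≢ ∷ u) _) =
        let M″ , A″ , len = augment {(x , a) ∷ M′} {x′} {c} rerouted (≤-trans (≤-reflexive (cong suc (sym (Perm.↭-length M↭)))) m<t)
                              Xx′ (closedX x c Xx xc) (λ { refl → x′∉ (back (there (here refl))) })
                              (λ { (here refl) → x≢x′ refl ; (there (here refl)) → x′∉ (back (here refl)) ; (there (there z)) → x′∉ (back (there (there z))) })
                              (λ { (here refl) → x∉ (back (there (here refl))) ; (there (here refl)) → a≢c refl ; (there (there z)) → Allₚ.All¬⇒¬Any c≢ z })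
                              (≤-trans (m≤m+n t b) (<⇒≤ (out-deg x′ gx′ Xx′)))
                              (≤-trans (m≤m+n t b) (<⇒≤ (in-deg c gc (closedX x c Xx xc))))
        in M″ , A″ , trans len (cong suc (sym (Perm.↭-length M↭)))
        where
        back : ∀ {z} → z ∈ a ∷ c ∷ verts M′ → z ∈ verts M
        back = Perm.∈-resp-↭ (↭-sym (verts-↭ M↭))
        rerouted : AntiMatching R X Y ((x , a) ∷ M′)
        rerouted = extend (drop-head A′) Xx (closedX x a Xx xa) xa (λ { refl → true≢false xa (irrefl x) })
          (λ z → x∉ (back (there (there z)))) (Allₚ.All¬⇒¬Any a≢)

open Augment using (augment; augment-XX)

module _ {q : ℕ} {R : Digraph q} {X Y g : Fin q → Bool} {t b : ℕ} (dense : Dense R X Y g t b) where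
  open Dense dense

  -- `M` covers fewer than `2 * t` vertices and at most `b` are bad, so `large` leaves two good
  -- uncovered ones. If both lie in `Y`, the case of two vertices in `X` applies to the transposed
  -- digraph.
  grow : ∀ {M} → AntiMatching R X Y M → length M < t → Bigger {R = R} {X} {Y} M
  grow {M} A m<t = pair (count>0⇒∃ q (≤-trans (s≤s z≤n) two))
    where
    open ≤-Reasoning
    V U : Fin q → Bool
    V i = (X i ∨ Y i) ∧ g i
    U = V ∖ verts M
    two : 2 ≤ count q U
    two = +-cancelʳ-≤ (2 * t + b) 2 _ (begin
      2 + (2 * t + b)                               ≡⟨ +-comm 2 _ ⟩
      2 * t + b + 2                                 ≤⟨ large ⟩
      count q (λ i → X i ∨ Y i)                     ≤⟨ count-∪ q (λ i x → Data.Sum.map (∧-intro x) not-intro (bool-cases (g i))) ⟩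
      count q V + count q (not ∘ g)
                                                    ≤⟨ +-mono-≤ (count-∖ q V (verts M)) few-bad ⟩
      count q U + total (ind ∘ V) (verts M) + b             ≤⟨ +-monoˡ-≤ b (+-monoʳ-≤ (count q U) (begin
        total (ind ∘ V) (verts M)                 ≤⟨ total-mono (verts M) (λ v _ → ind≤1 (V v)) ⟩
        total (λ _ → 1) (verts M)         ≡⟨ total-verts (λ _ → 1) M ⟩
        total (λ _ → 2) M                 ≡⟨ total-const 2 M ⟩
        length M * 2                      ≤⟨ *-monoˡ-≤ 2 (<⇒≤ m<t) ⟩
        t * 2                             ≡⟨ *-comm t 2 ⟩
        2 * t                             ∎)) ⟩
      count q U + 2 * t + b                         ≡⟨ +-assoc (count q U) _ b ⟩
      count q U + (2 * t + b)                       ∎)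
    open-U : ∀ i → U i ≡ true → ((X i ≡ true ⊎ Y i ≡ true) × g i ≡ true) × i ∉ verts M
    open-U i x = let a , c = ∖-elim V (verts M) i x ; a₁ , a₂ = ∧-elim (X i ∨ Y i) a in (∨-elim (X i) a₁ , a₂) , c
    XX : ∀ {x x′} → X x ≡ true → X x′ ≡ true → x ≢ x′ → x ∉ verts M → x′ ∉ verts M → g x ≡ true → g x′ ≡ true → Bigger {R = R} {X} {Y} M
    XX Xx Xx′ = augment-XX dense A m<t Xx Xx′
    YY : ∀ {y y′} → Y y ≡ true → Y y′ ≡ true → y ≢ y′ → y ∉ verts M → y′ ∉ verts M → g y ≡ true → g y′ ≡ true → Bigger {R = R} {X} {Y} M
    YY Yy Yy′ y≢ y∉ y′∉ gy gy′ =
      let M′ , A′ , len = augment-XX (flip-dense dense) (flip-anti A) (subst (_< t) (sym (length-flip M)) m<t) Yy Yy′ y≢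
                            (y∉ ∘ Perm.∈-resp-↭ (↭-sym (verts-flip M))) (y′∉ ∘ Perm.∈-resp-↭ (↭-sym (verts-flip M))) gy gy′
      in flip-arcs M′ , flip-anti A′ , trans (length-flip M′) (trans len (cong suc (length-flip M)))
    XY : ∀ {x y} → X x ≡ true → Y y ≡ true → x ≢ y → x ∉ verts M → y ∉ verts M → g x ≡ true → g y ≡ true → Bigger {R = R} {X} {Y} M
    XY {x} {y} Xx Yy x≢y x∉ y∉ gx gy = augment dense A m<t Xx Yy x≢y x∉ y∉
      (≤-trans (m≤m+n t b) (<⇒≤ (out-deg x gx Xx))) (≤-trans (m≤m+n t b) (<⇒≤ (in-deg y gy Yy)))
    pair : (∃ λ u → U u ≡ true) → Bigger {R = R} {X} {Y} M
    pair (u , Uu) with count-<⇒∃ q {λ v → does (v Fin.≟ u)} (subst (_< count q U) (sym (count-⁅⁆ q u)) two)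
    ... | v , Uv , v≠u with open-U u Uu | open-U v Uv | doesn't⁻ (v Fin.≟ u) v≠u
    ... | (inj₁ Xu , gu) , u∉ | (inj₁ Xv , gv) , v∉ | v≢u = XX Xu Xv (v≢u ∘ sym) u∉ v∉ gu gv
    ... | (inj₁ Xu , gu) , u∉ | (inj₂ Yv , gv) , v∉ | v≢u = XY Xu Yv (v≢u ∘ sym) u∉ v∉ gu gv
    ... | (inj₂ Yu , gu) , u∉ | (inj₁ Xv , gv) , v∉ | v≢u = XY Xv Yu v≢u v∉ u∉ gv gu
    ... | (inj₂ Yu , gu) , u∉ | (inj₂ Yv , gv) , v∉ | v≢u = YY Yu Yv (v≢u ∘ sym) u∉ v∉ gu gv

  antimatching : ∀ m → m ≤ t → ∃ λ M → AntiMatching R X Y M × length M ≡ m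
  antimatching zero    _   = [] , antiMatching [] [] , refl
  antimatching (suc m) m<t with antimatching m (<⇒≤ m<t)
  ... | M , A , refl = grow A m<t

-- Alternating walks: from (true , i) one moves along an arc of R, from (false , i) against it

adj : ∀ {q} → Digraph q → Bool → Digraph q
adj R true  i j = R i j
adj R false i j = R j i

data Walk {q : ℕ} (R : Digraph q) : Bool → Fin q → Bool → Fin q → ℕ → Set where
  stop : ∀ {r i} → Walk R r i r i 0
  step : ∀ {r i j r′ i′ l} → adj R r i j ≡ true → Walk R (not r) j r′ i′ l → Walk R r i r′ i′ (suc l)

module _ {q : ℕ} {R : Digraph q} where

  _▹_ : ∀ {r i r′ i′ r″ i″ l m} → Walk R r i r′ i′ l → Walk R r′ i′ r″ i″ m → Walk R r i r″ i″ (l + m)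
  stop     ▹ v = v
  step e w ▹ v = step e (w ▹ v)

  reverse-walk : ∀ {r i r′ i′ l} → Walk R r i r′ i′ l → Walk R r′ i′ r i l
  reverse-walk stop = stop
  reverse-walk {r = r} {i} (step {j = j} {l = l} e w) =
    subst (Walk R _ _ _ _) (+-comm l 1) (reverse-walk w ▹ back r e)
    where
    back : ∀ r {i j} → adj R r i j ≡ true → Walk R (not r) j r i 1
    back true  e = step e stop
    back false e = step e stop

-- The two sides of the component of `(true , i₀)` in the double cover. The bound `2 * q` on walks
-- to the root is the number of vertices of this cover.
record Component {q : ℕ} (R : Digraph q) (i₀ : Fin q) : Set where
  field
    Comp   : Bool → Fin q → Bool
    root   : Comp true i₀ ≡ true
    closed : ∀ r i j → adj R r i j ≡ true → Comp (not r) j ≡ true → Comp r i ≡ true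
    toRoot : ∀ r i → Comp r i ≡ true → ∃ λ l → l ≤ 2 * q × Walk R r i true i₀ l

  closed′ : ∀ r i j → adj R r i j ≡ true → Comp r i ≡ true → Comp (not r) j ≡ true
  closed′ true  i j e c = closed false j i e c
  closed′ false i j e c = closed true j i e c

  connect : ∀ r i r′ i′ → Comp r i ≡ true → Comp r′ i′ ≡ true → ∃ λ l → l ≤ 2 * q + 2 * q × Walk R r i r′ i′ l
  connect r i r′ i′ c c′ with toRoot r i c | toRoot r′ i′ c′
  ... | l , l≤ , w | l′ , l′≤ , w′ = l + l′ , +-mono-≤ l≤ l′≤ , w ▹ reverse-walk w′

module _ {q : ℕ} (R : Digraph q) (i₀ : Fin q) where

  private
    reached : (Bool → Fin q → Bool) → ℕ
    reached C = count q (C true) + count q (C false)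

    reached≤ : ∀ C → reached C ≤ 2 * q
    reached≤ C = +-mono-≤ (count≤n q (C true)) (≤-trans (count≤n q (C false)) (≤-reflexive (sym (+-identityʳ q))))

    next? : ∀ (C : Bool → Fin q → Bool) r i → Dec (∃ λ j → (adj R r i j ∧ C (not r) j) ≡ true)
    next? C r i = Fin.any? (λ j → (adj R r i j ∧ C (not r) j) Data.Bool.≟ true)

    expand : (Bool → Fin q → Bool) → Bool → Fin q → Bool
    expand C r i = C r i ∨ does (next? C r i)

    new? : ∀ (C : Bool → Fin q → Bool) r → Dec (∃ λ i → expand C r i ≡ true × C r i ≡ false)
    new? C r = Fin.any? (λ i → (expand C r i Data.Bool.≟ true) ×-dec (C r i Data.Bool.≟ false))

    mono : ∀ (C : Bool → Fin q → Bool) r → count q (C r) ≤ count q (expand C r)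
    mono C r = count-mono q (λ i → ∨-introˡ)

    strict : ∀ (C : Bool → Fin q → Bool) r i → expand C r i ≡ true → C r i ≡ false → suc (count q (C r)) ≤ count q (expand C r)
    strict C r i e c = ≤-trans (≤-reflexive (cong (_+ count q (C r)) (sym (count-⁅⁆ q i))))
      (count-⊎ q (λ j x → subst (λ z → expand C r z ≡ true) (sym (does⁻ (j Fin.≟ i) x)) e) (λ j → ∨-introˡ)
        (λ j x y → true≢false y (trans (cong (C r) (does⁻ (j Fin.≟ i) x)) c)))

    grows : ∀ (C : Bool → Fin q → Bool) r → (∃ λ i → expand C r i ≡ true × C r i ≡ false) → suc (reached C) ≤ reached (expand C)
    grows C true  (i , e , c) = +-mono-≤ (strict C true i e c) (mono C false)
    grows C false (i , e , c) = ≤-trans (≤-reflexive (sym (+-suc (count q (C true)) _))) (+-mono-≤ (mono C true) (strict C false i e c))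

    -- `m` rounds are done and `f` remain. Every unfinished round reaches something new, so
    -- `f + reached C` stays at least `2 * q`; with no fuel left everything is reached and no
    -- further growth is possible.
    bfs : ∀ f m (C : Bool → Fin q → Bool) → C true i₀ ≡ true → (∀ r i → C r i ≡ true → ∃ λ l → l ≤ m × Walk R r i true i₀ l) →
      m + f ≤ 2 * q → 2 * q ≤ f + reached C → Component R i₀
    continue : ∀ f m (C : Bool → Fin q → Bool) → C true i₀ ≡ true → (∀ r i → C r i ≡ true → ∃ λ l → l ≤ m × Walk R r i true i₀ l) →
      m + f ≤ 2 * q → 2 * q ≤ f + reached C → suc (reached C) ≤ reached (expand C) → Component R i₀

    bfs f m C root walks mf enough with toSum (new? C true) | toSum (new? C false)
    ... | inj₁ x | _      = continue f m C root walks mf enough (grows C true x)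
    ... | inj₂ _ | inj₁ x = continue f m C root walks mf enough (grows C false x)
    ... | inj₂ n₁ | inj₂ n₂ = record { Comp = C ; root = root ; closed = closed
            ; toRoot = λ r i c → let l , l≤ , w = walks r i c in l , ≤-trans l≤ (≤-trans (m≤m+n m f) mf) , w }
      where
      closed : ∀ r i j → adj R r i j ≡ true → C (not r) j ≡ true → C r i ≡ true
      closed r i j e c with bool-cases (C r i)
      ... | inj₁ x = x
      closed true  i j e c | inj₂ x = ⊥-elim (n₁ (i , ∨-introʳ _ (does⁺ (next? C true i) (j , ∧-intro e c)) , x))
      closed false i j e c | inj₂ x = ⊥-elim (n₂ (i , ∨-introʳ _ (does⁺ (next? C false i) (j , ∧-intro e c)) , x))

    continue zero    m C root walks mf en g = ⊥-elim (<-irrefl refl (<-≤-trans (≤-trans (s≤s en) g) (reached≤ (expand C))))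
    continue (suc f) m C root walks mf en g = bfs f (suc m) (expand C) (∨-introˡ root) walks′
      (≤-trans (≤-reflexive (sym (+-suc m f))) mf) (≤-trans en (≤-trans (≤-reflexive (sym (+-suc f _))) (+-monoʳ-≤ f g)))
      where
      walks′ : ∀ r i → expand C r i ≡ true → ∃ λ l → l ≤ suc m × Walk R r i true i₀ l
      walks′ r i c with ∨-elim (C r i) c
      ... | inj₁ x = let l , l≤ , w = walks r i x in l , m≤n⇒m≤1+n l≤ , w
      ... | inj₂ x = let j , y = does⁻ (next? C r i) x
                         e , z = ∧-elim (adj R r i j) y
                         l , l≤ , w = walks (not r) j z in suc l , s≤s l≤ , step e w

  component : Component R i₀
  component = bfs (2 * q) 0 C₀ (does⁺ (i₀ Fin.≟ i₀) refl) walks₀ ≤-refl (m≤m+n _ _)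
    where
    C₀ : Bool → Fin q → Bool
    C₀ true  i = does (i Fin.≟ i₀)
    C₀ false i = false
    walks₀ : ∀ r i → C₀ r i ≡ true → ∃ λ l → l ≤ 0 × Walk R r i true i₀ l
    walks₀ true i c with i Fin.≟ i₀
    ... | yes refl = 0 , z≤n , stop

-- From the semidegree of `D` to a large antimatching in the reduced digraph

blk-transpose : ∀ {q} (R : Digraph q) x y → blk (transpose R) x y ≡ blk R y x
blk-transpose R (just i) (just j) = refl
blk-transpose R (just i) nothing  = refl
blk-transpose R nothing  (just j) = refl
blk-transpose R nothing  nothing  = refl

blk⇒ : ∀ {q} (R : Digraph q) x y → blk R x y ≡ true → ∃ λ i → ∃ λ j → x ≡ just i × y ≡ just j × R i j ≡ true
blk⇒ R (just i) (just j) r = i , j , refl , refl , r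

sumF-ind : ∀ q s (f : Fin q → Bool) → sumF q (λ j → s * ind (f j)) ≡ s * count q f
sumF-ind q s f = trans (sumF-* q s (ind ∘ f)) (cong (s *_) (sym (count≡sumF q f)))

markov : ∀ n c N (f : Fin n → ℕ) → count n (λ u → does (N <? c * f u)) * N ≤ c * sumF n f
markov n c N f = begin
  count n (λ u → does (N <? c * f u)) * N           ≡⟨ *-comm _ N ⟩
  N * count n (λ u → does (N <? c * f u))           ≡⟨ sumF-ind n N _ ⟨
  sumF n (λ u → N * ind (does (N <? c * f u)))      ≤⟨ sumF-mono n pointwise ⟩
  sumF n (λ u → c * f u)                            ≡⟨ sumF-* n c f ⟩
  c * sumF n f                                      ∎
  where
  open ≤-Reasoning
  pointwise : ∀ u → N * ind (does (N <? c * f u)) ≤ c * f u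
  pointwise u = by (does (N <? c * f u)) (does⁻ (N <? c * f u))
    where
    by : ∀ b → (b ≡ true → N < c * f u) → N * ind b ≤ c * f u
    by true  h = ≤-trans (≤-reflexive (*-identityʳ N)) (<⇒≤ (h refl))
    by false h = ≤-trans (≤-reflexive (*-zeroʳ N)) z≤n

module _ {n q s : ℕ} (p : Fin n → Maybe (Fin q)) (size : ∀ i → count n (cls p i) ≡ s) where

  union-size : ∀ (f : Fin q → Bool) {A : Fin n → Bool} → (∀ v → A v ≡ true → ∃ λ j → p v ≡ just j × f j ≡ true) →
    count n A ≤ s * count q f
  union-size f {A} h = begin
    count n A                                          ≤⟨ count-⋃ n q (λ j v → f j ∧ cls p j v) (λ v a →
                                                            let j , b , c = h v a in j , ∧-intro c (cls⁺ p j v b)) ⟩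
    sumF q (λ j → count n (λ v → f j ∧ cls p j v))     ≤⟨ sumF-mono q part ⟩
    sumF q (λ j → s * ind (f j))                       ≡⟨ sumF-ind q s f ⟩
    s * count q f                                      ∎
    where
    open ≤-Reasoning
    part : ∀ j → count n (λ v → f j ∧ cls p j v) ≤ s * ind (f j)
    part j with f j
    ... | true  = ≤-reflexive (trans (size j) (sym (*-identityʳ s)))
    ... | false = ≤-trans (≤-reflexive (count-∅ n {λ _ → false} λ _ ())) z≤n

  union-size′ : ∀ (f : Fin q → Bool) {A : Fin n → Bool} → (∀ v j → p v ≡ just j → f j ≡ true → A v ≡ true) →
    s * count q f ≤ count n A
  union-size′ f {A} h = begin
    s * count q f                                      ≡⟨ sumF-ind q s f ⟨
    sumF q (λ j → s * ind (f j))                       ≤⟨ sumF-mono q part ⟩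
    sumF q (λ j → count n (λ v → f j ∧ cls p j v))     ≤⟨ count-⨄ n q (λ j v → f j ∧ cls p j v)
                                                            (λ j v x → let a , b = ∧-elim (f j) x in h v j (cls⁻ p j v b) a)
                                                            (λ j j′ v x y → cls-disjoint p j j′ v (proj₂ (∧-elim (f j) x)) (proj₂ (∧-elim (f j′) y))) ⟩
    count n A                                          ∎
    where
    open ≤-Reasoning
    part : ∀ j → s * ind (f j) ≤ count n (λ v → f j ∧ cls p j v)
    part j with f j
    ... | true  = ≤-reflexive (trans (*-identityʳ s) (sym (size j)))
    ... | false = ≤-trans (≤-reflexive (*-zeroʳ s)) z≤n

  degree-split : ∀ (D : Digraph n) (R : Digraph q) u i → p u ≡ just i →
    outdeg D u ≤ s * outdeg R i + count n (λ v → D u v ∧ not (blk R (p u) (p v)))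
  degree-split D R u i a = ≤-trans (count-∪ n {g = kept} (λ v d → Data.Sum.map (∧-intro d) (∧-intro d ∘ not-intro) (bool-cases (blk R (p u) (p v)))))
    (+-monoˡ-≤ (count n (λ v → D u v ∧ not (blk R (p u) (p v)))) (union-size (R i) nbr))
    where
    kept : Fin n → Bool
    kept v = D u v ∧ blk R (p u) (p v)
    nbr : ∀ v → kept v ≡ true → ∃ λ j → p v ≡ just j × R i j ≡ true
    nbr v x with blk⇒ R (p u) (p v) (proj₂ (∧-elim (D u v) x))
    ... | i′ , j , e , e′ , r with trans (sym a) e
    ... | refl = j , e′ , r

-- The arcs (a , b) in the antimatching carry the bulk of the tree, Comp connects them.
record Frame {n : ℕ} (D : Digraph n) (dd ζ S k : ℕ) : Set where
  field
    q h     : ℕ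
    p       : Fin n → Maybe (Fin q)
    R       : Digraph q
    size    : ∀ i → count n (cls p i) ≡ ζ * (8 * dd) * h
    n≤S*h   : n ≤ S * h
    no-hole : ∀ i j → R i j ≡ true → ¬ HasHole D dd h (cls p i) (cls p j)
    i₀      : Fin q
    comp    : Component R i₀
  open Component comp public
  field
    M           : List (Fin q × Fin q)
    matching    : AntiMatching R (Comp true) (Comp false) M
    -- The loads of both roles must fit into `t` classes of size `s` each. The `3 * cs` kept back
    -- per class are the connector, the part of the bulk that stays free, and the rounding error of
    -- the assignment.
    capacity    : suc k + 6 * (length M * (8 * dd * h)) ≤ 2 * (length M * (ζ * (8 * dd) * h))

-- In units of `n / (32 * m)`: the semidegree exceeds `k / 2` by 16, a good vertex loses at most 4,
-- all bad classes together have at most 1, a single class has at most 2, and `t * s` is aimed at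
-- `k / 2` plus 8.
module Reduction {n : ℕ} (D : Digraph n) (m k dd S : ℕ) (m>0 : 0 < m) (n>0 : 0 < n) (dd>0 : 0 < dd)
  (anti : ∀ u v → D u v ≡ true → D v u ≡ false)
  (outs : ∀ v → m * k + n ≤ 2 * m * outdeg D v) (ins : ∀ v → m * k + n ≤ 2 * m * indeg D v) where

  module _ (reg : Regular D dd (16 * m * (8 * dd)) (512 * (m * m)) S (16 * m)) where
    open Regular reg

    private
      s : ℕ
      s = 16 * m * (8 * dd) * h

      h>0 : 0 < h
      h>0 = factor>0 h n>0 (≤-trans n≤S*h (≤-reflexive (*-comm S h)))

      s>0 : 0 < s
      s>0 = *-mono-≤ (*-mono-≤ (≤-trans m>0 (m≤n*m m 16)) (≤-trans dd>0 (m≤n*m dd 8))) h>0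

      lost : Digraph n
      lost u v = D u v ∧ not (blk R (p u) (p v))

      bo bi bv : Fin n → Bool
      bo u = does (n <? 8 * m * outdeg lost u)
      bi u = does (n <? 8 * m * indeg lost u)
      bv u = bo u ∨ bi u

      -- Combined with `markov`: at most `n * n / (512 * (m * m))` arcs are lost in total, so at
      -- most `n / (64 * m)` vertices can lose more than `n / (8 * m)` in one direction.
      few : ∀ c x → c * n ≤ 8 * m * x → 512 * (m * m) * x ≤ n * n → 64 * m * c ≤ n
      few c x e₁ e₂ = *-cancelˡ-≤′ n n>0 (begin
        n * (64 * m * c)      ≡⟨ eq₁ n m c ⟩
        64 * m * (c * n)      ≤⟨ *-monoʳ-≤ (64 * m) e₁ ⟩
        64 * m * (8 * m * x)  ≡⟨ eq₂ m x ⟩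
        512 * (m * m) * x     ≤⟨ e₂ ⟩
        n * n                 ∎)
        where
        open ≤-Reasoning
        eq₁ : ∀ n m c → n * (64 * m * c) ≡ 64 * m * (c * n)
        eq₁ = solve-∀
        eq₂ : ∀ m x → 64 * m * (8 * m * x) ≡ 512 * (m * m) * x
        eq₂ = solve-∀

      few-bv : 32 * m * count n bv ≤ n
      few-bv = *-cancelˡ-≤′ 2 (s≤s z≤n) (begin
        2 * (32 * m * count n bv)                   ≡⟨ eq m (count n bv) ⟩
        64 * m * count n bv                         ≤⟨ *-monoʳ-≤ (64 * m) (count-∪ n (λ u → ∨-elim (bo u))) ⟩
        64 * m * (count n bo + count n bi)          ≡⟨ *-distribˡ-+ (64 * m) (count n bo) _ ⟩
        64 * m * count n bo + 64 * m * count n bi   ≤⟨ +-mono-≤ (few _ (arcs lost) (markov n (8 * m) n _) missing)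
                                                         (few _ (arcs lost) (≤-trans (markov n (8 * m) n _) (≤-reflexive (cong (8 * m *_) (sym (arcs-transpose n lost))))) missing) ⟩
        n + n                                       ≡⟨ cong (n +_) (+-identityʳ n) ⟨
        2 * n                                       ∎)
        where
        open ≤-Reasoning
        eq : ∀ m c → 2 * (32 * m * c) ≡ 64 * m * c
        eq = solve-∀

      lost-out : ∀ u → bv u ≡ false → 8 * m * outdeg lost u ≤ n
      lost-out u g = ≮⇒≥ (doesn't⁻ (n <? 8 * m * outdeg lost u) (proj₁ (∨-false (bo u) g)))

      lost-in : ∀ u → bv u ≡ false → 8 * m * indeg lost u ≤ n
      lost-in u g = ≮⇒≥ (doesn't⁻ (n <? 8 * m * indeg lost u) (proj₂ (∨-false (bo u) g)))

      -- An unclassified vertex loses all its arcs, at least `n / (2 * m)` of them, far beyond what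
      -- a good vertex may lose.
      good-classified : ∀ u → bv u ≡ false → ∃ λ i → p u ≡ just i
      good-classified u g with maybe-cases (p u)
      ... | inj₂ x = x
      ... | inj₁ x = ⊥-elim (<⇒≱ (m<m+n n n>0) (begin
        n + n                    ≤⟨ m≤m+n (n + n) (2 * n + 4 * (m * k)) ⟩
        n + n + (2 * n + 4 * (m * k)) ≡⟨ eq n (m * k) ⟩
        4 * (m * k + n)          ≤⟨ *-monoʳ-≤ 4 (outs u) ⟩
        4 * (2 * m * outdeg D u) ≡⟨ eq′ m (outdeg D u) ⟩
        8 * m * outdeg D u       ≤⟨ *-monoʳ-≤ (8 * m) (count-mono n (λ v d → ∧-intro d (trans (cong (λ y → not (blk R y (p v))) x) refl))) ⟩
        8 * m * outdeg lost u    ≤⟨ lost-out u g ⟩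
        n                        ∎))
        where
        open ≤-Reasoning
        eq : ∀ n x → n + n + (2 * n + 4 * x) ≡ 4 * (x + n)
        eq = solve-∀
        eq′ : ∀ m x → 4 * (2 * m * x) ≡ 8 * m * x
        eq′ = solve-∀

      -- One good vertex is enough: the arcs it keeps lead into out-neighbours (or come from
      -- in-neighbours) of its class in `R`, so its degrees force those of the class.
      good? : ∀ i → Dec (∃ λ u → p u ≡ just i × bv u ≡ false)
      good? i = Fin.any? (λ u → ≡-dec Fin._≟_ (p u) (just i) ×-dec (bv u Data.Bool.≟ false))

      g : Fin q → Bool
      g i = does (good? i)

      b : ℕ
      b = count q (not ∘ g)

      few-b : 32 * m * (s * b) ≤ n
      few-b = ≤-trans (*-monoʳ-≤ (32 * m) (union-size′ p size (not ∘ g) (λ v j a x →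
        decidable-stable (bv v Data.Bool.≟ true) (λ y → doesn't⁻ (good? j) (not-elim x) (v , a , ¬true⇒false y))))) few-bv

      degree-bound : ∀ d a x → m * k + n ≤ 2 * m * d → d ≤ s * a + x → 8 * m * x ≤ n → 16 * (m * k) + 12 * n ≤ 32 * m * (s * a)
      degree-bound d a x e₁ e₂ e₃ = +-cancelʳ-≤ (4 * n) _ _ (begin
        16 * (m * k) + 12 * n + 4 * n      ≡⟨ eq₁ (m * k) n ⟩
        16 * (m * k + n)                   ≤⟨ *-monoʳ-≤ 16 e₁ ⟩
        16 * (2 * m * d)                   ≤⟨ *-monoʳ-≤ 16 (*-monoʳ-≤ (2 * m) e₂) ⟩
        16 * (2 * m * (s * a + x))         ≡⟨ eq₂ m (s * a) x ⟩
        32 * m * (s * a) + 4 * (8 * m * x) ≤⟨ +-monoʳ-≤ (32 * m * (s * a)) (*-monoʳ-≤ 4 e₃) ⟩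
        32 * m * (s * a) + 4 * n           ∎)
        where
        open ≤-Reasoning
        eq₁ : ∀ x n → 16 * x + 12 * n + 4 * n ≡ 16 * (x + n)
        eq₁ = solve-∀
        eq₂ : ∀ m y x → 16 * (2 * m * (y + x)) ≡ 32 * m * y + 4 * (8 * m * x)
        eq₂ = solve-∀

      lost-in′ : ∀ u → count n (λ v → D v u ∧ not (blk (transpose R) (p u) (p v))) ≤ indeg lost u
      lost-in′ u = count-mono n (λ v x → trans (cong (λ y → D v u ∧ not y) (sym (blk-transpose R (p u) (p v)))) x)

      out-bound : ∀ i → g i ≡ true → 16 * (m * k) + 12 * n ≤ 32 * m * (s * outdeg R i)
      out-bound i x = let u , a , y = does⁻ (good? i) x in
        degree-bound _ _ _ (outs u) (degree-split p size D R u i a) (lost-out u y)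

      in-bound : ∀ i → g i ≡ true → 16 * (m * k) + 12 * n ≤ 32 * m * (s * indeg R i)
      in-bound i x = let u , a , y = does⁻ (good? i) x in
        degree-bound _ _ _ (ins u) (degree-split p size (transpose D) (transpose R) u i a)
          (≤-trans (*-monoʳ-≤ (8 * m) (lost-in′ u)) (lost-in u y))

      4ms>0 : 0 < 4 * m * s
      4ms>0 = *-mono-≤ (≤-trans m>0 (m≤n*m m 4)) s>0

      instance
        4ms≢0 : NonZero (4 * m * s)
        4ms≢0 = >-nonZero 4ms>0

      -- `t * s` is about `k / 2 + n / (4 * m)`: above `k / 2`, so that the tree fits, and below the
      -- degree `k / 2 + 3 * n / (8 * m)` of a good class, so that the exchange argument applies.
      t : ℕ
      t = (2 * (m * k) + n) / (4 * m * s)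

      t-upper : t * (4 * m * s) ≤ 2 * (m * k) + n
      t-upper = m/n*n≤m (2 * (m * k) + n) (4 * m * s)

      t-lower : 2 * (m * k) + n ≤ 4 * m * s + t * (4 * m * s)
      t-lower = ≤-trans (≤-reflexive (m≡m%n+[m/n]*n (2 * (m * k) + n) (4 * m * s)))
        (+-monoˡ-≤ (t * (4 * m * s)) (<⇒≤ (m%n<n (2 * (m * k) + n) (4 * m * s))))

      scale : ∀ a c x → 32 * m * (s * (a * t + c * b + x)) ≤ a * (16 * (m * k) + 8 * n) + c * n + x * (2 * n)
      scale a c x = begin
        32 * m * (s * (a * t + c * b + x))
          ≡⟨ eq m s a t c b x ⟩
        a * (8 * (t * (4 * m * s))) + c * (32 * m * (s * b)) + x * (2 * (16 * m * s))
          ≤⟨ +-mono-≤ (+-mono-≤ (*-monoʳ-≤ a (*-monoʳ-≤ 8 t-upper)) (*-monoʳ-≤ c few-b)) (*-monoʳ-≤ x (*-monoʳ-≤ 2 small)) ⟩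
        a * (8 * (2 * (m * k) + n)) + c * n + x * (2 * n)
          ≡⟨ cong (λ y → a * y + c * n + x * (2 * n)) (eq′ (m * k) n) ⟩
        a * (16 * (m * k) + 8 * n) + c * n + x * (2 * n) ∎
        where
        open ≤-Reasoning
        eq : ∀ m s a t c b x → 32 * m * (s * (a * t + c * b + x)) ≡
          a * (8 * (t * (4 * m * s))) + c * (32 * m * (s * b)) + x * (2 * (16 * m * s))
        eq = solve-∀
        eq′ : ∀ x n → 8 * (2 * x + n) ≡ 16 * x + 8 * n
        eq′ = solve-∀

      unscale : ∀ {a c} → 32 * m * (s * a) ≤ 32 * m * (s * c) → a ≤ c
      unscale h = *-cancelˡ-≤′ s s>0 (*-cancelˡ-≤′ (32 * m) (≤-trans m>0 (m≤n*m m 32)) h)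

      deg-R : ∀ a → 16 * (m * k) + 12 * n ≤ 32 * m * (s * a) → t + b < a
      deg-R a e = unscale (begin
        32 * m * (s * suc (t + b))                           ≡⟨ cong (λ y → 32 * m * (s * y)) (eq t b) ⟩
        32 * m * (s * (1 * t + 1 * b + 1))                   ≤⟨ scale 1 1 1 ⟩
        1 * (16 * (m * k) + 8 * n) + 1 * n + 1 * (2 * n)     ≤⟨ m≤m+n _ n ⟩
        1 * (16 * (m * k) + 8 * n) + 1 * n + 1 * (2 * n) + n ≡⟨ eq′ (m * k) n ⟩
        16 * (m * k) + 12 * n                                ≤⟨ e ⟩
        32 * m * (s * a)                                     ∎)
        where
        open ≤-Reasoning
        eq : ∀ t b → suc (t + b) ≡ 1 * t + 1 * b + 1
        eq = solve-∀
        eq′ : ∀ x n → 1 * (16 * x + 8 * n) + 1 * n + 1 * (2 * n) + n ≡ 16 * x + 12 * n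
        eq′ = solve-∀

      good-vertex : ∃ λ u → bv u ≡ false
      good-vertex = let u , _ , x = count-<⇒∃ n {bv} {λ _ → true} (≤-trans fewer (≤-reflexive (sym (count-const n)))) in u , x
        where
        fewer : count n bv < n
        fewer with count n bv in eq
        ... | zero = n>0
        ... | suc c = begin
          suc (suc c)         ≤⟨ s≤s (m≤m+n (suc c) c) ⟩
          suc (suc c + c)     ≡⟨ two c ⟩
          2 * suc c           ≤⟨ *-monoˡ-≤ (suc c) (≤-trans (s≤s (s≤s z≤n)) (*-monoʳ-≤ 32 m>0)) ⟩
          32 * m * suc c      ≡⟨ cong (32 * m *_) eq ⟨
          32 * m * count n bv ≤⟨ few-bv ⟩
          n                   ∎
          where
          open ≤-Reasoning
          two : ∀ c → suc (suc c + c) ≡ 2 * suc c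
          two = solve-∀

      start : ∃ λ i → g i ≡ true
      start = let u , x = good-vertex ; i , a = good-classified u x in i , does⁺ (good? i) (u , a , x)

    module FrameAt (i₀ : Fin q) (gi₀ : g i₀ ≡ true) where
      open Component (component R i₀)

      private
        X Y : Fin q → Bool
        X = Comp true
        Y = Comp false

        toY : ∀ i j → X i ≡ true → R i j ≡ true → Y j ≡ true
        toY i j x r = closed′ true i j r x

        toX : ∀ i j → Y j ≡ true → R i j ≡ true → X i ≡ true
        toX i j y r = closed true i j r y

        XY : Fin q → Bool
        XY i = X i ∨ Y i

        large-if : ∀ a → 32 * (m * k) + 23 * n ≤ 32 * m * (s * a) → 2 * t + b + 2 ≤ a
        large-if a e = unscale (begin
          32 * m * (s * (2 * t + b + 2))                       ≡⟨ cong (λ y → 32 * m * (s * (2 * t + y + 2))) (*-identityˡ b) ⟨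
          32 * m * (s * (2 * t + 1 * b + 2))                   ≤⟨ scale 2 1 2 ⟩
          2 * (16 * (m * k) + 8 * n) + 1 * n + 2 * (2 * n)     ≤⟨ m≤m+n _ (2 * n) ⟩
          2 * (16 * (m * k) + 8 * n) + 1 * n + 2 * (2 * n) + 2 * n ≡⟨ eq (m * k) n ⟩
          32 * (m * k) + 23 * n                                ≤⟨ e ⟩
          32 * m * (s * a)                                     ∎)
          where
          open ≤-Reasoning
          eq : ∀ x n → 2 * (16 * x + 8 * n) + 1 * n + 2 * (2 * n) + 2 * n ≡ 32 * x + 23 * n
          eq = solve-∀

        -- A vertex whose class lies in both X and Y sees disjoint out- and in-neighbourhoods, by orientation.
        large-overlap : ∀ z → X z ≡ true → Y z ≡ true → g z ≡ true → 2 * t + b + 2 ≤ count q XY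
        large-overlap z Xz Yz gz with does⁻ (good? z) gz
        ... | u , pu , gu = large-if (count q XY) (+-cancelʳ-≤ (8 * n) _ _ (begin
          32 * (m * k) + 23 * n + 8 * n                     ≤⟨ m≤m+n _ n ⟩
          32 * (m * k) + 23 * n + 8 * n + n                 ≡⟨ eq₁ (m * k) n ⟩
          16 * (m * k + n) + 16 * (m * k + n)               ≤⟨ +-mono-≤ (*-monoʳ-≤ 16 (outs u)) (*-monoʳ-≤ 16 (ins u)) ⟩
          16 * (2 * m * outdeg D u) + 16 * (2 * m * indeg D u) ≡⟨ eq₂ m (outdeg D u) (indeg D u) ⟩
          32 * m * (outdeg D u + indeg D u)                 ≤⟨ *-monoʳ-≤ (32 * m) split ⟩
          32 * m * (s * count q XY + (outdeg lost u + indeg lost u)) ≡⟨ eq₃ m (s * count q XY) (outdeg lost u) (indeg lost u) ⟩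
          32 * m * (s * count q XY) + (4 * (8 * m * outdeg lost u) + 4 * (8 * m * indeg lost u))
                                                            ≤⟨ +-monoʳ-≤ (32 * m * (s * count q XY)) (+-mono-≤ (*-monoʳ-≤ 4 (lost-out u gu)) (*-monoʳ-≤ 4 (lost-in u gu))) ⟩
          32 * m * (s * count q XY) + (4 * n + 4 * n)       ≡⟨ cong (32 * m * (s * count q XY) +_) (eq₄ n) ⟩
          32 * m * (s * count q XY) + 8 * n                 ∎))
          where
          open ≤-Reasoning
          eq₁ : ∀ x n → 32 * x + 23 * n + 8 * n + n ≡ 16 * (x + n) + 16 * (x + n)
          eq₁ = solve-∀
          eq₂ : ∀ m x y → 16 * (2 * m * x) + 16 * (2 * m * y) ≡ 32 * m * (x + y)
          eq₂ = solve-∀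
          eq₃ : ∀ m a x y → 32 * m * (a + (x + y)) ≡ 32 * m * a + (4 * (8 * m * x) + 4 * (8 * m * y))
          eq₃ = solve-∀
          eq₄ : ∀ n → 4 * n + 4 * n ≡ 8 * n
          eq₄ = solve-∀
          eq₅ : ∀ a b c d → (a + b) + (c + d) ≡ (a + c) + (b + d)
          eq₅ = solve-∀
          O I : Fin n → Bool
          O v = D u v ∧ blk R (p u) (p v)
          I v = D v u ∧ blk R (p v) (p u)
          inXY : ∀ v → (O v ∨ I v) ≡ true → ∃ λ j → p v ≡ just j × XY j ≡ true
          inXY v x with ∨-elim (O v) x
          ... | inj₁ o with blk⇒ R (p u) (p v) (proj₂ (∧-elim (D u v) o))
          ... | i , j , e , e′ , r with trans (sym pu) e
          ... | refl = j , e′ , ∨-introʳ (X j) (toY z j Xz r)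
          inXY v x | inj₂ o with blk⇒ R (p v) (p u) (proj₂ (∧-elim (D v u) o))
          ... | i , j , e , e′ , r with trans (sym pu) e′
          ... | refl = i , e , ∨-introˡ (toX i z Yz r)
          split : outdeg D u + indeg D u ≤ s * count q XY + (outdeg lost u + indeg lost u)
          split = begin
            outdeg D u + indeg D u
              ≤⟨ +-mono-≤ (count-∪ n {g = O} (λ v d → Data.Sum.map (∧-intro d) (∧-intro d ∘ not-intro) (bool-cases (blk R (p u) (p v)))))
                          (count-∪ n {g = I} (λ v d → Data.Sum.map (∧-intro d) (∧-intro d ∘ not-intro) (bool-cases (blk R (p v) (p u))))) ⟩
            (count n O + outdeg lost u) + (count n I + indeg lost u)
              ≡⟨ eq₅ (count n O) (outdeg lost u) (count n I) (indeg lost u) ⟩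
            (count n O + count n I) + (outdeg lost u + indeg lost u)
              ≤⟨ +-monoˡ-≤ _ (≤-trans (count-⊎ n {h = λ v → O v ∨ I v} (λ v → ∨-introˡ) (λ v → ∨-introʳ (O v))
                   (λ v x y → true≢false (proj₁ (∧-elim (D v u) y)) (anti u v (proj₁ (∧-elim (D u v) x)))))
                   (union-size p size XY inXY)) ⟩
            s * count q XY + (outdeg lost u + indeg lost u) ∎

        good-out : ∀ (f : Fin q → Bool) → count q f ≤ count q (λ j → f j ∧ g j) + b
        good-out f = count-∪ q (λ j x → Data.Sum.map (∧-intro x) not-intro (bool-cases (g j)))

        -- Take a good out-neighbour `y₀` of `i₀`. The out-neighbours of `i₀` lie in `Y` and the
        -- in-neighbours of `y₀` in `X`; their good parts are disjoint when no good class lies on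
        -- both sides, so the two degrees add up, at a cost of `2 * b`.
        large-disjoint : (∀ z → X z ≡ true → Y z ≡ true → g z ≡ true → ⊥) → 2 * t + b + 2 ≤ count q XY
        large-disjoint none = +-cancelʳ-≤ (2 * b) (2 * t + b + 2) (count q XY) (≤-trans degrees neighbours)
          where
          open ≤-Reasoning
          good-nbr : ∃ λ j → R i₀ j ≡ true × not (g j) ≡ false
          good-nbr = count-<⇒∃ q (≤-trans (s≤s (m≤n+m b t)) (deg-R _ (out-bound i₀ gi₀)))
          y₀ : Fin q
          y₀ = proj₁ good-nbr
          Yy₀ : Y y₀ ≡ true
          Yy₀ = toY i₀ y₀ root (proj₁ (proj₂ good-nbr))
          gy₀ : g y₀ ≡ true
          gy₀ = trans (sym (Data.Bool.Properties.not-involutive _)) (cong not (proj₂ (proj₂ good-nbr)))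
          out inn : Fin q → Bool
          out j = R i₀ j ∧ g j
          inn j = R j y₀ ∧ g j
          eq₁ : ∀ t b → 2 * t + b + 2 + 2 * b ≡ 2 * t + 3 * b + 2
          eq₁ = solve-∀
          eq₂ : ∀ x n → 2 * (16 * x + 8 * n) + 3 * n + 2 * (2 * n) + n ≡ (16 * x + 12 * n) + (16 * x + 12 * n)
          eq₂ = solve-∀
          eq₃ : ∀ m s x y → 32 * m * (s * x) + 32 * m * (s * y) ≡ 32 * m * (s * (x + y))
          eq₃ = solve-∀
          eq₄ : ∀ x b y → (x + b) + (y + b) ≡ (x + y) + 2 * b
          eq₄ = solve-∀
          degrees : 2 * t + b + 2 + 2 * b ≤ outdeg R i₀ + indeg R y₀
          degrees = unscale {2 * t + b + 2 + 2 * b} {outdeg R i₀ + indeg R y₀} (begin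
            32 * m * (s * (2 * t + b + 2 + 2 * b))               ≡⟨ cong (λ y → 32 * m * (s * y)) (eq₁ t b) ⟩
            32 * m * (s * (2 * t + 3 * b + 2))                   ≤⟨ scale 2 3 2 ⟩
            2 * (16 * (m * k) + 8 * n) + 3 * n + 2 * (2 * n)     ≤⟨ m≤m+n _ n ⟩
            2 * (16 * (m * k) + 8 * n) + 3 * n + 2 * (2 * n) + n ≡⟨ eq₂ (m * k) n ⟩
            (16 * (m * k) + 12 * n) + (16 * (m * k) + 12 * n)    ≤⟨ +-mono-≤ (out-bound i₀ gi₀) (in-bound y₀ gy₀) ⟩
            32 * m * (s * outdeg R i₀) + 32 * m * (s * indeg R y₀) ≡⟨ eq₃ m s (outdeg R i₀) (indeg R y₀) ⟩
            32 * m * (s * (outdeg R i₀ + indeg R y₀))            ∎)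
          neighbours : outdeg R i₀ + indeg R y₀ ≤ count q XY + 2 * b
          neighbours = begin
            outdeg R i₀ + indeg R y₀                             ≤⟨ +-mono-≤ (good-out (R i₀)) (good-out (λ j → R j y₀)) ⟩
            (count q out + b) + (count q inn + b)                ≡⟨ eq₄ (count q out) b (count q inn) ⟩
            (count q out + count q inn) + 2 * b                  ≤⟨ +-monoˡ-≤ (2 * b) (count-⊎ q {out} {inn} {XY}
                                                                     (λ j x → ∨-introʳ (X j) (toY i₀ j root (proj₁ (∧-elim (R i₀ j) x))))
                                                                     (λ j x → ∨-introˡ (toX j y₀ Yy₀ (proj₁ (∧-elim (R j y₀) x))))
                                                                     (λ j x y → none j (toX j y₀ Yy₀ (proj₁ (∧-elim (R j y₀) y)))
                                                                       (toY i₀ j root (proj₁ (∧-elim (R i₀ j) x))) (proj₂ (∧-elim (R i₀ j) x)))) ⟩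
            count q XY + 2 * b                                   ∎

        large : 2 * t + b + 2 ≤ count q XY
        large with Fin.any? (λ z → (X z Data.Bool.≟ true) ×-dec (Y z Data.Bool.≟ true) ×-dec (g z Data.Bool.≟ true))
        ... | yes (z , x , y , w) = large-overlap z x y w
        ... | no none = large-disjoint (λ z x y w → none (z , x , y , w))

        dense : Dense R X Y g t b
        dense = record { irrefl = irrefl ; closedX = toY ; closedY = toX ; few-bad = ≤-refl
          ; out-deg = λ i gi _ → deg-R _ (out-bound i gi) ; in-deg = λ j gj _ → deg-R _ (in-bound j gj) ; large = large }

        cs : ℕ
        cs = 8 * dd * h

        -- After multiplication by `8 * m`, twice `t * s` exceeds `k` by `4 * n` up to rounding.
        -- Since `s = 16 * m * cs`, the reserve costs `3 * t * s`, covered by `2 * n`; the extra 1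
        -- in `suc k` and the rounding of `t` take `n` each.
        capacity : 2 * t ≤ q → suc k + 6 * (t * cs) ≤ 2 * (t * s)
        capacity 2t≤q = *-cancelˡ-≤′ (8 * m) (≤-trans m>0 (m≤n*m m 8)) (+-cancelʳ-≤ n _ _ (begin
          8 * m * (suc k + 6 * (t * cs)) + n
            ≡⟨ eq₁ m k t dd h n ⟩
          8 * (m * k) + 8 * m + (t * s + 2 * t * s) + n
            ≤⟨ +-monoˡ-≤ n (+-mono-≤ (+-monoʳ-≤ (8 * (m * k)) 8m≤n) (+-mono-≤ (≤-trans (*-monoˡ-≤ s (m≤n*m t 2)) 2ts≤n) 2ts≤n)) ⟩
          8 * (m * k) + n + (n + n) + n
            ≡⟨ eq₂ (m * k) n ⟩
          4 * (2 * (m * k) + n)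
            ≤⟨ *-monoʳ-≤ 4 t-lower ⟩
          4 * (4 * m * s + t * (4 * m * s))
            ≡⟨ eq₃ m s t ⟩
          8 * m * (2 * (t * s)) + 16 * m * s
            ≤⟨ +-monoʳ-≤ (8 * m * (2 * (t * s))) small ⟩
          8 * m * (2 * (t * s)) + n ∎))
          where
          open ≤-Reasoning
          2ts≤n : 2 * t * s ≤ n
          2ts≤n = ≤-trans (*-monoˡ-≤ s 2t≤q) (classes-size n p s size)
          8m≤n : 8 * m ≤ n
          8m≤n = ≤-trans (*-monoˡ-≤ m (m≤n+m 8 8)) (≤-trans (m≤m*n (16 * m) s {{>-nonZero s>0}}) small)
          eq₁ : ∀ m k t d h n → 8 * m * (suc k + 6 * (t * (8 * d * h))) + n ≡
            8 * (m * k) + 8 * m + (t * (16 * m * (8 * d) * h) + 2 * t * (16 * m * (8 * d) * h)) + n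
          eq₁ = solve-∀
          eq₂ : ∀ x n → 8 * x + n + (n + n) + n ≡ 4 * (2 * x + n)
          eq₂ = solve-∀
          eq₃ : ∀ m s t → 4 * (4 * m * s + t * (4 * m * s)) ≡ 8 * m * (2 * (t * s)) + 16 * m * s
          eq₃ = solve-∀

      frame-at : Frame D dd (16 * m) S k
      frame-at with antimatching dense t ≤-refl
      ... | M , A , len = record
        { q = q ; h = h ; p = p ; R = R ; size = size ; n≤S*h = n≤S*h ; no-hole = no-hole ; i₀ = i₀
        ; comp = component R i₀ ; M = M ; matching = A
        ; capacity = subst (λ t → suc k + 6 * (t * cs) ≤ 2 * (t * s)) (sym len)
            (capacity (subst (_≤ q) (trans (length-verts M) (cong (2 *_) len)) (unique-length q (verts M) (AntiMatching.disjoint A)))) }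

    frame : Frame D dd (16 * m) S k
    frame = FrameAt.frame-at (proj₁ start) (proj₂ start)

open Reduction using (frame)

-- Rooted forests

-- Left-child right-sibling encoding: in `v ⟨ F ⟩ G` the children of `v` are the roots of `F`, and
-- `G` holds the trees beside `v`.
data Forest (m : ℕ) : Set where
  ∅     : Forest m
  _⟨_⟩_ : Fin m → Forest m → Forest m → Forest m

module _ {m : ℕ} where

  nodes : Forest m → List (Fin m)
  nodes ∅           = []
  nodes (v ⟨ F ⟩ G) = v ∷ nodes F ++ nodes G

  edges : Fin m → Forest m → List (Fin m × Fin m)
  edges p ∅           = []
  edges p (v ⟨ F ⟩ G) = (p , v) ∷ edges v F ++ edges p G

  width : Forest m → ℕ
  width ∅           = 0
  width (v ⟨ F ⟩ G) = suc (width G)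

  order : Forest m → ℕ
  order ∅           = 0
  order (v ⟨ F ⟩ G) = suc (order F + order G)

  length-nodes : ∀ F → length (nodes F) ≡ order F
  length-nodes ∅           = refl
  length-nodes (v ⟨ F ⟩ G) = cong suc (trans (length-++ (nodes F)) (cong₂ _+_ (length-nodes F) (length-nodes G)))

  data Mem (u : Fin m) : Forest m → Set where
    here  : ∀ {F G} → Mem u (u ⟨ F ⟩ G)
    down  : ∀ {v F G} → Mem u F → Mem u (v ⟨ F ⟩ G)
    right : ∀ {v F G} → Mem u G → Mem u (v ⟨ F ⟩ G)

  mem : ∀ {u} F → u ∈ nodes F → Mem u F
  mem (v ⟨ F ⟩ G) (here refl) = here
  mem (v ⟨ F ⟩ G) (there u∈) with ∈-++⁻ (nodes F) u∈
  ... | inj₁ x = down (mem F x)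
  ... | inj₂ x = right (mem G x)

  insert : ∀ {u F} → Mem u F → Fin m → Forest m
  insert {u} (here {F} {G})     w = u ⟨ w ⟨ ∅ ⟩ F ⟩ G
  insert (down {v} {F} {G} x)   w = v ⟨ insert x w ⟩ G
  insert (right {v} {F} {G} x)  w = v ⟨ F ⟩ insert x w

  nodes-insert : ∀ {u F} (x : Mem u F) w → nodes (insert x w) ↭ w ∷ nodes F
  nodes-insert {u} (here {F} {G}) w = Perm.swap u w ↭-refl
  nodes-insert (down {v} {F} {G} x) w = ↭-trans (prep v (Perm.++⁺ʳ (nodes G) (nodes-insert x w))) (Perm.swap v w ↭-refl)
  nodes-insert (right {v} {F} {G} x) w =
    ↭-trans (prep v (Perm.++⁺ˡ (nodes F) (nodes-insert x w))) (Perm.shift w (v ∷ nodes F) (nodes G))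

  edges-insert : ∀ {u F} p (x : Mem u F) w → edges p (insert x w) ↭ (u , w) ∷ edges p F
  edges-insert {u} p (here {F} {G}) w = Perm.swap (p , u) (u , w) ↭-refl
  edges-insert {u} p (down {v} {F} {G} x) w =
    ↭-trans (prep (p , v) (Perm.++⁺ʳ (edges p G) (edges-insert v x w))) (Perm.swap (p , v) (u , w) ↭-refl)
  edges-insert {u} p (right {v} {F} {G} x) w =
    ↭-trans (prep (p , v) (Perm.++⁺ˡ (edges v F) (edges-insert p x w))) (Perm.shift (u , w) ((p , v) ∷ edges v F) (edges p G))

-- A rooted spanning tree of `T`

arcs-unique : ∀ n (E : Digraph n) l → Unique l → All (λ e → E (proj₁ e) (proj₂ e) ≡ true) l → length l ≤ arcs E
arcs-unique n E [] _ _ = z≤n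
arcs-unique n E ((u , v) ∷ l) (x∉ ∷ uniq) (e ∷ es) = begin
  suc (length l)                        ≤⟨ s≤s (arcs-unique n E′ l uniq (All.zipWith (λ { {a , b} (x≢ , y) →
                                             ∧-intro y (not-intro (¬true⇒false (λ z → x≢ (sym (single⇒ a b z))))) }) (x∉ , es))) ⟩
  suc (arcs E′)                         ≡⟨ cong (_+ arcs E′) (sym (trans (arcs-rect n _ _) (cong₂ _*_ (count-⁅⁆ n u) (count-⁅⁆ n v)))) ⟩
  arcs single + arcs E′                 ≤⟨ arcs-⊎ n (λ a b z → subst (λ w → E (proj₁ w) (proj₂ w) ≡ true) (sym (single⇒ a b z)) e)
                                             (λ a b z → proj₁ (∧-elim (E a b) z))
                                             (λ a b z w → true≢false z (not-elim (proj₂ (∧-elim (E a b) w)))) ⟩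
  arcs E                                ∎
  where
  open ≤-Reasoning
  single E′ : Digraph n
  single = rect (λ a → does (a Fin.≟ u)) (λ b → does (b Fin.≟ v))
  E′ a b = E a b ∧ not (single a b)
  single⇒ : ∀ a b → single a b ≡ true → (a , b) ≡ (u , v)
  single⇒ a b z = let x , y = ∧-elim (does (a Fin.≟ u)) z in cong₂ _,_ (does⁻ (a Fin.≟ u) x) (does⁻ (b Fin.≟ v) y)

module _ {k : ℕ} (T : Digraph (suc k)) (conn : Connected T) (k-arcs : arcs T ≡ k) where

  private
    V : Set
    V = Fin (suc k)

    crossing : ∀ (done : List V) {a b} → Star (UAdj T) a b → a ∈ done → b ∉ done →
      ∃ λ u → ∃ λ w → u ∈ done × w ∉ done × UAdj T u w
    crossing done ε a∈ b∉ = ⊥-elim (b∉ a∈)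
    crossing done (_◅_ {a} {c} e s) a∈ b∉ with c ∈? done
    ... | yes c∈ = crossing done s c∈ b∉
    ... | no c∉  = a , c , a∈ , c∉ , e

    oriented-arc : ∀ {u w} → UAdj T u w → Σ[ e ∈ V × V ] T (proj₁ e) (proj₂ e) ≡ true × ((e ≡ (u , w)) ⊎ (e ≡ (w , u)))
    oriented-arc (inj₁ x) = _ , x , inj₁ refl
    oriented-arc (inj₂ x) = _ , x , inj₂ refl

    -- `A` lists the arcs of `T` behind the forest edges, in their true direction. Once all vertices
    -- are reached it has `k` distinct entries, and `arcs T ≡ k` then leaves no other arc.
    record Grown (F : Forest (suc k)) (A : List (V × V)) : Set where
      field
        unique  : Unique (zero ∷ nodes F)
        adjs    : All (λ e → UAdj T (proj₁ e) (proj₂ e)) (edges zero F)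
        a-uniq  : Unique A
        a-arcs  : All (λ e → T (proj₁ e) (proj₂ e) ≡ true) A
        a-in    : All (λ e → proj₁ e ∈ zero ∷ nodes F × proj₂ e ∈ zero ∷ nodes F) A
        a-edges : All (λ e → e ∈ edges zero F ⊎ (proj₂ e , proj₁ e) ∈ edges zero F) A
        len     : length A ≡ length (nodes F)

    attach : ∀ F u w → u ∈ zero ∷ nodes F → Σ[ F′ ∈ Forest (suc k) ] nodes F′ ↭ w ∷ nodes F × edges zero F′ ↭ (u , w) ∷ edges zero F
    attach F u w (here refl) = w ⟨ ∅ ⟩ F , ↭-refl , ↭-refl
    attach F u w (there u∈)  = insert (mem F u∈) w , nodes-insert (mem F u∈) w , edges-insert zero (mem F u∈) w

    grow-one : ∀ {F A} → Grown F A → ∀ u w → u ∈ zero ∷ nodes F → w ∉ zero ∷ nodes F → UAdj T u w →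
      Σ[ F′ ∈ Forest (suc k) ] Σ[ e ∈ V × V ] Grown F′ (e ∷ A) × length (nodes F′) ≡ suc (length (nodes F))
    grow-one {F} {A} gr u w u∈ w∉ uw with attach F u w u∈ | oriented-arc uw
    ... | F′ , pn , pe | e , te , e≡ = F′ , e , record
          { unique  = Unique-resp-↭ (↭-trans (Perm.swap w zero ↭-refl) (prep zero (↭-sym pn))) (∉⇒All≢ w∉ ∷ unique)
          ; adjs    = Perm.All-resp-↭ (↭-sym pe) (uw ∷ adjs)
          ; a-uniq  = ∉⇒All≢ (λ e∈ → w∉ (w-in e≡ (All.lookup a-in e∈))) ∷ a-uniq
          ; a-arcs  = te ∷ a-arcs
          ; a-in    = ends e≡ ∷ All.map (λ (x , y) → old x , old y) a-in
          ; a-edges = edge e≡ ∷ All.map (Data.Sum.map old-edge old-edge) a-edges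
          ; len     = trans (cong suc len) (sym (Perm.↭-length pn)) } , Perm.↭-length pn
      where
      open Grown gr
      old : ∀ {x} → x ∈ zero ∷ nodes F → x ∈ zero ∷ nodes F′
      old (here x)  = here x
      old (there x) = there (Perm.∈-resp-↭ (↭-sym pn) (there x))
      new : w ∈ zero ∷ nodes F′
      new = there (Perm.∈-resp-↭ (↭-sym pn) (here refl))
      old-edge : ∀ {x} → x ∈ edges zero F → x ∈ edges zero F′
      old-edge x = Perm.∈-resp-↭ (↭-sym pe) (there x)
      w-in : ∀ {e} → (e ≡ (u , w)) ⊎ (e ≡ (w , u)) → proj₁ e ∈ zero ∷ nodes F × proj₂ e ∈ zero ∷ nodes F → w ∈ zero ∷ nodes F
      w-in (inj₁ refl) = proj₂
      w-in (inj₂ refl) = proj₁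
      ends : ∀ {e} → (e ≡ (u , w)) ⊎ (e ≡ (w , u)) → proj₁ e ∈ zero ∷ nodes F′ × proj₂ e ∈ zero ∷ nodes F′
      ends (inj₁ refl) = old u∈ , new
      ends (inj₂ refl) = new , old u∈
      edge : ∀ {e} → (e ≡ (u , w)) ⊎ (e ≡ (w , u)) → e ∈ edges zero F′ ⊎ (proj₂ e , proj₁ e) ∈ edges zero F′
      edge (inj₁ refl) = inj₁ (Perm.∈-resp-↭ (↭-sym pe) (here refl))
      edge (inj₂ refl) = inj₂ (Perm.∈-resp-↭ (↭-sym pe) (here refl))

  record Spanning : Set where
    field
      F       : Forest (suc k)
      unique  : Unique (zero ∷ nodes F)
      covers  : ∀ v → v ∈ zero ∷ nodes F
      adjs    : All (λ e → UAdj T (proj₁ e) (proj₂ e)) (edges zero F)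
      all-arcs : ∀ u v → T u v ≡ true → (u , v) ∈ edges zero F ⊎ (v , u) ∈ edges zero F

  private
    finish : ∀ F A → Grown F A → (∀ v → v ∈ zero ∷ nodes F) → Spanning
    finish F A gr cov = record { F = F ; unique = unique ; covers = cov ; adjs = adjs ; all-arcs = all-arcs }
      where
      open Grown gr
      open ≤-Reasoning
      many : k ≤ length A
      many = ≤-pred (begin
        suc k                                      ≡⟨ count-const (suc k) ⟨
        count (suc k) (λ _ → true)                 ≤⟨ count-covered (suc k) (λ _ → true) (zero ∷ nodes F) (λ v _ → cov v) ⟩
        total (λ _ → 1) (zero ∷ nodes F)           ≡⟨ trans (total-const 1 (zero ∷ nodes F)) (*-identityʳ _) ⟩
        suc (length (nodes F))                     ≡⟨ cong suc len ⟨
        suc (length A)                             ∎)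
      all-arcs : ∀ u v → T u v ≡ true → (u , v) ∈ edges zero F ⊎ (v , u) ∈ edges zero F
      all-arcs u v t with Data.List.Relation.Unary.Any.any? (Data.Product.Properties.≡-dec Fin._≟_ Fin._≟_ (u , v)) A
      ... | yes uv∈ = All.lookup a-edges uv∈
      ... | no uv∉ = ⊥-elim (<-irrefl refl (begin-strict
              k                     ≤⟨ many ⟩
              length A              <⟨ arcs-unique (suc k) T ((u , v) ∷ A) (∉⇒All≢ uv∉ ∷ a-uniq) (t ∷ a-arcs) ⟩
              arcs T                ≡⟨ k-arcs ⟩
              k                     ∎))

    span-from : ∀ f F A → Grown F A → k ≤ length (nodes F) + f → Spanning
    span-from f F A gr bound with Fin.any? (λ v → ¬? (v ∈? (zero ∷ nodes F)))
    ... | no none = finish F A gr (λ v → decidable-stable (v ∈? (zero ∷ nodes F)) (λ v∉ → none (v , v∉)))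
    span-from zero F A gr bound | yes (v , v∉) = ⊥-elim (<-irrefl refl (begin-strict
        suc k                         <⟨ s≤s (s≤s (≤-trans bound (≤-reflexive (+-identityʳ _)))) ⟩
        length (v ∷ zero ∷ nodes F)   ≤⟨ unique-length (suc k) (v ∷ zero ∷ nodes F) (∉⇒All≢ v∉ ∷ Grown.unique gr) ⟩
        suc k                         ∎))
      where open ≤-Reasoning
    span-from (suc f) F A gr bound | yes (v , v∉) with crossing (zero ∷ nodes F) (conn zero v) (here refl) v∉
    ... | u , w , u∈ , w∉ , uw with grow-one gr u w u∈ w∉ uw
    ... | F′ , e , gr′ , len = span-from f F′ (e ∷ A) gr′
            (≤-trans bound (≤-reflexive (trans (+-suc (length (nodes F)) f) (cong (_+ f) (sym len)))))

  spanning : Spanning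
  spanning = span-from k ∅ [] (record { unique = [] ∷ [] ; adjs = [] ; a-uniq = [] ; a-arcs = [] ; a-in = [] ; a-edges = [] ; len = refl }) ≤-refl

-- Sources and sinks of a balanced antidirected tree

isZero⁺ : ∀ {x} → x ≡ 0 → isZero x ≡ true
isZero⁺ refl = refl

isZero-pos : ∀ {x} → 0 < x → isZero x ≡ false
isZero-pos (s≤s _) = refl

-- The role of a tree vertex, matching the flag of `adj`: a source is followed along arcs, any other
-- vertex against them.
src : ∀ {m} → Digraph m → Fin m → Bool
src T v = isZero (indeg T v)

module _ {m : ℕ} (T : Digraph m) (anti : Antidirected T) where

  arc-tail : ∀ u v → T u v ≡ true → src T u ≡ true
  arc-tail u v t = isZero⁺ (count-∅ m (λ w w→u → anti w u v w→u t))

  arc-head : ∀ u v → T u v ≡ true → src T v ≡ false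
  arc-head u v t = isZero-pos (∃⇒count>0 m u t)

  adj-alternate : ∀ {u v} → UAdj T u v → src T v ≡ not (src T u)
  adj-alternate {u} {v} (inj₁ t) = trans (arc-head u v t) (cong not (sym (arc-tail u v t)))
  adj-alternate {u} {v} (inj₂ t) = trans (arc-tail v u t) (cong not (sym (arc-head v u t)))

module _ {k : ℕ} (T : Digraph (suc (suc k))) (anti : Antidirected T) (conn : Connected T) (bal : Balanced T) where

  private
    m : ℕ
    m = suc (suc k)

    other : ∀ (v : Fin m) → ∃ λ u → u ≢ v
    other zero    = suc zero , λ ()
    other (suc v) = zero , λ ()

    neighbour : ∀ v → ∃ λ u → UAdj T v u
    neighbour v with other v
    ... | u , u≢v with conn v u
    ... | ε     = ⊥-elim (u≢v refl)
    ... | e ◅ _ = _ , e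

    non-sources-sink : count m (not ∘ src T) ≤ count m (src T)
    non-sources-sink = ≤-trans (count-mono m sink) (≤-reflexive bal)
      where
      sink : ∀ v → not (src T v) ≡ true → isZero (outdeg T v) ≡ true
      sink v x with neighbour v
      ... | u , inj₁ t = ⊥-elim (true≢false (arc-tail T anti v u t) (not-elim x))
      ... | u , inj₂ t = isZero⁺ (count-∅ m (λ w v→w → anti u v w t v→w))

    sinks-non-source : count m (src T) ≤ count m (not ∘ src T)
    sinks-non-source = ≤-trans (≤-reflexive (sym bal)) (count-mono m sink)
      where
      sink : ∀ v → isZero (outdeg T v) ≡ true → not (src T v) ≡ true
      sink v x with neighbour v
      ... | u , inj₁ t = ⊥-elim (true≢false x (isZero-pos (∃⇒count>0 m {T v} u t)))
      ... | u , inj₂ t = not-intro (arc-head T anti u v t)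

  -- With at least two vertices, connectivity gives every vertex a neighbour. Sinks are then exactly
  -- the non-sources, and balance makes each of the two half of the tree.
  half-sources : 2 * count m (src T) ≤ m
  half-sources = ≤-trans (≤-reflexive (cong (count m (src T) +_) (+-identityʳ _)))
    (≤-trans (+-monoʳ-≤ (count m (src T)) sinks-non-source) (≤-reflexive (count-complement m (src T))))

  half-sinks : 2 * count m (not ∘ src T) ≤ m
  half-sinks = ≤-trans (≤-reflexive (cong (count m (not ∘ src T) +_) (+-identityʳ _)))
    (≤-trans (+-monoˡ-≤ (count m (not ∘ src T)) non-sources-sink) (≤-reflexive (count-complement m (src T))))

-- Cutting a forest into pieces: (v , F) is a forest F hanging below the vertex v

Piece : ℕ → Set
Piece m = Fin m × Forest m

shuffle : ∀ {A : Set} (x : A) as bs cs ds → x ∷ (as ++ bs) ++ (cs ++ ds) ↭ (x ∷ as ++ cs) ++ (bs ++ ds)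
shuffle x as bs cs ds = prep x (↭-trans (↭-reflexive (++-assoc as bs (cs ++ ds)))
  (↭-trans (Perm.++⁺ˡ as (Perm.shifts bs cs)) (↭-reflexive (sym (++-assoc as cs (bs ++ ds))))))

module _ {m : ℕ} where

  pnodes : List (Piece m) → List (Fin m)
  pnodes []             = []
  pnodes ((v , F) ∷ ps) = nodes F ++ pnodes ps

  pedges : List (Piece m) → List (Fin m × Fin m)
  pedges []             = []
  pedges ((v , F) ∷ ps) = edges v F ++ pedges ps

  pnodes-++ : ∀ ps qs → pnodes (ps ++ qs) ≡ pnodes ps ++ pnodes qs
  pnodes-++ []             qs = refl
  pnodes-++ ((v , F) ∷ ps) qs = trans (cong (nodes F ++_) (pnodes-++ ps qs)) (sym (++-assoc (nodes F) _ _))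

  pedges-++ : ∀ ps qs → pedges (ps ++ qs) ≡ pedges ps ++ pedges qs
  pedges-++ []             qs = refl
  pedges-++ ((v , F) ∷ ps) qs = trans (cong (edges v F ++_) (pedges-++ ps qs)) (sym (++-assoc (edges v F) _ _))

  -- The order needed for embedding: when a piece is reached, the vertex it hangs below already has
  -- an image.
  Chain : List (Fin m) → List (Piece m) → Set
  Chain done []             = ⊤
  Chain done ((v , F) ∷ ps) = v ∈ done × Chain (nodes F ++ done) ps

  chain-++ : ∀ {done} ps {qs} → Chain done ps → (∀ {done′} → (∀ {x} → x ∈ done → x ∈ done′) → Chain done′ qs) → Chain done (ps ++ qs)
  chain-++ []             c       h = h id
  chain-++ ((v , F) ∷ ps) (x , c) h = x , chain-++ ps c (λ sub → h (sub ∘ ∈-++⁺ʳ (nodes F)))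

  Bounded : ℕ → Forest m → Set
  Bounded Δ ∅           = ⊤
  Bounded Δ (v ⟨ F ⟩ G) = width F ≤ Δ × Bounded Δ F × Bounded Δ G

module Cut {m : ℕ} (σ : ℕ) (σ>0 : 0 < σ) where

  -- The children of `v` are detached as soon as `σ` nodes remain below it, so every piece has at
  -- least `σ` nodes and pieces are few. What stays attached gives each tree at most `σ` nodes, so a
  -- piece, having at most `Δ` roots, has at most `Δ * σ`.
  hang : Fin m → Forest m → Forest m × List (Piece m)
  hang v F = if does (order F <? σ) then (F , []) else (∅ , (v , F) ∷ [])

  cut : Forest m → Forest m × List (Piece m)
  cut ∅           = ∅ , []
  cut (v ⟨ F ⟩ G) =
    v ⟨ proj₁ (hang v (proj₁ (cut F))) ⟩ proj₁ (cut G) ,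
    -- The piece cut off below `v` comes before the pieces found inside `F`, which may hang below
    -- its nodes.
    proj₂ (hang v (proj₁ (cut F))) ++ (proj₂ (cut F) ++ proj₂ (cut G))

  private
    hang-cases : ∀ v F → (order F < σ × hang v F ≡ (F , [])) ⊎ (σ ≤ order F × hang v F ≡ (∅ , (v , F) ∷ []))
    hang-cases v F with bool-cases (does (order F <? σ))
    ... | inj₁ x = inj₁ (does⁻ (order F <? σ) x , cong (λ b → if b then (F , []) else (∅ , (v , F) ∷ [])) x)
    ... | inj₂ x = inj₂ (≮⇒≥ (doesn't⁻ (order F <? σ) x) , cong (λ b → if b then (F , []) else (∅ , (v , F) ∷ [])) x)

  cut-nodes : ∀ F → nodes F ↭ nodes (proj₁ (cut F)) ++ pnodes (proj₂ (cut F))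
  cut-nodes ∅ = ↭-refl
  cut-nodes (v ⟨ F ⟩ G) = ↭-trans (prep v (Perm.++⁺ (↭-trans (cut-nodes F) (pieces (hang-cases v (proj₁ (cut F))))) (cut-nodes G)))
    (↭-trans (shuffle v (nodes F″) (pnodes (rs ++ ps)) (nodes G′) (pnodes qs))
      (Perm.++⁺ˡ (v ∷ nodes F″ ++ nodes G′) (↭-reflexive (trans (sym (pnodes-++ (rs ++ ps) qs)) (cong pnodes (++-assoc rs ps qs))))))
    where
    F′ = proj₁ (cut F)
    ps = proj₂ (cut F)
    G′ = proj₁ (cut G)
    qs = proj₂ (cut G)
    F″ = proj₁ (hang v F′)
    rs = proj₂ (hang v F′)
    pieces : (order F′ < σ × hang v F′ ≡ (F′ , [])) ⊎ (σ ≤ order F′ × hang v F′ ≡ (∅ , (v , F′) ∷ [])) →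
      nodes F′ ++ pnodes ps ↭ nodes F″ ++ pnodes (rs ++ ps)
    pieces (inj₁ (_ , e)) rewrite e = ↭-refl
    pieces (inj₂ (_ , e)) rewrite e = ↭-refl

  cut-edges : ∀ p F → edges p F ↭ edges p (proj₁ (cut F)) ++ pedges (proj₂ (cut F))
  cut-edges p ∅ = ↭-refl
  cut-edges p (v ⟨ F ⟩ G) = ↭-trans (prep (p , v) (Perm.++⁺ (↭-trans (cut-edges v F) (pieces (hang-cases v (proj₁ (cut F))))) (cut-edges p G)))
    (↭-trans (shuffle (p , v) (edges v F″) (pedges (rs ++ ps)) (edges p G′) (pedges qs))
      (Perm.++⁺ˡ ((p , v) ∷ edges v F″ ++ edges p G′) (↭-reflexive (trans (sym (pedges-++ (rs ++ ps) qs)) (cong pedges (++-assoc rs ps qs))))))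
    where
    F′ = proj₁ (cut F)
    ps = proj₂ (cut F)
    G′ = proj₁ (cut G)
    qs = proj₂ (cut G)
    F″ = proj₁ (hang v F′)
    rs = proj₂ (hang v F′)
    pieces : (order F′ < σ × hang v F′ ≡ (F′ , [])) ⊎ (σ ≤ order F′ × hang v F′ ≡ (∅ , (v , F′) ∷ [])) →
      edges v F′ ++ pedges ps ↭ edges v F″ ++ pedges (rs ++ ps)
    pieces (inj₁ (_ , e)) rewrite e = ↭-refl
    pieces (inj₂ (_ , e)) rewrite e = ↭-refl

  cut-width : ∀ F → width (proj₁ (cut F)) ≡ width F
  cut-width ∅           = refl
  cut-width (v ⟨ F ⟩ G) = cong suc (cut-width G)

  cut-order : ∀ F → order (proj₁ (cut F)) ≤ width F * σ
  cut-order ∅ = z≤n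
  cut-order (v ⟨ F ⟩ G) = +-mono-≤ (small (hang-cases v (proj₁ (cut F)))) (cut-order G)
    where
    small : (order (proj₁ (cut F)) < σ × hang v (proj₁ (cut F)) ≡ (proj₁ (cut F) , [])) ⊎
            (σ ≤ order (proj₁ (cut F)) × hang v (proj₁ (cut F)) ≡ (∅ , (v , proj₁ (cut F)) ∷ [])) →
      suc (order (proj₁ (hang v (proj₁ (cut F))))) ≤ σ
    small (inj₁ (x , e)) rewrite e = x
    small (inj₂ (_ , e)) rewrite e = σ>0

  Small : ℕ → Piece m → Set
  Small Δ (v , F) = order F ≤ Δ * σ × width F ≤ Δ × Bounded Δ F

  cut-small : ∀ {Δ} F → Bounded Δ F → Bounded Δ (proj₁ (cut F)) × All (Small Δ) (proj₂ (cut F)) × All (λ x → σ ≤ order (proj₂ x)) (proj₂ (cut F))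
  cut-small ∅ _ = tt , [] , []
  cut-small {Δ} (v ⟨ F ⟩ G) (w , bF , bG) with cut-small F bF | cut-small G bG
  ... | rF , pF , lF | rG , pG , lG with hang-cases v (proj₁ (cut F))
  ... | inj₁ (_ , e) rewrite e = (≤-trans (≤-reflexive (cut-width F)) w , rF , rG) , Allₚ.++⁺ pF pG , Allₚ.++⁺ lF lG
  ... | inj₂ (x , e) rewrite e = (z≤n , tt , rG) ,
          (≤-trans (cut-order F) (*-monoˡ-≤ σ w) , ≤-trans (≤-reflexive (cut-width F)) w , rF) ∷ Allₚ.++⁺ pF pG , x ∷ Allₚ.++⁺ lF lG

  cut-chain : ∀ {done} F → (∀ {x} → x ∈ nodes (proj₁ (cut F)) → x ∈ done) → Chain done (proj₂ (cut F))
  cut-chain ∅ _ = tt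
  cut-chain {done} (v ⟨ F ⟩ G) sub with hang-cases v (proj₁ (cut F))
  ... | inj₁ (_ , e) rewrite e = chain-++ (proj₂ (cut F)) (cut-chain F (sub ∘ there ∘ ∈-++⁺ˡ))
          (λ s → cut-chain G (s ∘ sub ∘ there ∘ ∈-++⁺ʳ (nodes (proj₁ (cut F)))))
  ... | inj₂ (_ , e) rewrite e = sub (here refl) , chain-++ (proj₂ (cut F)) (cut-chain F ∈-++⁺ˡ)
          (λ s → cut-chain G (s ∘ ∈-++⁺ʳ (nodes (proj₁ (cut F))) ∘ sub ∘ there))

length-pnodes : ∀ {m} σ (ps : List (Piece m)) → All (λ x → σ ≤ order (proj₂ x)) ps → length ps * σ ≤ length (pnodes ps)
length-pnodes σ [] _ = z≤n
length-pnodes σ ((v , F) ∷ ps) (x ∷ xs) = ≤-trans (+-mono-≤ (≤-trans x (≤-reflexive (sym (length-nodes F)))) (length-pnodes σ ps xs))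
  (≤-reflexive (sym (length-++ (nodes F))))

unique-++ : ∀ {A : Set} (xs : List A) {ys} → Unique (xs ++ ys) → Unique xs × Unique ys
unique-++ []       u       = [] , u
unique-++ (x ∷ xs) (a ∷ u) = let v , w = unique-++ xs u in Allₚ.++⁻ˡ xs a ∷ v , w

module _ {m : ℕ} (T : Digraph m) {Δ : ℕ} (deg : MaxDegLe T Δ) where

  private
    roots : Forest m → List (Fin m)
    roots ∅           = []
    roots (v ⟨ F ⟩ G) = v ∷ roots G

    length-roots : ∀ F → length (roots F) ≡ width F
    length-roots ∅           = refl
    length-roots (v ⟨ F ⟩ G) = cong suc (length-roots G)

    roots⊆ : ∀ {P : Fin m → Set} F → All P (nodes F) → All P (roots F)
    roots⊆ ∅           _       = []
    roots⊆ (v ⟨ F ⟩ G) (x ∷ a) = x ∷ roots⊆ G (Allₚ.++⁻ʳ (nodes F) a)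

    roots-unique : ∀ F → Unique (nodes F) → Unique (roots F)
    roots-unique ∅           _       = []
    roots-unique (v ⟨ F ⟩ G) (x ∷ u) = roots⊆ G (Allₚ.++⁻ʳ (nodes F) x) ∷ roots-unique G (proj₂ (unique-++ (nodes F) u))

    roots-adj : ∀ p F → All (λ e → UAdj T (proj₁ e) (proj₂ e)) (edges p F) → All (UAdj T p) (roots F)
    roots-adj p ∅           _       = []
    roots-adj p (v ⟨ F ⟩ G) (x ∷ a) = x ∷ roots-adj p G (Allₚ.++⁻ʳ (edges v F) a)

  width≤ : ∀ p F → Unique (nodes F) → All (λ e → UAdj T (proj₁ e) (proj₂ e)) (edges p F) → width F ≤ Δ
  width≤ p F u a = begin
    width F                                                          ≡⟨ length-roots F ⟨
    length (roots F)                                                 ≡⟨ trans (total-const 1 (roots F)) (*-identityʳ _) ⟨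
    total (λ _ → 1) (roots F)                                        ≤⟨ total-mono (roots F) (λ c c∈ → one (All.lookup (roots-adj p F a) c∈)) ⟩
    total (λ c → ind (T p c) + ind (T c p)) (roots F)                ≡⟨ total-+ _ _ (roots F) ⟩
    total (λ c → ind (T p c)) (roots F) + total (λ c → ind (T c p)) (roots F)
      ≤⟨ +-mono-≤ (unique-count m (T p) (roots F) (roots-unique F u)) (unique-count m (λ c → T c p) (roots F) (roots-unique F u)) ⟩
    udeg T p                                                         ≤⟨ deg p ⟩
    Δ                                                                ∎
    where
    open ≤-Reasoning
    one : ∀ {c} → UAdj T p c → 1 ≤ ind (T p c) + ind (T c p)
    one (inj₁ x) rewrite x = s≤s z≤n
    one {c} (inj₂ x) rewrite x = m≤n+m 1 (ind (T p c))

  bounded : ∀ p F → Unique (nodes F) → All (λ e → UAdj T (proj₁ e) (proj₂ e)) (edges p F) → Bounded Δ F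
  bounded p ∅ _ _ = tt
  bounded p (v ⟨ F ⟩ G) (x ∷ u) (y ∷ a) =
    let uF , uG = unique-++ (nodes F) u ; aF = Allₚ.++⁻ˡ (edges v F) a ; aG = Allₚ.++⁻ʳ (edges v F) a in
    width≤ v F uF aF , bounded v F uF aF , bounded p G uG aG

-- Spreading each type of elements evenly over the bins balances several weights at the same time.

module Assign {A : Set} {N : ℕ} (ty : A → Fin N) {t : ℕ} (t>0 : 0 < t) where

  occ : Fin N → List A → ℕ
  occ τ = total (λ a → ind (does (ty a Fin.≟ τ)))

  cnt : Fin N → Fin t → List (A × Fin t) → ℕ
  cnt τ e = total (λ x → ind (does (ty (proj₁ x) Fin.≟ τ) ∧ does (proj₂ x Fin.≟ e)))

  private
    cnt-sum : ∀ τ as → sumF t (λ e → cnt τ e as) ≡ occ τ (map proj₁ as)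
    cnt-sum τ []              = sumF-zero t (λ _ → refl)
    cnt-sum τ ((a , e₀) ∷ as) = trans (sumF-+ t _ _) (cong₂ _+_ (one (does (ty a Fin.≟ τ))) (cnt-sum τ as))
      where
      one : ∀ b → sumF t (λ e → ind (b ∧ does (e₀ Fin.≟ e))) ≡ ind b
      one true  = trans (sumF-single t _ e₀ (λ e e≢ → cong ind (doesn't⁺ (e₀ Fin.≟ e) (e≢ ∘ sym)))) (cong ind (does⁺ (e₀ Fin.≟ e₀) refl))
      one false = sumF-zero t (λ _ → refl)

    least : ∀ τ as → ∃ λ e → t * cnt τ e as ≤ occ τ (map proj₁ as)
    least τ as = let e , x = sumF-<⇒∃ t {λ e → t * cnt τ e as} {λ _ → suc (occ τ (map proj₁ as))} less in e , ≤-pred x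
      where
      open ≤-Reasoning
      less : sumF t (λ e → t * cnt τ e as) < sumF t (λ _ → suc (occ τ (map proj₁ as)))
      less = begin-strict
        sumF t (λ e → t * cnt τ e as)                ≡⟨ sumF-* t t _ ⟩
        t * sumF t (λ e → cnt τ e as)                ≡⟨ cong (t *_) (cnt-sum τ as) ⟩
        t * occ τ (map proj₁ as)                     <⟨ *-monoʳ-< t {{>-nonZero t>0}} ≤-refl ⟩
        t * suc (occ τ (map proj₁ as))               ≡⟨ sumF-const t _ ⟨
        sumF t (λ _ → suc (occ τ (map proj₁ as)))    ∎

  -- Greedy: each element goes to a bin holding the fewest elements of its type. Such a bin is at
  -- most average before the insertion, hence at most one above average afterwards.
  balance : ∀ l → Σ[ as ∈ List (A × Fin t) ] map proj₁ as ≡ l × (∀ τ e → t * cnt τ e as ≤ occ τ l + t)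
  balance [] = [] , refl , λ τ e → ≤-trans (≤-reflexive (*-zeroʳ t)) z≤n
  balance (a ∷ l) with balance l
  ... | as , refl , inv with least (ty a) as
  ... | e₀ , low = (a , e₀) ∷ as , refl , inv′
    where
    inv′ : ∀ τ e → t * cnt τ e ((a , e₀) ∷ as) ≤ occ τ (a ∷ map proj₁ as) + t
    inv′ τ e with ty a Fin.≟ τ | e₀ Fin.≟ e
    ... | yes refl | yes refl = ≤-trans (≤-reflexive (trans (*-suc t _) (+-comm t _)))
                                  (+-monoˡ-≤ t (≤-trans low (n≤1+n _)))
    ... | yes refl | no _ = ≤-trans (inv τ e) (n≤1+n _)
    ... | no _ | _ = inv τ e

  load : (A → ℕ) → Fin t → List (A × Fin t) → ℕ
  load w e = total (λ x → w (proj₁ x) * ind (does (proj₂ x Fin.≟ e)))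

  private
    by-type : ∀ (ω : Fin N → ℕ) e as → load (ω ∘ ty) e as ≡ sumF N (λ τ → ω τ * cnt τ e as)
    by-type ω e []              = sym (sumF-zero N (λ τ → *-zeroʳ (ω τ)))
    by-type ω e ((a , e₀) ∷ as) = begin
      ω (ty a) * ind c + load (ω ∘ ty) e as
        ≡⟨ cong₂ _+_ (sym (sumF-single-ty c)) (by-type ω e as) ⟩
      sumF N (λ τ → ω τ * ind (does (ty a Fin.≟ τ) ∧ c)) + sumF N (λ τ → ω τ * cnt τ e as)
        ≡⟨ sumF-+ N _ _ ⟨
      sumF N (λ τ → ω τ * ind (does (ty a Fin.≟ τ) ∧ c) + ω τ * cnt τ e as)
        ≡⟨ sumF-cong N (λ τ → sym (*-distribˡ-+ (ω τ) _ _)) ⟩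
      sumF N (λ τ → ω τ * cnt τ e ((a , e₀) ∷ as)) ∎
      where
      open ≡-Reasoning
      c : Bool
      c = does (e₀ Fin.≟ e)
      sumF-single-ty : ∀ c → sumF N (λ τ → ω τ * ind (does (ty a Fin.≟ τ) ∧ c)) ≡ ω (ty a) * ind c
      sumF-single-ty c = trans (sumF-single N _ (ty a) (λ τ τ≢ →
          trans (cong (λ b → ω τ * ind (b ∧ c)) (doesn't⁺ (ty a Fin.≟ τ) (τ≢ ∘ sym))) (*-zeroʳ (ω τ))))
        (cong (λ b → ω (ty a) * ind (b ∧ c)) (does⁺ (ty a Fin.≟ ty a) refl))

    occ-total : ∀ (ω : Fin N → ℕ) l → sumF N (λ τ → ω τ * occ τ l) ≡ total (ω ∘ ty) l
    occ-total ω []      = sumF-zero N (λ τ → *-zeroʳ (ω τ))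
    occ-total ω (a ∷ l) = trans (sumF-cong N (λ τ → *-distribˡ-+ (ω τ) _ _)) (trans (sumF-+ N _ _)
      (cong₂ _+_ (trans (sumF-single N _ (ty a) (λ τ τ≢ → trans (cong (λ b → ω τ * ind b) (doesn't⁺ (ty a Fin.≟ τ) (τ≢ ∘ sym))) (*-zeroʳ (ω τ))))
                        (trans (cong (λ b → ω (ty a) * ind b) (does⁺ (ty a Fin.≟ ty a) refl)) (*-identityʳ _)))
                 (occ-total ω l)))

  load-bound : ∀ (ω : Fin N → ℕ) P → (∀ τ → ω τ ≤ P) → ∀ e l as → (∀ τ → t * cnt τ e as ≤ occ τ l + t) →
    t * load (ω ∘ ty) e as ≤ total (ω ∘ ty) l + t * (N * P)
  load-bound ω P ω≤ e l as inv = begin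
    t * load (ω ∘ ty) e as                               ≡⟨ cong (t *_) (by-type ω e as) ⟩
    t * sumF N (λ τ → ω τ * cnt τ e as)                  ≡⟨ sumF-* N t _ ⟨
    sumF N (λ τ → t * (ω τ * cnt τ e as))                ≤⟨ sumF-mono N step′ ⟩
    sumF N (λ τ → ω τ * occ τ l + t * P)                 ≡⟨ sumF-+ N _ _ ⟩
    sumF N (λ τ → ω τ * occ τ l) + sumF N (λ _ → t * P)  ≡⟨ cong₂ _+_ (occ-total ω l) (trans (sumF-const N (t * P)) (eq N t P)) ⟩
    total (ω ∘ ty) l + t * (N * P)                       ∎
    where
    open ≤-Reasoning
    eq : ∀ a b c → a * (b * c) ≡ b * (a * c)
    eq = solve-∀
    step′ : ∀ τ → t * (ω τ * cnt τ e as) ≤ ω τ * occ τ l + t * P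
    step′ τ = begin
      t * (ω τ * cnt τ e as)     ≡⟨ eq t (ω τ) (cnt τ e as) ⟩
      ω τ * (t * cnt τ e as)     ≤⟨ *-monoʳ-≤ (ω τ) (inv τ) ⟩
      ω τ * (occ τ l + t)        ≡⟨ *-distribˡ-+ (ω τ) (occ τ l) t ⟩
      ω τ * occ τ l + ω τ * t    ≤⟨ +-monoʳ-≤ (ω τ * occ τ l) (≤-trans (*-monoˡ-≤ t (ω≤ τ)) (≤-reflexive (*-comm P t))) ⟩
      ω τ * occ τ l + t * P      ∎

bin-load : ∀ {A : Set} {t} → (A → ℕ) → Fin t → List (A × Fin t) → ℕ
bin-load w e = total (λ x → w (proj₁ x) * ind (does (proj₂ x Fin.≟ e)))

total-cong : ∀ {A : Set} {f g : A → ℕ} xs → (∀ x → x ∈ xs → f x ≡ g x) → total f xs ≡ total g xs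
total-cong []       h = refl
total-cong (x ∷ xs) h = cong₂ _+_ (h x (here refl)) (total-cong xs (λ y → h y ∘ there))

-- With the pair of weights as type, evenness within each type balances both weights at once. Each
-- of the `suc P * suc P` types puts at most one element too many, of weight at most `P`, into a
-- bin.
assign : ∀ {A : Set} (w₁ w₂ : A → ℕ) P {t} → 0 < t → ∀ l → (∀ a → a ∈ l → w₁ a ≤ P × w₂ a ≤ P) →
  Σ[ as ∈ List (A × Fin t) ] map proj₁ as ≡ l ×
    (∀ e → t * bin-load w₁ e as ≤ total w₁ l + t * (suc P * suc P * P)) ×
    (∀ e → t * bin-load w₂ e as ≤ total w₂ l + t * (suc P * suc P * P))
assign {A} w₁ w₂ P {t} t>0 l bounds = as , eq , bound w₁ ω₁ (λ τ → ≤-pred (Fin.toℕ<n (proj₁ (remQuot {suc P} (suc P) τ)))) w₁≡ ,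
    bound w₂ ω₂ (λ τ → ≤-pred (Fin.toℕ<n (proj₂ (remQuot {suc P} (suc P) τ)))) w₂≡
  where
  open ≤-Reasoning
  -- Truncation only makes the type total; on the elements of `l` it is exact.
  clamp : ℕ → Fin (suc P)
  clamp x = Data.Fin.fromℕ< (s≤s (m⊓n≤n x P))
  clamp≡ : ∀ {x} → x ≤ P → Data.Fin.toℕ (clamp x) ≡ x
  clamp≡ {x} x≤ = trans (Fin.toℕ-fromℕ< _) (m≤n⇒m⊓n≡m x≤)
  ty : A → Fin (suc P * suc P)
  ty a = combine (clamp (w₁ a)) (clamp (w₂ a))
  open Assign ty t>0
  as = proj₁ (balance l)
  eq = proj₁ (proj₂ (balance l))
  inv = proj₂ (proj₂ (balance l))
  ω₁ ω₂ : Fin (suc P * suc P) → ℕ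
  ω₁ τ = Data.Fin.toℕ (proj₁ (remQuot {suc P} (suc P) τ))
  ω₂ τ = Data.Fin.toℕ (proj₂ (remQuot {suc P} (suc P) τ))
  w₁≡ : ∀ a → a ∈ l → w₁ a ≡ ω₁ (ty a)
  w₁≡ a a∈ = sym (trans (cong (Data.Fin.toℕ ∘ proj₁) (Fin.remQuot-combine (clamp (w₁ a)) (clamp (w₂ a)))) (clamp≡ (proj₁ (bounds a a∈))))
  w₂≡ : ∀ a → a ∈ l → w₂ a ≡ ω₂ (ty a)
  w₂≡ a a∈ = sym (trans (cong (Data.Fin.toℕ ∘ proj₂) (Fin.remQuot-combine (clamp (w₁ a)) (clamp (w₂ a)))) (clamp≡ (proj₂ (bounds a a∈))))
  bound : ∀ w (ω : Fin (suc P * suc P) → ℕ) → (∀ τ → ω τ ≤ P) → (∀ a → a ∈ l → w a ≡ ω (ty a)) →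
    ∀ e → t * bin-load w e as ≤ total w l + t * (suc P * suc P * P)
  bound w ω ω≤ w≡ e = begin
    t * bin-load w e as                             ≡⟨ cong (t *_) (total-cong as (λ x x∈ → cong (_* ind (does (proj₂ x Fin.≟ e)))
                                                         (w≡ (proj₁ x) (subst (proj₁ x ∈_) eq (∈-map⁺ proj₁ x∈))))) ⟩
    t * load (ω ∘ ty) e as                          ≤⟨ load-bound ω P ω≤ e l as (λ τ → inv τ e) ⟩
    total (ω ∘ ty) l + t * (suc P * suc P * P)      ≡⟨ cong (_+ t * (suc P * suc P * P)) (total-cong l w≡) ⟨
    total w l + t * (suc P * suc P * P)             ∎

-- Greedy embedding of forests

-- The number of nodes planned in a state satisfying `zf`. It depends on the plan alone and not on
-- the images chosen, so usage can be bounded in advance.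
cost : ∀ {m} {St : Set} → (St → St) → (St → Bool) → Forest m → St → ℕ
cost nxt zf ∅           st = 0
cost nxt zf (v ⟨ F ⟩ G) st = ind (zf st) + (cost nxt zf F (nxt st) + cost nxt zf G st)

cost≤order : ∀ {m} {St : Set} (nxt : St → St) zf (F : Forest m) st → cost nxt zf F st ≤ order F
cost≤order nxt zf ∅           st = z≤n
cost≤order nxt zf (v ⟨ F ⟩ G) st = +-mono-≤ (ind≤1 (zf st)) (+-mono-≤ (cost≤order nxt zf F (nxt st)) (cost≤order nxt zf G st))

module _ {m n : ℕ} (D : Digraph n) (role : Fin m → Bool) where

  Drawn : List (Fin m × Fin n) → Fin m × Fin m → Set
  Drawn al (a , b) = ∃ λ y → ∃ λ z → (a , y) ∈ al × (b , z) ∈ al × adj D (role a) y z ≡ true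

  drawn-mono : ∀ {al al′} → (∀ {x} → x ∈ al → x ∈ al′) → ∀ {e} → Drawn al e → Drawn al′ e
  drawn-mono sub (y , z , y∈ , z∈ , d) = y , z , sub y∈ , sub z∈ , d

Alternating : ∀ {m} → (Fin m → Bool) → Fin m × Fin m → Set
Alternating role (a , b) = role b ≡ not (role a)

links : ∀ {n} → Digraph n → Bool → Fin n → (Fin n → Bool) → ℕ
links {n} D r y S = count n (λ z → adj D r y z ∧ S z)

use : ∀ {m n} → (Fin n → Bool) → List (Fin m × Fin n) → ℕ
use Z = total (ind ∘ Z ∘ proj₂)

-- A node planned in state st goes to set st and its children are planned in state nxt st;
-- ok is the property of images that later pieces rely on.
record Plan {n : ℕ} (D : Digraph n) (St : Set) (ok : Bool → Fin n → Bool) (τ P : ℕ) : Set where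
  field
    set      : St → Fin n → Bool
    nxt      : St → St
    side     : St → Bool
    side-nxt : ∀ st → side (nxt st) ≡ not (side st)
    h        : ℕ
    dull     : ∀ st → count n (λ z → set st z ∧ not (does (τ ≤? links D (side st) z (set (nxt st))))) ≤ h
    not-ok   : ∀ st → count n (λ z → set st z ∧ not (ok (side st) z)) ≤ h
    room     : h + h + P < τ

module Embed {m n : ℕ} (D : Digraph n) (role : Fin m → Bool) {St : Set} {ok : Bool → Fin n → Bool} {τ P : ℕ}
  (plan : Plan D St ok τ P) where
  open Plan plan

  Assoc : Set
  Assoc = List (Fin m × Fin n)

  OkAt : Fin m × Fin n → Set
  OkAt (a , z) = ok (role a) z ≡ true

  record Embedded (F : Forest m) (p : Fin m) (st : St) (al al′ : Assoc) : Set where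
    field
      keys   : map proj₁ al′ ↭ nodes F ++ map proj₁ al
      images : Unique (map proj₂ al′)
      keeps  : ∀ {x} → x ∈ al → x ∈ al′
      okay   : All OkAt al′
      drawn  : All (Drawn D role al′) (edges p F)
      -- All sets and flags at once: the same embedding must later be charged to every connector and
      -- to every bulk set.
      usage  : ∀ (Z : Fin n → Bool) zf → (∀ st z → set st z ≡ true → Z z ≡ true → zf st ≡ true) →
               use Z al′ ≤ cost {m} nxt zf F st + use Z al

  private
    -- Of at least `τ` neighbours in the target set, at most `h` are too poorly linked to the next
    -- set, at most `h` are not `ok`, and at most `P` are occupied; `room` leaves one.
    choose : ∀ (al : Assoc) b p y st → (∀ st → use (set st) al ≤ b) → b ≤ P → τ ≤ links D (role p) y (set st) →
      ∃ λ z → adj D (role p) y z ≡ true × set st z ≡ true × z ∉ map proj₂ al ×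
              τ ≤ links D (side st) z (set (nxt st)) × ok (side st) z ≡ true
    choose al b p y st fresh b≤P enough = pick (count-<⇒∃ n {bad} {cand} few)
      where
      open ≤-Reasoning
      S cand bad₁ bad₂ bad₃ bad : Fin n → Bool
      S = set st
      cand z = adj D (role p) y z ∧ S z
      bad₁ z = S z ∧ not (does (τ ≤? links D (side st) z (set (nxt st))))
      bad₂ z = S z ∧ not (ok (side st) z)
      bad₃ z = S z ∧ does (z ∈? map proj₂ al)
      bad z = (bad₁ z ∨ bad₂ z) ∨ bad₃ z
      used : count n bad₃ ≤ b
      used = begin
        count n bad₃                       ≤⟨ count-covered n bad₃ (map proj₂ al) (λ z x → does⁻ (z ∈? map proj₂ al) (proj₂ (∧-elim (S z) x))) ⟩
        total (ind ∘ bad₃) (map proj₂ al)  ≤⟨ total-mono (map proj₂ al) (λ z _ → ind-mono (λ x → proj₁ (∧-elim (S z) x))) ⟩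
        total (ind ∘ S) (map proj₂ al)     ≡⟨ total-map (ind ∘ S) proj₂ al ⟩
        use S al                           ≤⟨ fresh st ⟩
        b                                  ∎
      few : count n bad < count n cand
      few = begin-strict
        count n bad                               ≤⟨ count-∪ n (λ z → ∨-elim (bad₁ z ∨ bad₂ z)) ⟩
        count n (λ z → bad₁ z ∨ bad₂ z) + count n bad₃   ≤⟨ +-mono-≤ (count-∪ n (λ z → ∨-elim (bad₁ z))) (≤-trans used b≤P) ⟩
        count n bad₁ + count n bad₂ + P           ≤⟨ +-monoˡ-≤ P (+-mono-≤ (dull st) (not-ok st)) ⟩
        h + h + P                                 <⟨ room ⟩
        τ                                         ≤⟨ enough ⟩
        count n cand                              ∎
      pick : (∃ λ z → cand z ≡ true × bad z ≡ false) →
        ∃ λ z → adj D (role p) y z ≡ true × set st z ≡ true × z ∉ map proj₂ al ×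
              τ ≤ links D (side st) z (set (nxt st)) × ok (side st) z ≡ true
      pick (z , c , x) =
        let e , s = ∧-elim (adj D (role p) y z) c
            x₁₂ , x₃ = ∨-false (bad₁ z ∨ bad₂ z) x
            x₁ , x₂ = ∨-false (bad₁ z) x₁₂
        in z , e , s ,
           (λ z∈ → true≢false (∧-intro s (does⁺ (z ∈? map proj₂ al) z∈)) x₃) ,
           decidable-stable (τ ≤? _) (λ ¬t → true≢false (∧-intro s (not-intro (doesn't⁺ (τ ≤? _) ¬t))) x₁) ,
           decidable-stable (ok (side st) z Data.Bool.≟ true) (λ ¬t → true≢false (∧-intro s (not-intro (¬true⇒false ¬t))) x₂)

  -- `b` bounds how many earlier images lie in any set of the plan. For a new piece the sets avoid
  -- all earlier images and `b` starts at 0, so only the nodes of the piece itself count against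
  -- `P`.
  embed-forest : ∀ (F : Forest m) p y st (al : Assoc) b → role p ≡ not (side st) → All (Alternating role) (edges p F) →
    τ ≤ links D (role p) y (set st) → (p , y) ∈ al → Unique (map proj₂ al) → All OkAt al →
    (∀ st → use (set st) al ≤ b) → b + order F ≤ P → ∃ λ al′ → Embedded F p st al al′
  embed-forest ∅ p y st al b rp alt enough py∈ uniq okay fresh bound = al , record
    { keys = ↭-refl ; images = uniq ; keeps = id ; okay = okay ; drawn = [] ; usage = λ _ _ _ → ≤-refl }
  embed-forest (v ⟨ F ⟩ G) p y st al b rp (av ∷ alt) enough py∈ uniq okay fresh bound
    with choose al b p y st fresh (m+n≤o⇒m≤o b bound) enough
  ... | z , e , s , z∉ , many , okz
    with embed-forest F v z (nxt st) ((v , z) ∷ al) (suc b) rv (Allₚ.++⁻ˡ (edges v F) alt)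
           (subst (λ r → τ ≤ links D r z (set (nxt st))) (sym rv′) many) (here refl) (∉⇒All≢ z∉ ∷ uniq)
           (trans (cong (λ r → ok r z) rv′) okz ∷ okay)
           (λ st′ → +-mono-≤ (ind≤1 (set st′ z)) (fresh st′)) bF
    where
    rv′ : role v ≡ side st
    rv′ = trans av (trans (cong not rp) (Data.Bool.Properties.not-involutive (side st)))
    rv : role v ≡ not (side (nxt st))
    rv = trans rv′ (sym (trans (cong not (side-nxt st)) (Data.Bool.Properties.not-involutive (side st))))
    bF : suc b + order F ≤ P
    bF = ≤-trans (≤-trans (≤-reflexive (sym (+-suc b (order F)))) (+-monoʳ-≤ b (s≤s (m≤m+n (order F) (order G))))) bound
  ... | al₁ , E₁
    with embed-forest G p y st al₁ (order F + suc b) rp (Allₚ.++⁻ʳ (edges v F) alt) enough (Embedded.keeps E₁ (there py∈))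
           (Embedded.images E₁) (Embedded.okay E₁)
           (λ st′ → ≤-trans (Embedded.usage E₁ (set st′) (λ _ → true) (λ _ _ _ _ → refl))
             (+-mono-≤ (cost≤order nxt (λ _ → true) F (nxt st)) (+-mono-≤ (ind≤1 (set st′ z)) (fresh st′))))
           (≤-trans (≤-reflexive (eq b (order F) (order G))) bound)
    where
    eq : ∀ b f g → f + suc b + g ≡ b + suc (f + g)
    eq = solve-∀
  ... | al₂ , E₂ = al₂ , record
    { keys   = ↭-trans (Embedded.keys E₂) (↭-trans (Perm.++⁺ˡ (nodes G) (Embedded.keys E₁)) reorder)
    ; images = Embedded.images E₂
    ; keeps  = Embedded.keeps E₂ ∘ Embedded.keeps E₁ ∘ there
    ; okay   = Embedded.okay E₂
    ; drawn  = (y , z , Embedded.keeps E₂ (Embedded.keeps E₁ (there py∈)) , Embedded.keeps E₂ (Embedded.keeps E₁ (here refl)) , e) ∷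
               Allₚ.++⁺ (All.map (drawn-mono D role (Embedded.keeps E₂)) (Embedded.drawn E₁)) (Embedded.drawn E₂)
    ; usage  = usage′ }
    where
    reorder : nodes G ++ (nodes F ++ v ∷ map proj₁ al) ↭ v ∷ (nodes F ++ nodes G) ++ map proj₁ al
    reorder = ↭-trans (Perm.shifts (nodes G) (nodes F)) (↭-trans (Perm.++⁺ˡ (nodes F) (Perm.shift v (nodes G) (map proj₁ al)))
      (↭-trans (Perm.shift v (nodes F) (nodes G ++ map proj₁ al)) (prep v (↭-reflexive (sym (++-assoc (nodes F) (nodes G) (map proj₁ al)))))))
    usage′ : ∀ (Z : Fin n → Bool) zf → (∀ st z → set st z ≡ true → Z z ≡ true → zf st ≡ true) →
      use Z al₂ ≤ cost nxt zf (v ⟨ F ⟩ G) st + use Z al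
    usage′ Z zf h = begin
      use Z al₂                                                           ≤⟨ Embedded.usage E₂ Z zf h ⟩
      cG + use Z al₁                                                      ≤⟨ +-monoʳ-≤ cG (Embedded.usage E₁ Z zf h) ⟩
      cG + (cF + (ind (Z z) + use Z al))                                  ≤⟨ +-monoʳ-≤ cG (+-monoʳ-≤ cF (+-monoˡ-≤ (use Z al) (ind-mono (h st z s)))) ⟩
      cG + (cF + (ind (zf st) + use Z al))                                ≡⟨ eq cG cF (ind (zf st)) (use Z al) ⟩
      ind (zf st) + (cF + cG) + use Z al                                  ∎
      where
      open ≤-Reasoning
      cF = cost nxt zf F (nxt st)
      cG = cost nxt zf G st
      eq : ∀ a b c d → a + (b + (c + d)) ≡ c + (b + a) + d
      eq = solve-∀

-- Typical vertices of hole-free pairs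

atypical : ∀ {n} → Digraph n → ℕ → Bool → (Fin n → Bool) → (Fin n → Bool) → Fin n → Bool
atypical {n} D dd r V S z = V z ∧ not (does (count n S ≤? dd * links D r z S))

module _ {n : ℕ} (D : Digraph n) (dd h : ℕ) where

  private
    sparse-rows : ∀ r V S →
      dd * arcs (λ u v → rect (atypical D dd r V S) S u v ∧ adj D r u v) ≤ count n (atypical D dd r V S) * count n S
    sparse-rows r V S = begin
      dd * arcs (λ u v → rect A S u v ∧ adj D r u v)                 ≡⟨ sumF-* n dd _ ⟨
      sumF n (λ u → dd * count n (λ v → rect A S u v ∧ adj D r u v)) ≤⟨ sumF-mono n row ⟩
      sumF n (λ u → count n S * ind (A u))                           ≡⟨ sumF-* n (count n S) _ ⟩
      count n S * sumF n (ind ∘ A)                                   ≡⟨ cong (count n S *_) (count≡sumF n A) ⟨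
      count n S * count n A                                          ≡⟨ *-comm (count n S) _ ⟩
      count n A * count n S                                          ∎
      where
      open ≤-Reasoning
      A : Fin n → Bool
      A = atypical D dd r V S
      row : ∀ u → dd * count n (λ v → rect A S u v ∧ adj D r u v) ≤ count n S * ind (A u)
      row u with bool-cases (A u)
      ... | inj₁ x = begin
            dd * count n (λ v → rect A S u v ∧ adj D r u v)  ≤⟨ *-monoʳ-≤ dd (count-mono n (λ v y → let a , b = ∧-elim (rect A S u v) y in
                                                                   ∧-intro b (proj₂ (∧-elim (A u) a)))) ⟩
            dd * links D r u S                               ≤⟨ <⇒≤ (≰⇒> (doesn't⁻ (count n S ≤? dd * links D r u S) (not-elim (proj₂ (∧-elim (V u) x))))) ⟩
            count n S                                        ≡⟨ *-identityʳ _ ⟨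
            count n S * 1                                    ≡⟨ cong (λ b → count n S * ind b) x ⟨
            count n S * ind (A u)                            ∎
      ... | inj₂ x = ≤-trans (≤-reflexive (trans (cong (dd *_) (count-∅ n {λ v → rect A S u v ∧ adj D r u v}
                        (λ v y → true≢false (proj₁ (∧-elim (A u) (proj₁ (∧-elim (rect A S u v) y)))) x))) (*-zeroʳ dd))) z≤n

  -- Otherwise the atypical vertices and `S` would span a hole: both sides have at least `h`
  -- vertices, and every row is sparse. Against the direction of arcs the same rectangle is read
  -- transposed.
  few-atypical : ∀ {q} {R : Digraph q} (V : Fin q → Fin n → Bool) → (∀ i j → R i j ≡ true → ¬ HasHole D dd h (V i) (V j)) →
    ∀ r i j S → adj R r i j ≡ true → (∀ z → S z ≡ true → V j z ≡ true) → h ≤ count n S →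
    count n (atypical D dd r (V i) S) < h
  few-atypical V no-hole true i j S e S⊆ h≤S with h ≤? count n (atypical D dd true (V i) S)
  ... | no x  = ≰⇒> x
  ... | yes x = ⊥-elim (no-hole i j e (atypical D dd true (V i) S , S , (λ z a → proj₁ (∧-elim (V i z) a)) , S⊆ , x , h≤S ,
                  sparse-rows true (V i) S))
  few-atypical V no-hole false i j S e S⊆ h≤S with h ≤? count n (atypical D dd false (V i) S)
  ... | no x  = ≰⇒> x
  ... | yes x = ⊥-elim (no-hole j i e (S , A , S⊆ , (λ z a → proj₁ (∧-elim (V i z) a)) , h≤S , x ,
                  (begin
                    dd * arcs (λ u v → rect S A u v ∧ D u v)   ≡⟨ cong (dd *_) (arcs-transpose n _) ⟩
                    dd * arcs (λ v u → rect S A u v ∧ D u v)   ≤⟨ *-monoʳ-≤ dd (arcs-mono n (λ v u y → let a , b = ∧-elim (rect S A u v) y ; c , d = ∧-elim (S u) a in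
                                                                    ∧-intro (∧-intro d c) b)) ⟩
                    dd * arcs (λ v u → rect A S v u ∧ D u v)   ≤⟨ sparse-rows false (V i) S ⟩
                    count n A * count n S                      ≡⟨ *-comm (count n A) _ ⟩
                    count n S * count n A                      ∎)))
    where
    open ≤-Reasoning
    A : Fin n → Bool
    A = atypical D dd false (V i) S

module _ {q : ℕ} where

  tail-of head-of : (M : List (Fin q × Fin q)) → Fin (length M) → Fin q
  tail-of M e = proj₁ (Data.List.lookup M e)
  head-of M e = proj₂ (Data.List.lookup M e)

  tail∈ : ∀ M e → tail-of M e ∈ verts M
  tail∈ (_ ∷ M) zero    = here refl
  tail∈ (_ ∷ M) (suc e) = there (there (tail∈ M e))

  head∈ : ∀ M e → head-of M e ∈ verts M
  head∈ (_ ∷ M) zero    = there (here refl)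
  head∈ (_ ∷ M) (suc e) = there (there (head∈ M e))

  tail-injective : ∀ M → Unique (verts M) → ∀ e f → tail-of M e ≡ tail-of M f → e ≡ f
  tail-injective (_ ∷ M) ((_ ∷ a) ∷ _ ∷ u) zero zero _ = refl
  tail-injective (_ ∷ M) ((_ ∷ a) ∷ _ ∷ u) zero (suc f) x = ⊥-elim (All.lookup a (tail∈ M f) x)
  tail-injective (_ ∷ M) ((_ ∷ a) ∷ _ ∷ u) (suc e) zero x = ⊥-elim (All.lookup a (tail∈ M e) (sym x))
  tail-injective (_ ∷ M) (_ ∷ _ ∷ u) (suc e) (suc f) x = cong suc (tail-injective M u e f x)

  head-injective : ∀ M → Unique (verts M) → ∀ e f → head-of M e ≡ head-of M f → e ≡ f
  head-injective (_ ∷ M) (_ ∷ b ∷ u) zero zero _ = refl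
  head-injective (_ ∷ M) (_ ∷ b ∷ u) zero (suc f) x = ⊥-elim (All.lookup b (head∈ M f) x)
  head-injective (_ ∷ M) (_ ∷ b ∷ u) (suc e) zero x = ⊥-elim (All.lookup b (head∈ M e) (sym x))
  head-injective (_ ∷ M) (_ ∷ _ ∷ u) (suc e) (suc f) x = cong suc (head-injective M u e f x)

  tail≢head : ∀ M → Unique (verts M) → ∀ e f → tail-of M e ≢ head-of M f
  tail≢head (_ ∷ M) ((a≢b ∷ a) ∷ b ∷ u) zero zero x = a≢b x
  tail≢head (_ ∷ M) ((_ ∷ a) ∷ b ∷ u) zero (suc f) x = All.lookup a (head∈ M f) x
  tail≢head (_ ∷ M) ((_ ∷ a) ∷ b ∷ u) (suc e) zero x = All.lookup b (tail∈ M e) (sym x)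
  tail≢head (_ ∷ M) (_ ∷ _ ∷ u) (suc e) (suc f) x = tail≢head M u e f x

is : Bool → Bool → Bool
is true  b = b
is false b = not b

share : ∀ {m} → (Fin m → Bool) → Bool → List (Fin m) → ℕ
share role ρ = total (λ v → ind (is ρ (role v)))

share≤length : ∀ {m} (role : Fin m → Bool) ρ l → share role ρ l ≤ length l
share≤length role ρ l = ≤-trans (total-mono l (λ v _ → ind≤1 _)) (≤-reflexive (trans (total-const 1 l) (*-identityʳ _)))

is-refl : ∀ b → is b b ≡ true
is-refl true  = refl
is-refl false = refl

module _ {m : ℕ} (role : Fin m → Bool) {St : Set} (nxt : St → St) (side : St → Bool) (side-nxt : ∀ st → side (nxt st) ≡ not (side st)) where

  -- Roles alternate along the tree just as sides alternate along the plan, so a node in a state of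
  -- side `ρ` has role `ρ`.
  cost-share : ∀ ρ zf → (∀ st → zf st ≡ true → side st ≡ ρ) → ∀ p F st → All (Alternating role) (edges p F) →
    role p ≡ not (side st) → cost nxt zf F st ≤ share role ρ (nodes F)
  cost-share ρ zf h p ∅ st _ _ = z≤n
  cost-share ρ zf h p (v ⟨ F ⟩ G) st (av ∷ alt) rp = begin
    ind (zf st) + (cost nxt zf F (nxt st) + cost nxt zf G st)
      ≤⟨ +-mono-≤ (ind-mono (λ x → trans (cong (is ρ) (trans rv (h st x))) (is-refl ρ)))
           (+-mono-≤ (cost-share ρ zf h v F (nxt st) (Allₚ.++⁻ˡ (edges v F) alt) (trans rv (sym (trans (cong not (side-nxt st)) (Data.Bool.Properties.not-involutive (side st))))))
             (cost-share ρ zf h p G st (Allₚ.++⁻ʳ (edges v F) alt) rp)) ⟩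
    ind (is ρ (role v)) + (share role ρ (nodes F) + share role ρ (nodes G))
      ≡⟨ cong (ind (is ρ (role v)) +_) (total-++ _ (nodes F) (nodes G)) ⟨
    share role ρ (v ∷ nodes F ++ nodes G) ∎
    where
    open ≤-Reasoning
    rv : role v ≡ side st
    rv = trans av (trans (cong not rp) (Data.Bool.Properties.not-involutive (side st)))

  cost-none : ∀ zf → (∀ st → zf st ≡ true → ⊥) → ∀ (F : Forest m) st → cost nxt zf F st ≡ 0
  cost-none zf h ∅ st = refl
  cost-none zf h (v ⟨ F ⟩ G) st = cong₂ _+_ (cong ind (¬true⇒false (h st))) (cong₂ _+_ (cost-none zf h F (nxt st)) (cost-none zf h G st))

all-at : ∀ {A : Set} {P : A → Set} {xs} → All P xs → ∀ e → P (Data.List.lookup xs e)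
all-at (x ∷ _)  zero    = x
all-at (_ ∷ xs) (suc e) = all-at xs e

count-fresh : ∀ {m n} (f : Fin n → Bool) (al : List (Fin m × Fin n)) → count n f ≤ count n (f ∖ map proj₂ al) + use f al
count-fresh {n = n} f al = ≤-trans (count-∖ n f (map proj₂ al))
  (≤-reflexive (cong (count n (f ∖ map proj₂ al) +_) (total-map (ind ∘ f) proj₂ al)))

use-mono : ∀ {m n} {f g : Fin n → Bool} (al : List (Fin m × Fin n)) → (∀ z → f z ≡ true → g z ≡ true) → use f al ≤ use g al
use-mono al h = total-mono al (λ x _ → ind-mono (h (proj₂ x)))

links-fresh : ∀ {m n} (D : Digraph n) r y S (al : List (Fin m × Fin n)) →
  links D r y S ≤ links D r y (S ∖ map proj₂ al) + use S al
links-fresh {n = n} D r y S al = ≤-trans (count-fresh (λ z → adj D r y z ∧ S z) al)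
  (+-mono-≤ (count-mono n (λ z x → let a , b = ∖-elim (λ z → adj D r y z ∧ S z) (map proj₂ al) z x ; c , d = ∧-elim (adj D r y z) a in
               ∧-intro c (∖-intro S (map proj₂ al) z d b)))
            (use-mono al (λ z x → proj₂ (∧-elim (adj D r y z) x))))

use-fresh : ∀ {m n} (f : Fin n → Bool) (al : List (Fin m × Fin n)) → use (f ∖ map proj₂ al) al ≡ 0
use-fresh f al = go al (λ x → x)
  where
  go : ∀ bl → (∀ {x} → x ∈ bl → x ∈ al) → use (f ∖ map proj₂ al) bl ≡ 0
  go []       _   = refl
  go (x ∷ bl) sub = cong₂ _+_ (cong ind (¬true⇒false (λ y → proj₂ (∖-elim f (map proj₂ al) (proj₂ x) y) (∈-map⁺ proj₂ (sub (here refl)))))) (go bl (sub ∘ there))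

-- Embedding the pieces through connectors and bulks

module Assembly {n k dd ζ S : ℕ} {D : Digraph n} (fr : Frame D dd ζ S k) (dd>0 : 0 < dd) (ζ>0 : 0 < ζ) (n>0 : 0 < n) where
  open Frame fr

  -- A connector gets `8 * dd * h` vertices. At most `4 * h` of them are ever used, so at least
  -- `dd * (4 * h)` stay free, and a typical vertex has `4 * h` free neighbours there.
  cs s t : ℕ
  cs = 8 * dd * h
  s  = ζ * (8 * dd) * h
  t  = length M

  h>0 : 0 < h
  h>0 = factor>0 h n>0 (≤-trans n≤S*h (≤-reflexive (*-comm S h)))

  cs≤s : cs ≤ s
  cs≤s = *-monoˡ-≤ h (m≤n*m (8 * dd) ζ {{>-nonZero ζ>0}})

  8h≤ : ∀ {x} → cs ≤ dd * x → 8 * h ≤ x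
  8h≤ {x} e = *-cancelˡ-≤′ dd dd>0 (≤-trans (≤-reflexive (eq dd h)) e)
    where
    eq : ∀ d h → d * (8 * h) ≡ 8 * d * h
    eq = solve-∀

  h≤4ddh : h ≤ dd * (4 * h)
  h≤4ddh = ≤-trans (m≤n*m h 4) (m≤n*m (4 * h) dd {{>-nonZero dd>0}})

  4ddh+4h≤cs : dd * (4 * h) + 4 * h ≤ cs
  4ddh+4h≤cs = ≤-trans (+-monoʳ-≤ (dd * (4 * h)) (m≤n*m (4 * h) dd {{>-nonZero dd>0}})) (≤-reflexive (eq dd h))
    where
    eq : ∀ d h → d * (4 * h) + d * (4 * h) ≡ 8 * d * h
    eq = solve-∀

  h≤cs : h ≤ cs
  h≤cs = ≤-trans h≤4ddh (≤-trans (m≤m+n _ _) 4ddh+4h≤cs)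

  V : Fin q → Fin n → Bool
  V = cls p

  abstract
    connector : ∀ i → ∃ λ g → (∀ v → g v ≡ true → V i v ≡ true) × count n g ≡ cs
    connector i = subset-of-size n (V i) cs (≤-trans cs≤s (≤-reflexive (sym (size i))))

  C Bulk : Fin q → Fin n → Bool
  C i = proj₁ (connector i)
  Bulk i v = V i v ∧ not (C i v)

  C⊆V : ∀ i v → C i v ≡ true → V i v ≡ true
  C⊆V i = proj₁ (proj₂ (connector i))

  |C| : ∀ i → count n (C i) ≡ cs
  |C| i = proj₂ (proj₂ (connector i))

  Bulk⊆V : ∀ i v → Bulk i v ≡ true → V i v ≡ true
  Bulk⊆V i v x = proj₁ (∧-elim (V i v) x)

  |Bulk| : ∀ i → s ≤ count n (Bulk i) + cs
  |Bulk| i = begin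
    s                                  ≡⟨ size i ⟨
    count n (V i)                      ≤⟨ count-∪ n (λ v x → Data.Sum.swap (Data.Sum.map₂ (∧-intro x ∘ not-intro) (bool-cases (C i v)))) ⟩
    count n (Bulk i) + count n (C i)   ≡⟨ cong (count n (Bulk i) +_) (|C| i) ⟩
    count n (Bulk i) + cs              ∎
    where open ≤-Reasoning

  V-disjoint : ∀ {i j v} → V i v ≡ true → V j v ≡ true → i ≡ j
  V-disjoint {i} {j} {v} = cls-disjoint p i j v

  C-Bulk : ∀ {i j v} → C i v ≡ true → Bulk j v ≡ true → ⊥
  C-Bulk {i} {j} {v} c b with V-disjoint (C⊆V i v c) (Bulk⊆V j v b)
  ... | refl = true≢false c (not-elim (proj₂ (∧-elim (V i v) b)))

  -- What makes an image of role `r` usable as an anchor for later pieces: it has at least `8 * h`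
  -- neighbours in some connector of the component, of which `4 * h` survive any later use. The
  -- whole connector is tested, since that use is not yet known.
  ok? : ∀ r y → Dec (∃ λ j → Comp (not r) j ≡ true × cs ≤ dd * links D r y (C j))
  ok? r y = Fin.any? (λ j → (Comp (not r) j Data.Bool.≟ true) ×-dec (cs ≤? dd * links D r y (C j)))

  ok : Bool → Fin n → Bool
  ok r y = does (ok? r y)

  a b : Fin t → Fin q
  a = tail-of M
  b = head-of M

  ab-arc : ∀ e → R (a e) (b e) ≡ true × Comp true (a e) ≡ true × Comp false (b e) ≡ true
  ab-arc = all-at (AntiMatching.valid matching)

  uniq-ab : Unique (verts M)
  uniq-ab = AntiMatching.disjoint matching

  few : ∀ r i j (X : Fin n → Bool) → adj R r i j ≡ true → (∀ z → X z ≡ true → V j z ≡ true) → h ≤ count n X →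
    count n (atypical D dd r (V i) X) < h
  few = few-atypical D dd h V no-hole

  few-not-ok : ∀ r i j → adj R r i j ≡ true → Comp r i ≡ true → ∀ (X : Fin n → Bool) → (∀ z → X z ≡ true → V i z ≡ true) →
    count n (λ z → X z ∧ not (ok r z)) < h
  few-not-ok r i j e c X X⊆ = ≤-<-trans (count-mono n sub)
    (few r i j (C j) e (C⊆V j) (≤-trans h≤cs (≤-reflexive (sym (|C| j)))))
    where
    sub : ∀ z → (X z ∧ not (ok r z)) ≡ true → atypical D dd r (V i) (C j) z ≡ true
    sub z x = let x₁ , x₂ = ∧-elim (X z) x in
      ∧-intro (X⊆ z x₁) (not-intro (doesn't⁺ (count n (C j) ≤? dd * links D r z (C j)) (λ y →
        doesn't⁻ (ok? r z) (not-elim x₂) (j , closed′ r i j e c , ≤-trans (≤-reflexive (sym (|C| j))) y))))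

  -- Follow a walk to the tail of arc e through the connectors, then bounce along e.
  data Route (e : Fin t) : Set where
    conn    : ∀ r i l → Walk R r i true (a e) l → Comp r i ≡ true → Route e
    inA inB : Route e

  module _ {e : Fin t} where

    side : Route e → Bool
    side (conn r _ _ _ _) = r
    side inA              = true
    side inB              = false

    cluster : Route e → Fin q
    cluster (conn _ i _ _ _) = i
    cluster inA              = a e
    cluster inB              = b e

    nxt : Route e → Route e
    nxt (conn r i _ (step {j = j} d w) c) = conn (not r) j _ w (closed′ r i j d c)
    -- The walk has arrived at the tail class of `e`, whose connector takes this node; its children
    -- already go to the bulk of the head.
    nxt (conn r i _ stop c)               = inB
    nxt inA                               = inB
    nxt inB                               = inA

    base : Route e → Fin n → Bool
    base (conn _ i _ _ _) = C i
    base inA              = Bulk (a e)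
    base inB              = Bulk (b e)

    isConn isA isB : Route e → Bool
    isConn (conn _ _ _ _ _) = true
    isConn inA              = false
    isConn inB              = false
    isA (conn _ _ _ _ _) = false
    isA inA              = true
    isA inB              = false
    isB (conn _ _ _ _ _) = false
    isB inA              = false
    isB inB              = true

    side-nxt : ∀ st → side (nxt st) ≡ not (side st)
    side-nxt (conn r i _ (step d w) c) = refl
    side-nxt (conn r i _ stop c)       = refl
    side-nxt inA                       = refl
    side-nxt inB                       = refl

    adj-nxt : ∀ st → adj R (side st) (cluster st) (cluster (nxt st)) ≡ true
    adj-nxt (conn r i _ (step d w) c) = d
    adj-nxt (conn r i _ stop c)       = proj₁ (ab-arc e)
    adj-nxt inA                       = proj₁ (ab-arc e)
    adj-nxt inB                       = proj₁ (ab-arc e)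

    in-comp : ∀ st → Comp (side st) (cluster st) ≡ true
    in-comp (conn r i _ _ c) = c
    in-comp inA              = proj₁ (proj₂ (ab-arc e))
    in-comp inB              = proj₂ (proj₂ (ab-arc e))

    base⊆V : ∀ st z → base st z ≡ true → V (cluster st) z ≡ true
    base⊆V (conn r i _ _ c) = C⊆V i
    base⊆V inA              = Bulk⊆V (a e)
    base⊆V inB              = Bulk⊆V (b e)

  module _ {m : ℕ} (role : Fin m → Bool) (e : Fin t) (al : List (Fin m × Fin n))
    (C-use : ∀ i → use (C i) al ≤ 4 * h) (A-use : use (Bulk (a e)) al + 2 * cs ≤ s) (B-use : use (Bulk (b e)) al + 2 * cs ≤ s)
    (P : ℕ) (P<2h : P < 2 * h) where

    private
      bulk-left : ∀ i → use (Bulk i) al + 2 * cs ≤ s → dd * (4 * h) ≤ count n (Bulk i ∖ map proj₂ al)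
      bulk-left i u = ≤-trans (≤-trans (m≤m+n _ _) 4ddh+4h≤cs) (+-cancelʳ-≤ (use (Bulk i) al + cs) cs _ (begin
        cs + (use (Bulk i) al + cs)                                    ≡⟨ eq cs (use (Bulk i) al) ⟩
        use (Bulk i) al + 2 * cs                                       ≤⟨ u ⟩
        s                                                              ≤⟨ |Bulk| i ⟩
        count n (Bulk i) + cs                                          ≤⟨ +-monoˡ-≤ cs (count-fresh (Bulk i) al) ⟩
        count n (Bulk i ∖ map proj₂ al) + use (Bulk i) al + cs         ≡⟨ +-assoc (count n (Bulk i ∖ map proj₂ al)) _ _ ⟩
        count n (Bulk i ∖ map proj₂ al) + (use (Bulk i) al + cs)       ∎))
        where
        open ≤-Reasoning
        eq : ∀ c u → c + (u + c) ≡ u + 2 * c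
        eq = solve-∀

      conn-left : ∀ i → dd * (4 * h) ≤ count n (C i ∖ map proj₂ al)
      conn-left i = +-cancelʳ-≤ (4 * h) _ _ (≤-trans 4ddh+4h≤cs (≤-trans (≤-reflexive (sym (|C| i)))
        (≤-trans (count-fresh (C i) al) (+-monoʳ-≤ _ (C-use i)))))

      set : Route e → Fin n → Bool
      set st = base st ∖ map proj₂ al

      set⊆V : ∀ st z → set st z ≡ true → V (cluster st) z ≡ true
      set⊆V st z x = base⊆V st z (proj₁ (∖-elim (base st) (map proj₂ al) z x))

      left : ∀ st → dd * (4 * h) ≤ count n (set st)
      left (conn r i _ _ _) = conn-left i
      left inA              = bulk-left (a e) A-use
      left inB              = bulk-left (b e) B-use

    -- Every set keeps `dd * (4 * h)` free vertices, so a typical vertex has the `4 * h` links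
    -- demanded as `τ`. Excluding twice `h` and fewer than `2 * h` occupied vertices leaves a
    -- choice.
    plan : Plan D (Route e) ok (4 * h) P
    plan = record
      { set = set ; nxt = nxt ; side = side ; side-nxt = side-nxt ; h = h
      ; dull = λ st → <⇒≤ (≤-<-trans (count-mono n (λ z x → let x₁ , x₂ = ∧-elim (set st z) x in
          ∧-intro (set⊆V st z x₁) (not-intro (doesn't⁺ (count n (set (nxt st)) ≤? dd * links D (side st) z (set (nxt st))) (λ y →
            doesn't⁻ (4 * h ≤? links D (side st) z (set (nxt st))) (not-elim x₂)
              (*-cancelˡ-≤′ dd dd>0 (≤-trans (left (nxt st)) y)))))))
          (few (side st) (cluster st) (cluster (nxt st)) (set (nxt st)) (adj-nxt st) (set⊆V (nxt st)) (≤-trans h≤4ddh (left (nxt st)))))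
      ; not-ok = λ st → <⇒≤ (few-not-ok (side st) (cluster st) (cluster (nxt st)) (adj-nxt st) (in-comp st) (set st) (set⊆V st))
      ; room = ≤-trans (+-monoʳ-< (h + h) P<2h) (≤-reflexive (eq h)) }
      where
      eq : ∀ h → h + h + 2 * h ≡ 4 * h
      eq = solve-∀

  bulk-free : ∀ {m} {e : Fin t} (F : Forest m) (st : Route e) → isConn st ≡ false → cost nxt isConn F st ≡ 0
  bulk-free ∅           st  _ = refl
  bulk-free (v ⟨ F ⟩ G) inA _ = cong₂ _+_ (bulk-free F inB refl) (bulk-free G inA refl)
  bulk-free (v ⟨ F ⟩ G) inB _ = cong₂ _+_ (bulk-free F inA refl) (bulk-free G inB refl)

  -- Only the first `l + 1` levels of the piece lie in connectors, each at most `Δ` times as large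
  -- as the one above; the base `suc Δ` absorbs the sum over the levels.
  conn-cost : ∀ {m Δ} {e : Fin t} (F : Forest m) {r i l w c} → Bounded Δ F → cost nxt isConn F (conn {e} r i l w c) ≤ width F * suc Δ ^ l
  conn-cost ∅ _ = z≤n
  conn-cost {Δ = Δ} {e} (v ⟨ F ⟩ G) {r} {i} {l} {w} {c} (wF , bF , bG) = begin
    1 + (cost nxt isConn F (nxt (conn r i l w c)) + cost nxt isConn G (conn r i l w c))
      ≤⟨ +-monoʳ-≤ 1 (+-monoʳ-≤ (cost nxt isConn F (nxt (conn r i l w c))) (conn-cost G bG)) ⟩
    1 + cost nxt isConn F (nxt (conn r i l w c)) + width G * suc Δ ^ l
      ≤⟨ +-monoˡ-≤ (width G * suc Δ ^ l) (below l w) ⟩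
    suc Δ ^ l + width G * suc Δ ^ l ∎
    where
    open ≤-Reasoning
    below : ∀ {r i c} l (w : Walk R r i true (a e) l) → 1 + cost nxt isConn F (nxt (conn {e} r i l w c)) ≤ suc Δ ^ l
    below zero    stop       = ≤-reflexive (cong suc (bulk-free {e = e} F inB refl))
    below (suc l) (step d w) = +-mono-≤ (m^n>0 (suc Δ) l) (≤-trans (conn-cost F bF) (*-monoˡ-≤ (suc Δ ^ l) wF))

  q≤S : q ≤ S
  q≤S = *-cancelˡ-≤′ h h>0 (begin
    h * q                      ≤⟨ *-monoʳ-≤ h (m≤m*n q (ζ * (8 * dd)) {{>-nonZero (*-mono-≤ ζ>0 (≤-trans dd>0 (m≤n*m dd 8)))}}) ⟩
    h * (q * (ζ * (8 * dd)))   ≡⟨ eq h q (ζ * (8 * dd)) ⟩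
    q * s                      ≤⟨ classes-size n p s size ⟩
    n                          ≤⟨ n≤S*h ⟩
    S * h                      ≡⟨ *-comm S h ⟩
    h * S                      ∎)
    where
    open ≤-Reasoning
    eq : ∀ h q x → h * (q * x) ≡ q * (x * h)
    eq = solve-∀

  module Fold {m : ℕ} (role : Fin m → Bool) (Δ P W : ℕ) (P<2h : P < 2 * h) (W-large : suc Δ ^ suc (4 * S) ≤ W) where

    OkAt : Fin m × Fin n → Set
    OkAt (v , z) = ok (role v) z ≡ true

    weight : Bool → Piece m → ℕ
    weight ρ (v , F) = share role ρ (nodes F)

    Fit : Piece m → Set
    Fit (v , F) = order F ≤ P × width F ≤ Δ × Bounded Δ F × All (Alternating role) (edges v F)

    -- Bulk use counts what is placed and what is still assigned. Of the `2 * cs` kept back, one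
    -- half is the connector inside the class and the other keeps the bulk large enough for typical
    -- vertices to exist. Each remaining piece has `W` connector vertices set aside.
    record Inv (al : List (Fin m × Fin n)) (rest : List (Piece m × Fin t)) : Set where
      field
        images : Unique (map proj₂ al)
        okay   : All OkAt al
        C-use  : ∀ i → use (C i) al + W * length rest ≤ 4 * h
        A-use  : ∀ e → use (Bulk (a e)) al + bin-load (weight true) e rest + 2 * cs ≤ s
        B-use  : ∀ e → use (Bulk (b e)) al + bin-load (weight false) e rest + 2 * cs ≤ s

    private
      -- `c` tells whether the arc under consideration is the one the piece is assigned to; if not,
      -- the piece takes nothing from that arc's bulk.
      gated : ∀ c ρ (e : Fin t) (zf : Route e → Bool) → (∀ (st : Route e) → zf st ≡ true → side st ≡ ρ) → ∀ v F st → All (Alternating role) (edges v F) →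
        role v ≡ not (side st) → cost nxt (λ st → zf st ∧ c) F st ≤ share role ρ (nodes F) * ind c
      gated true ρ e zf h v F st alt rv = ≤-trans
        (cost-share role nxt side side-nxt ρ (λ st → zf st ∧ true) (λ st x → h st (proj₁ (∧-elim (zf st) x))) v F st alt rv)
        (≤-reflexive (sym (*-identityʳ _)))
      gated false ρ e zf h v F st alt rv = ≤-trans
        (≤-reflexive (cost-none role nxt side side-nxt (λ st → zf st ∧ false) (λ st x → true≢false (proj₂ (∧-elim (zf st) x)) refl) F st)) z≤n

    Result : List (Fin m × Fin n) → List (Piece m) → Set
    Result al ps = ∃ λ al′ → map proj₁ al′ ↭ pnodes ps ++ map proj₁ al × Unique (map proj₂ al′) ×
      (∀ {x} → x ∈ al → x ∈ al′) × All (Drawn D role al′) (pedges ps)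

    embed-pieces : ∀ rest al done → Inv al rest → Chain done (map proj₁ rest) → (∀ {x} → x ∈ done → x ∈ map proj₁ al) →
      All Fit (map proj₁ rest) → Result al (map proj₁ rest)
    embed-pieces [] al done inv _ _ _ = al , ↭-refl , Inv.images inv , id , []
    embed-pieces (((v , F) , e) ∷ rest) al done inv (v∈ , chain) done⊆ ((oF , wF , bF , alt) ∷ fits)
      with ∈-map⁻ proj₁ (done⊆ v∈)
    ... | (.v , y) , vy∈ , refl with does⁻ (ok? (role v) y) (All.lookup (Inv.okay inv) vy∈)
    -- The anchor `y` is well linked to the connector of `j`, and `(not (role v) , j)` lies in the
    -- component, so a short walk leads from there to the tail class of `e`.
    ... | j , cj , dense with connect (not (role v)) j true (a e) cj (proj₁ (proj₂ (ab-arc e)))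
    ... | l , l≤ , w = continue (embed-forest F v y st al 0 (sym (Data.Bool.Properties.not-involutive (role v))) alt enough vy∈ images okay
                          (λ st → ≤-reflexive (use-fresh (base st) al)) oF)
      where
      open Inv inv
      open ≤-Reasoning
      pl : Plan D (Route e) ok (4 * h) P
      pl = plan role e al (λ i → ≤-trans (m≤m+n (use (C i) al) _) (C-use i))
             (≤-trans (+-monoˡ-≤ (2 * cs) (m≤m+n (use (Bulk (a e)) al) _)) (A-use e)) (≤-trans (+-monoˡ-≤ (2 * cs) (m≤m+n (use (Bulk (b e)) al) _)) (B-use e)) P P<2h
      open Embed D role pl using (embed-forest; Embedded)
      st : Route e
      st = conn (not (role v)) j l w cj
      enough : 4 * h ≤ links D (role v) y (C j ∖ map proj₂ al)
      enough = +-cancelʳ-≤ (4 * h) _ _ (begin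
        4 * h + 4 * h                                          ≡⟨ eq h ⟩
        8 * h                                                  ≤⟨ 8h≤ dense ⟩
        links D (role v) y (C j)                               ≤⟨ links-fresh D (role v) y (C j) al ⟩
        links D (role v) y (C j ∖ map proj₂ al) + use (C j) al ≤⟨ +-monoʳ-≤ (links D (role v) y (C j ∖ map proj₂ al)) (≤-trans (m≤m+n (use (C j) al) _) (C-use j)) ⟩
        links D (role v) y (C j ∖ map proj₂ al) + 4 * h        ∎)
        where
        eq : ∀ h → 4 * h + 4 * h ≡ 8 * h
        eq = solve-∀
      walk-cost : cost nxt isConn F st ≤ W
      walk-cost = begin
        cost nxt isConn F st         ≤⟨ conn-cost F bF ⟩
        width F * suc Δ ^ l          ≤⟨ *-monoˡ-≤ (suc Δ ^ l) (≤-trans wF (n≤1+n Δ)) ⟩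
        suc Δ ^ suc l                ≤⟨ ^-monoʳ-≤ (suc Δ) (s≤s (≤-trans l≤ (≤-trans (≤-reflexive (eq q)) (*-monoʳ-≤ 4 q≤S)))) ⟩
        suc Δ ^ suc (4 * S)          ≤⟨ W-large ⟩
        W                            ∎
        where
        eq : ∀ q → 2 * q + 2 * q ≡ 4 * q
        eq = solve-∀
      continue : (∃ λ al′ → Embedded F v st al al′) → Result al (map proj₁ (((v , F) , e) ∷ rest))
      continue (al₁ , E) with embed-pieces rest al₁ (nodes F ++ done) inv₁ chain sub fits
        where
        from-base : ∀ st z → (base st ∖ map proj₂ al) z ≡ true → base st z ≡ true
        from-base st z x = proj₁ (∖-elim (base st) (map proj₂ al) z x)
        -- Connectors, bulks of tails and bulks of heads are pairwise disjoint, so a route through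
        -- the tail bulk of `e′` must be in state `inA` with `e ≡ e′`. This is the flag needed to
        -- charge the usage.
        in-A : ∀ e′ (st : Route e) z → base st z ≡ true → Bulk (a e′) z ≡ true → (isA st ∧ does (e Fin.≟ e′)) ≡ true
        in-A e′ (conn _ i _ _ _) z x y = ⊥-elim (C-Bulk {i} x y)
        in-A e′ inA z x y = does⁺ (e Fin.≟ e′) (tail-injective M uniq-ab e e′ (V-disjoint (Bulk⊆V _ z x) (Bulk⊆V _ z y)))
        in-A e′ inB z x y = ⊥-elim (tail≢head M uniq-ab e′ e (V-disjoint (Bulk⊆V _ z y) (Bulk⊆V _ z x)))
        in-B : ∀ e′ (st : Route e) z → base st z ≡ true → Bulk (b e′) z ≡ true → (isB st ∧ does (e Fin.≟ e′)) ≡ true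
        in-B e′ (conn _ i _ _ _) z x y = ⊥-elim (C-Bulk {i} x y)
        in-B e′ inB z x y = does⁺ (e Fin.≟ e′) (head-injective M uniq-ab e e′ (V-disjoint (Bulk⊆V _ z x) (Bulk⊆V _ z y)))
        in-B e′ inA z x y = ⊥-elim (tail≢head M uniq-ab e e′ (V-disjoint (Bulk⊆V _ z x) (Bulk⊆V _ z y)))
        in-C : ∀ i (st : Route e) z → base st z ≡ true → C i z ≡ true → isConn st ≡ true
        in-C i (conn _ _ _ _ _) z x y = refl
        in-C i inA z x y = ⊥-elim (C-Bulk {i} y x)
        in-C i inB z x y = ⊥-elim (C-Bulk {i} y x)
        isA⇒ : ∀ (st : Route e) → isA st ≡ true → side st ≡ true
        isA⇒ inA _ = refl
        isB⇒ : ∀ (st : Route e) → isB st ≡ true → side st ≡ false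
        isB⇒ inB _ = refl
        rv : role v ≡ not (side st)
        rv = sym (Data.Bool.Properties.not-involutive (role v))
        bulk-step : ∀ {u u₁ c x y} → u₁ ≤ c + u → c ≤ x → u + (x + y) + 2 * cs ≤ s → u₁ + y + 2 * cs ≤ s
        bulk-step {u} {u₁} {c} {x} {y} h₁ h₂ h₃ = begin
          u₁ + y + 2 * cs         ≤⟨ +-monoˡ-≤ (2 * cs) (+-monoˡ-≤ y (≤-trans h₁ (+-monoˡ-≤ u h₂))) ⟩
          x + u + y + 2 * cs      ≡⟨ cong (_+ 2 * cs) (eq x u y) ⟩
          u + (x + y) + 2 * cs    ≤⟨ h₃ ⟩
          s                       ∎
          where
          eq : ∀ x u y → x + u + y ≡ u + (x + y)
          eq = solve-∀
        inv₁ : Inv al₁ rest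
        inv₁ = record
          { images = Embedded.images E ; okay = Embedded.okay E
          ; C-use = λ i → begin
              use (C i) al₁ + W * length rest
                ≤⟨ +-monoˡ-≤ (W * length rest) (≤-trans (Embedded.usage E (C i) isConn (λ st z x y → in-C i st z (from-base st z x) y)) (+-monoˡ-≤ (use (C i) al) walk-cost)) ⟩
              W + use (C i) al + W * length rest
                ≡⟨ eq W (use (C i) al) (length rest) ⟩
              use (C i) al + W * suc (length rest)
                ≤⟨ C-use i ⟩
              4 * h ∎
          ; A-use = λ e′ → bulk-step {use (Bulk (a e′)) al} (Embedded.usage E (Bulk (a e′)) (λ st → isA st ∧ does (e Fin.≟ e′)) (λ st z x y → in-A e′ st z (from-base st z x) y))
              (gated (does (e Fin.≟ e′)) true e isA isA⇒ v F st alt rv) (A-use e′)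
          ; B-use = λ e′ → bulk-step {use (Bulk (b e′)) al} (Embedded.usage E (Bulk (b e′)) (λ st → isB st ∧ does (e Fin.≟ e′)) (λ st z x y → in-B e′ st z (from-base st z x) y))
              (gated (does (e Fin.≟ e′)) false e isB isB⇒ v F st alt rv) (B-use e′) }
          where
          eq : ∀ w u l → w + u + w * l ≡ u + w * suc l
          eq = solve-∀
        sub : ∀ {x} → x ∈ nodes F ++ done → x ∈ map proj₁ al₁
        sub x∈ with ∈-++⁻ (nodes F) x∈
        ... | inj₁ y = Perm.∈-resp-↭ (↭-sym (Embedded.keys E)) (∈-++⁺ˡ y)
        ... | inj₂ y = Perm.∈-resp-↭ (↭-sym (Embedded.keys E)) (∈-++⁺ʳ (nodes F) (done⊆ y))
      ... | al₂ , keys , images₂ , keeps , drawn = al₂ ,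
            ↭-trans keys (↭-trans (Perm.++⁺ˡ (pnodes (map proj₁ rest)) (Embedded.keys E))
              (↭-trans (Perm.shifts (pnodes (map proj₁ rest)) (nodes F)) (↭-reflexive (sym (++-assoc (nodes F) _ _))))) ,
            images₂ , keeps ∘ Embedded.keeps E , Allₚ.++⁺ (All.map (drawn-mono D role keeps) (Embedded.drawn E)) drawn

-- Embedding the whole tree

exception-exists : ∀ n (f g : Fin n → Bool) → count n (λ z → f z ∧ not (g z)) < count n f → ∃ λ z → f z ≡ true × g z ≡ true
exception-exists n f g few with count-<⇒∃ n {λ z → f z ∧ not (g z)} {f} few
... | z , fz , x = z , fz , decidable-stable (g z Data.Bool.≟ true) (λ ¬g → true≢false (∧-intro fz (not-intro (¬true⇒false ¬g))) x)

unique-tail : ∀ {A : Set} {x : A} {xs} → Unique (x ∷ xs) → Unique xs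
unique-tail (_ ∷ u) = u

keys-unique : ∀ {A B : Set} {l : List (A × B)} {a b b′} → Unique (map proj₁ l) → (a , b) ∈ l → (a , b′) ∈ l → b ≡ b′
keys-unique (x ∷ u) (here refl) (here refl) = refl
keys-unique (x ∷ u) (here refl) (there q)   = ⊥-elim (All.lookup x (∈-map⁺ proj₁ q) refl)
keys-unique (x ∷ u) (there p)   (here refl) = ⊥-elim (All.lookup x (∈-map⁺ proj₁ p) refl)
keys-unique (x ∷ u) (there p)   (there q)   = keys-unique u p q

values-unique : ∀ {A B : Set} {l : List (A × B)} {a a′ b} → Unique (map proj₂ l) → (a , b) ∈ l → (a′ , b) ∈ l → a ≡ a′
values-unique (x ∷ u) (here refl) (here refl) = refl
values-unique (x ∷ u) (here refl) (there q)   = ⊥-elim (All.lookup x (∈-map⁺ proj₂ q) refl)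
values-unique (x ∷ u) (there p)   (here refl) = ⊥-elim (All.lookup x (∈-map⁺ proj₂ p) refl)
values-unique (x ∷ u) (there p)   (there q)   = values-unique u p q

pedges-all : ∀ {m} {A : Fin m × Fin m → Set} ps → All A (pedges ps) → All (λ x → All A (edges (proj₁ x) (proj₂ x))) ps
pedges-all []             _ = []
pedges-all ((v , F) ∷ ps) a = Allₚ.++⁻ˡ (edges v F) a ∷ pedges-all ps (Allₚ.++⁻ʳ (edges v F) a)

total-share : ∀ {m} (role : Fin m → Bool) ρ (ps : List (Piece m)) →
  total (λ x → share role ρ (nodes (proj₂ x))) ps ≡ share role ρ (pnodes ps)
total-share role ρ []             = refl
total-share role ρ ((v , F) ∷ ps) = trans (cong (share role ρ (nodes F) +_) (total-share role ρ ps)) (sym (total-++ _ (nodes F) (pnodes ps)))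

-- `W * S ≤ σ` keeps pieces so few that their walks together use at most about `n / S ≤ h` connector
-- vertices. The cubic bound on `P` makes the rounding of the assignment smaller than a connector.
embed-forest-in-frame : ∀ {n k dd ζ S Δ σ P W m} {D : Digraph n} (fr : Frame D dd ζ S k) → 0 < dd → 0 < ζ → 0 < n →
  suc Δ ^ suc (4 * S) ≤ W → 0 < σ → W * S ≤ σ → Δ * σ ≤ P → W ≤ Frame.h fr → suc P * suc P * suc P ≤ Frame.h fr →
  (role : Fin m → Bool) (top : Fin m) (F : Forest m) → m ≤ suc k → Unique (top ∷ nodes F) →
  All (Alternating role) (edges top F) → width F ≤ Δ → Bounded Δ F → (∀ ρ → 2 * count m (λ v → is ρ (role v)) ≤ suc k) →
  Σ[ al ∈ List (Fin m × Fin n) ] map proj₁ al ↭ top ∷ nodes F × Unique (map proj₂ al) × All (Drawn D role al) (edges top F)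
embed-forest-in-frame {n} {k} {dd} {ζ} {S} {Δ} {σ} {P} {W} {m} {D} fr dd>0 ζ>0 n>0 W-large σ>0 WS≤σ Δσ≤P W≤h P³≤h
  role top F m≤ unique alternates wF bounded-F half = conclude (embed-pieces as al₀ (top ∷ []) inv₀ chain₀ done₀ fits)
  where
  open ≤-Reasoning
  open Frame fr
  open Assembly fr dd>0 ζ>0 n>0

  P+1≤h : suc P ≤ h
  P+1≤h = ≤-trans (≤-trans (m≤m*n (suc P) (suc P)) (m≤m*n (suc P * suc P) (suc P))) P³≤h

  open Fold role Δ P W (≤-trans P+1≤h (m≤n*m h 2)) W-large

  S>0 : 0 < S
  S>0 = factor>0 S n>0 n≤S*h

  t>0 : 0 < t
  t>0 with t in eq
  ... | suc _ = s≤s z≤n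
  ... | zero  = ⊥-elim (n≮0 (≤-trans (≤-trans (m≤m+n (suc k) _) capacity) (≤-reflexive (cong (λ x → 2 * (x * s)) eq))))

  k≤n : k ≤ n
  k≤n = begin
    k                     ≤⟨ n≤1+n k ⟩
    suc k                 ≤⟨ ≤-trans (m≤m+n (suc k) _) capacity ⟩
    2 * (t * s)           ≡⟨ *-assoc 2 t s ⟨
    2 * t * s             ≡⟨ cong (_* s) (length-verts M) ⟨
    length (verts M) * s  ≤⟨ *-monoˡ-≤ s (unique-length q (verts M) uniq-ab) ⟩
    q * s                 ≤⟨ classes-size n p s size ⟩
    n                     ∎

  open Cut {m} σ σ>0

  F₀ : Forest m
  F₀ = proj₁ (cut F)

  ps ps₀ : List (Piece m)
  ps  = proj₂ (cut F)
  -- The remainder at the top is a piece below the root. It may have fewer than `σ` nodes, so the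
  -- count of pieces by size skips it and its walk is paid for separately by `W≤h`.
  ps₀ = (top , F₀) ∷ ps

  unique-F : Unique (nodes F)
  unique-F = unique-tail unique

  unique-ps₀ : Unique (pnodes ps₀)
  unique-ps₀ = Unique-resp-↭ (cut-nodes F) unique-F

  small : Bounded Δ F₀ × All (Small Δ) ps × All (λ x → σ ≤ order (proj₂ x)) ps
  small = cut-small F bounded-F

  alternating : All (λ x → All (Alternating role) (edges (proj₁ x) (proj₂ x))) ps₀
  alternating = pedges-all {A = Alternating role} ps₀ (Perm.All-resp-↭ (cut-edges top F) alternates)

  fits₀ : All Fit ps₀
  fits₀ = All.zipWith (λ ((o , w , b) , a) → ≤-trans o Δσ≤P , w , b , a)
    ((≤-trans (cut-order F) (*-monoˡ-≤ σ wF) , ≤-trans (≤-reflexive (cut-width F)) wF , proj₁ small) ∷ proj₁ (proj₂ small) , alternating)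

  weight≤P : ∀ ρ x → x ∈ ps₀ → weight ρ x ≤ P
  weight≤P ρ x x∈ = ≤-trans (share≤length role ρ (nodes (proj₂ x)))
    (≤-trans (≤-reflexive (length-nodes (proj₂ x))) (proj₁ (All.lookup fits₀ x∈)))

  assigned : _
  assigned = assign (weight true) (weight false) P t>0 ps₀ (λ x x∈ → weight≤P true x x∈ , weight≤P false x x∈)

  as : List (Piece m × Fin t)
  as = proj₁ assigned

  as-pieces : map proj₁ as ≡ ps₀
  as-pieces = proj₁ (proj₂ assigned)

  -- At most half of the tree has role `ρ`. Together with `2 * cs` of reserve and at most `cs` of
  -- rounding per bin, doubling gives exactly the left side of `capacity`.
  load≤ : ∀ ρ e → t * bin-load (weight ρ) e as ≤ total (weight ρ) ps₀ + t * (suc P * suc P * P) →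
    bin-load (weight ρ) e as + 2 * cs ≤ s
  load≤ ρ e bound = *-cancelˡ-≤′ t t>0 (*-cancelˡ-≤′ 2 (s≤s z≤n) (begin
    2 * (t * (bin-load (weight ρ) e as + 2 * cs))
      ≡⟨ eq₁ t (bin-load (weight ρ) e as) cs ⟩
    2 * (t * bin-load (weight ρ) e as) + 4 * (t * cs)
      ≤⟨ +-monoˡ-≤ (4 * (t * cs)) (*-monoʳ-≤ 2 (≤-trans bound (+-mono-≤ shares (*-monoʳ-≤ t X≤cs)))) ⟩
    2 * (count m (λ v → is ρ (role v)) + t * cs) + 4 * (t * cs)
      ≡⟨ eq₂ (count m (λ v → is ρ (role v))) (t * cs) ⟩
    2 * count m (λ v → is ρ (role v)) + 6 * (t * cs)
      ≤⟨ +-monoˡ-≤ (6 * (t * cs)) (half ρ) ⟩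
    suc k + 6 * (t * cs)
      ≤⟨ capacity ⟩
    2 * (t * s) ∎))
    where
    shares : total (weight ρ) ps₀ ≤ count m (λ v → is ρ (role v))
    shares = ≤-trans (≤-reflexive (total-share role ρ ps₀)) (unique-count m (λ v → is ρ (role v)) (pnodes ps₀) unique-ps₀)
    X≤cs : suc P * suc P * P ≤ cs
    X≤cs = ≤-trans (*-monoʳ-≤ (suc P * suc P) (n≤1+n P)) (≤-trans P³≤h h≤cs)
    eq₁ : ∀ t l c → 2 * (t * (l + 2 * c)) ≡ 2 * (t * l) + 4 * (t * c)
    eq₁ = solve-∀
    eq₂ : ∀ x y → 2 * (x + y) + 4 * y ≡ 2 * x + 6 * y
    eq₂ = solve-∀

  e₀ : Fin t
  e₀ = Data.Fin.fromℕ< t>0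

  root-cluster : ∃ λ i → ∃ λ j → adj R (role top) i j ≡ true × Comp (role top) i ≡ true
  root-cluster with role top
  ... | true  = a e₀ , b e₀ , proj₁ (ab-arc e₀) , proj₁ (proj₂ (ab-arc e₀))
  ... | false = b e₀ , a e₀ , proj₁ (ab-arc e₀) , proj₂ (proj₂ (ab-arc e₀))

  -- The root is placed in a connector, so bulk use starts at 0 and is caused by pieces alone.
  root-image : ∃ λ y → C (proj₁ root-cluster) y ≡ true × ok (role top) y ≡ true
  root-image = pick root-cluster
    where
    pick : ((i , _) : ∃ λ i → ∃ λ j → adj R (role top) i j ≡ true × Comp (role top) i ≡ true) →
      ∃ λ y → C i y ≡ true × ok (role top) y ≡ true
    pick (i , j , d , c) = exception-exists n (C i) (ok (role top))
      (≤-trans (few-not-ok (role top) i j d c (C i) (C⊆V i)) (≤-trans h≤cs (≤-reflexive (sym (|C| i)))))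

  al₀ : List (Fin m × Fin n)
  al₀ = (top , proj₁ root-image) ∷ []

  root-not-bulk : ∀ i → use (Bulk i) al₀ ≡ 0
  root-not-bulk i = cong (λ x → ind x + 0) (¬true⇒false (C-Bulk {proj₁ root-cluster} {i} (proj₁ (proj₂ root-image))))

  connectors-suffice : ∀ i → use (C i) al₀ + W * length as ≤ 4 * h
  connectors-suffice i = begin
    use (C i) al₀ + W * length as      ≤⟨ +-mono-≤ (+-monoˡ-≤ 0 (ind≤1 (C i (proj₁ root-image)))) (≤-reflexive (cong (W *_) len)) ⟩
    1 + W * suc (length ps)            ≡⟨ cong suc (*-suc W (length ps)) ⟩
    1 + (W + W * length ps)            ≤⟨ +-mono-≤ h>0 (+-mono-≤ W≤h many) ⟩
    h + (h + h)                        ≤⟨ m≤m+n _ h ⟩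
    h + (h + h) + h                    ≡⟨ eq₂ h ⟩
    4 * h                              ∎
    where
    len : length as ≡ suc (length ps)
    len = trans (sym (length-map proj₁ as)) (cong length as-pieces)
    eq₁ : ∀ s w l → s * (w * l) ≡ l * (w * s)
    eq₁ = solve-∀
    eq₂ : ∀ h → h + (h + h) + h ≡ 4 * h
    eq₂ = solve-∀
    many : W * length ps ≤ h
    many = *-cancelˡ-≤′ S S>0 (begin
      S * (W * length ps)                 ≡⟨ eq₁ S W (length ps) ⟩
      length ps * (W * S)                 ≤⟨ *-monoʳ-≤ (length ps) WS≤σ ⟩
      length ps * σ                       ≤⟨ length-pnodes σ ps (proj₂ (proj₂ small)) ⟩
      length (pnodes ps)                  ≤⟨ m≤n+m _ (length (nodes F₀)) ⟩
      length (nodes F₀) + length (pnodes ps) ≡⟨ length-++ (nodes F₀) ⟨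
      length (pnodes ps₀)                 ≡⟨ Perm.↭-length (cut-nodes F) ⟨
      length (nodes F)                    ≤⟨ ≤-pred (≤-trans (unique-length m (top ∷ nodes F) unique) m≤) ⟩
      k                                   ≤⟨ k≤n ⟩
      n                                   ≤⟨ n≤S*h ⟩
      S * h                               ∎)

  inv₀ : Inv al₀ as
  inv₀ = record
    { images = [] ∷ [] ; okay = proj₂ (proj₂ root-image) ∷ []
    ; C-use = connectors-suffice
    ; A-use = λ e → ≤-trans (≤-reflexive (cong (λ x → x + bin-load (weight true) e as + 2 * cs) (root-not-bulk (a e))))
                      (load≤ true e (proj₁ (proj₂ (proj₂ assigned)) e))
    ; B-use = λ e → ≤-trans (≤-reflexive (cong (λ x → x + bin-load (weight false) e as + 2 * cs) (root-not-bulk (b e))))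
                      (load≤ false e (proj₂ (proj₂ (proj₂ assigned)) e)) }

  chain₀ : Chain (top ∷ []) (map proj₁ as)
  chain₀ = subst (Chain (top ∷ [])) (sym as-pieces) (here refl , cut-chain F ∈-++⁺ˡ)

  done₀ : ∀ {x} → x ∈ top ∷ [] → x ∈ map proj₁ al₀
  done₀ x = x

  fits : All Fit (map proj₁ as)
  fits = subst (All Fit) (sym as-pieces) fits₀

  conclude : Result al₀ (map proj₁ as) → _
  conclude (al , keys , images , keeps , drawn) = al ,
    ↭-trans keys (↭-trans (Perm.++-comm (pnodes (map proj₁ as)) (top ∷ []))
      (prep top (↭-trans (↭-reflexive (cong pnodes as-pieces)) (↭-sym (cut-nodes F))))) ,
    images , Perm.All-resp-↭ (↭-sym (cut-edges top F)) (subst (All (Drawn D role al)) (cong pedges as-pieces) drawn)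

containment : ∀ {n m} {D : Digraph n} (T : Digraph m) → Antidirected T → ∀ {l es} (al : List (Fin m × Fin n)) →
  map proj₁ al ↭ l → Unique l → (∀ v → v ∈ l) → Unique (map proj₂ al) → All (Drawn D (src T) al) es →
  (∀ u v → T u v ≡ true → (u , v) ∈ es ⊎ (v , u) ∈ es) → Contains D T
containment {n} {m} {D} T anti {l} {es} al keys unique covers images drawn all-arcs = f , injective , preserves
  where
  unique-keys : Unique (map proj₁ al)
  unique-keys = Unique-resp-↭ (↭-sym keys) unique
  placed : ∀ v → ∃ λ y → (v , y) ∈ al
  placed v with ∈-map⁻ proj₁ (Perm.∈-resp-↭ (↭-sym keys) (covers v))
  ... | (.v , y) , y∈ , refl = y , y∈
  f : Fin m → Fin n
  f v = proj₁ (placed v)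
  f-unique : ∀ {v y} → (v , y) ∈ al → f v ≡ y
  f-unique {v} = keys-unique unique-keys (proj₂ (placed v))
  injective : Injective _≡_ _≡_ f
  injective {u} {v} e = values-unique images (subst (λ y → (u , y) ∈ al) e (proj₂ (placed u))) (proj₂ (placed v))
  drawn-at : ∀ u v → Drawn D (src T) al (u , v) → adj D (src T u) (f u) (f v) ≡ true
  drawn-at u v (y , z , y∈ , z∈ , d) = trans (cong₂ (adj D (src T u)) (f-unique y∈) (f-unique z∈)) d
  preserves : ∀ u v → T u v ≡ true → D (f u) (f v) ≡ true
  preserves u v t =
    [ (λ x → trans (cong (λ r → adj D r (f u) (f v)) (sym (arc-tail T anti u v t))) (drawn-at u v (All.lookup drawn x)))
    , (λ x → trans (cong (λ r → adj D r (f v) (f u)) (sym (arc-head T anti u v t))) (drawn-at v u (All.lookup drawn x)))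
    ]′ (all-arcs u v t)

embed-antitree : ∀ {n k dd ζ S Δ} {D : Digraph n} (fr : Frame D dd ζ S (suc k)) → 0 < dd → 0 < ζ → 0 < n →
  ∀ W P → suc Δ ^ suc (4 * S) ≤ W → Δ * (W * S) ≤ P → W ≤ Frame.h fr → suc P * suc P * suc P ≤ Frame.h fr →
  (T : Digraph (suc (suc k))) → AntiTree (suc k) T → Balanced T → MaxDegLe T Δ → Contains D T
embed-antitree {n} {k} {dd} {ζ} {S} {Δ} {D} fr dd>0 ζ>0 n>0 W P W-large P-large W≤h P³≤h T (_ , anti , conn , arcs-T) bal deg =
  conclude (embed-forest-in-frame fr dd>0 ζ>0 n>0 W-large (*-mono-≤ W>0 S>0) ≤-refl P-large W≤h P³≤h (src T) zero F ≤-refl unique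
    (All.map (λ {x} → adj-alternate T anti {proj₁ x} {proj₂ x}) adjs)
    (width≤ T deg zero F unique-F adjs) (bounded T deg zero F unique-F adjs) half)
  where
  m : ℕ
  m = suc (suc k)

  open Spanning (spanning T conn arcs-T)

  W>0 : 0 < W
  W>0 = ≤-trans (m^n>0 (suc Δ) (suc (4 * S))) W-large

  S>0 : 0 < S
  S>0 = factor>0 S n>0 (Frame.n≤S*h fr)

  unique-F : Unique (nodes F)
  unique-F = unique-tail unique

  half : ∀ ρ → 2 * count m (λ v → is ρ (src T v)) ≤ m
  half true  = half-sources T anti conn bal
  half false = half-sinks T anti conn bal

  conclude : (Σ[ al ∈ List (Fin m × Fin n) ] map proj₁ al ↭ zero ∷ nodes F × Unique (map proj₂ al) × All (Drawn D (src T) al) (edges zero F)) →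
    Contains D T
  conclude (al , keys , images , drawn) = containment T anti al keys unique covers images drawn all-arcs

-- Polylogarithms are eventually small

^-distribʳ-* : ∀ o m n → (m * n) ^ o ≡ m ^ o * n ^ o
^-distribʳ-* zero    m n = refl
^-distribʳ-* (suc o) m n = trans (cong (m * n *_) (^-distribʳ-* o m n)) (eq m n (m ^ o) (n ^ o))
  where
  eq : ∀ a b c d → a * b * (c * d) ≡ a * c * (b * d)
  eq = solve-∀

n≤2^n : ∀ n → suc n ≤ 2 ^ n
n≤2^n zero    = ≤-refl
n≤2^n (suc n) = ≤-trans (+-mono-≤ (≤-trans (s≤s z≤n) (n≤2^n n)) (n≤2^n n)) (≤-reflexive (cong (2 ^ n +_) (sym (+-identityʳ (2 ^ n)))))

-- Induction on the exponent by halving: with `j = l / 2`, one factor `2 ^ j` absorbs a factor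
-- `suc j` and the other is left to the induction hypothesis. Replacing `suc l` by `2 * suc j` costs
-- the constant `2 ^ suc B`.
poly-exp : ∀ B A → ∃ λ l₀ → ∀ l → l₀ ≤ l → A * suc l ^ B ≤ 2 ^ l
poly-exp zero A = A , λ l A≤l → ≤-trans (≤-reflexive (*-identityʳ A)) (≤-trans A≤l (≤-trans (n≤1+n l) (n≤2^n l)))
poly-exp (suc B) A with poly-exp B (A * 2 ^ suc B)
... | j₀ , below = 2 * j₀ , halve
  where
  open ≤-Reasoning
  halve : ∀ l → 2 * j₀ ≤ l → A * suc l ^ suc B ≤ 2 ^ l
  halve l l≥ = begin
    A * suc l ^ suc B                          ≤⟨ *-monoʳ-≤ A (^-monoˡ-≤ (suc B) sl≤) ⟩
    A * (2 * suc j) ^ suc B                    ≡⟨ cong (A *_) (^-distribʳ-* (suc B) 2 (suc j)) ⟩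
    A * (2 ^ suc B * (suc j * suc j ^ B))      ≡⟨ eq A (2 ^ suc B) (suc j) (suc j ^ B) ⟩
    suc j * (A * 2 ^ suc B * suc j ^ B)        ≤⟨ *-mono-≤ (n≤2^n j) (below j j≥) ⟩
    2 ^ j * 2 ^ j                              ≡⟨ ^-distribˡ-+-* 2 j j ⟨
    2 ^ (j + j)                                ≤⟨ ^-monoʳ-≤ 2 2j≤l ⟩
    2 ^ l                                      ∎
    where
    j : ℕ
    j = l / 2
    eq : ∀ a b c d → a * (b * (c * d)) ≡ c * (a * b * d)
    eq = solve-∀
    double : j * 2 ≡ j + j
    double = trans (*-comm j 2) (cong (j +_) (+-identityʳ j))
    2j≤l : j + j ≤ l
    2j≤l = ≤-trans (≤-reflexive (sym double)) (m/n*n≤m l 2)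
    sl≤ : suc l ≤ 2 * suc j
    sl≤ = begin
      suc l                     ≡⟨ cong suc (m≡m%n+[m/n]*n l 2) ⟩
      suc (l Data.Nat.DivMod.% 2 + j * 2)     ≤⟨ s≤s (+-monoˡ-≤ (j * 2) (≤-pred (m%n<n l 2))) ⟩
      2 + j * 2                 ≡⟨ cong (2 +_) (*-comm j 2) ⟩
      2 + 2 * j                 ≡⟨ *-suc 2 j ⟨
      2 * suc j                 ∎
    j≥ : j₀ ≤ j
    j≥ = ≮⇒≥ λ j<j₀ → <⇒≱ (begin-strict
      l           <⟨ sl≤ ⟩
      2 * suc j   ≤⟨ *-monoʳ-≤ 2 j<j₀ ⟩
      2 * j₀      ∎) l≥

-- If the rounded logarithm of `n` is `suc j`, then `n` exceeds `2 ^ j`, half of the power supplied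
-- by `poly-exp`; this is why `A` is doubled there.
polylog : ∀ A B → ∃ λ n₀ → ∀ n → n₀ ≤ n → A * suc ⌈log₂ n ⌉ ^ B ≤ n
polylog A B with poly-exp B (2 * A)
... | l₀ , below = 2 ^ suc l₀ , bound
  where
  open ≤-Reasoning
  bound : ∀ n → 2 ^ suc l₀ ≤ n → A * suc ⌈log₂ n ⌉ ^ B ≤ n
  bound n n≥ = from ⌈log₂ n ⌉ refl (≤-trans (≤-reflexive (sym (⌈log₂2^n⌉≡n (suc l₀)))) (⌈log₂⌉-mono-≤ n≥))
    where
    from : ∀ l → ⌈log₂ n ⌉ ≡ l → suc l₀ ≤ l → A * suc l ^ B ≤ n
    from (suc j) eq l≥ = *-cancelˡ-≤ 2 (begin
      2 * (A * suc (suc j) ^ B)   ≡⟨ *-assoc 2 A _ ⟨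
      2 * A * suc (suc j) ^ B     ≤⟨ below (suc j) (≤-trans (n≤1+n l₀) l≥) ⟩
      2 * 2 ^ j                   ≤⟨ *-monoʳ-≤ 2 (<⇒≤ (≰⇒> λ n≤ → <-irrefl refl (begin-strict
        j               <⟨ ≤-reflexive (sym eq) ⟩
        ⌈log₂ n ⌉       ≤⟨ ⌈log₂⌉-mono-≤ {n} {2 ^ j} n≤ ⟩
        ⌈log₂ 2 ^ j ⌉   ≡⟨ ⌈log₂2^n⌉≡n j ⟩
        j               ∎))) ⟩
      2 * n                       ∎)

-- With `y = suc Δ` and `w = suc (4 * S)`, both `W = y ^ w` and `suc P ≤ suc S * y ^ suc w` are
-- powers of `y` up to constants. The cube of the latter dominates everything, and `y` is at most
-- twice a power of the logarithm.
sizes-fit : ∀ c S → ∃ λ n₀ → ∀ n → n₀ ≤ n → ∀ Δ → Δ ≡ ⌈log₂ n ⌉ ^ c →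
  let W = suc Δ ^ suc (4 * S) ; P = Δ * (W * S) in
  S * W ≤ n × S * (suc P * suc P * suc P) ≤ n
sizes-fit c S with polylog (suc S * suc S * suc S * suc S * 2 ^ (3 * suc (suc (4 * S)))) (c * (3 * suc (suc (4 * S))))
... | n₀ , below = n₀ , λ { n n≥ Δ refl → bounds n n≥ (⌈log₂ n ⌉ ^ c) refl }
  where
  open ≤-Reasoning
  w E : ℕ
  w = suc (4 * S)
  E = 3 * suc w
  bounds : ∀ n → n₀ ≤ n → ∀ Δ → Δ ≡ ⌈log₂ n ⌉ ^ c →
    S * suc Δ ^ w ≤ n × S * (suc (Δ * (suc Δ ^ w * S)) * suc (Δ * (suc Δ ^ w * S)) * suc (Δ * (suc Δ ^ w * S))) ≤ n
  bounds n n≥ Δ Δ≡ = ≤-trans W≤ power , ≤-trans P≤ power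
    where
    s y W l : ℕ
    s = suc S
    y = suc Δ
    W = y ^ w
    l = suc ⌈log₂ n ⌉
    W>0 : 0 < W
    W>0 = m^n>0 y w
    y≤ : y ≤ 2 * l ^ c
    y≤ = begin
      suc Δ               ≡⟨ cong suc Δ≡ ⟩
      1 + ⌈log₂ n ⌉ ^ c   ≤⟨ +-mono-≤ (m^n>0 l c) (^-monoˡ-≤ c (n≤1+n ⌈log₂ n ⌉)) ⟩
      l ^ c + l ^ c       ≡⟨ cong (l ^ c +_) (+-identityʳ (l ^ c)) ⟨
      2 * l ^ c           ∎
    power : s * s * s * s * y ^ E ≤ n
    power = begin
      s * s * s * s * y ^ E                      ≤⟨ *-monoʳ-≤ (s * s * s * s) (^-monoˡ-≤ E y≤) ⟩
      s * s * s * s * (2 * l ^ c) ^ E            ≡⟨ cong (s * s * s * s *_) (^-distribʳ-* E 2 (l ^ c)) ⟩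
      s * s * s * s * (2 ^ E * (l ^ c) ^ E)      ≡⟨ *-assoc (s * s * s * s) (2 ^ E) ((l ^ c) ^ E) ⟨
      s * s * s * s * 2 ^ E * (l ^ c) ^ E        ≡⟨ cong (s * s * s * s * 2 ^ E *_) (^-*-assoc l c E) ⟩
      s * s * s * s * 2 ^ E * l ^ (c * E)        ≤⟨ below n n≥ ⟩
      n                                          ∎
    cube : y ^ E ≡ (y * W) * ((y * W) * (y * W))
    cube = trans (cong (y ^_) (*-comm 3 (suc w))) (trans (sym (^-*-assoc y (suc w) 3)) (cong (λ z → y * W * (y * W * z)) (*-identityʳ (y * W))))
    yW>0 : 0 < y * W
    yW>0 = *-mono-≤ (s≤s (z≤n {Δ})) W>0
    W≤ : S * W ≤ s * s * s * s * y ^ E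
    W≤ = begin
      S * W                   ≤⟨ *-mono-≤ (n≤1+n S) (m≤n*m W y) ⟩
      s * (y * W)             ≤⟨ *-mono-≤ (≤-trans (≤-trans (m≤m*n s s) (m≤m*n (s * s) s)) (m≤m*n (s * s * s) s))
                                   (m≤m*n (y * W) ((y * W) * (y * W)) {{>-nonZero (*-mono-≤ yW>0 yW>0)}}) ⟩
      s * s * s * s * ((y * W) * ((y * W) * (y * W))) ≡⟨ cong (s * s * s * s *_) cube ⟨
      s * s * s * s * y ^ E   ∎
    P+1≤ : suc (Δ * (W * S)) ≤ s * (y * W)
    P+1≤ = begin
      1 + Δ * (W * S)               ≤⟨ +-monoˡ-≤ (Δ * (W * S)) (≤-trans W>0 (m≤m+n W (Δ * W + S * W))) ⟩
      W + (Δ * W + S * W) + Δ * (W * S) ≡⟨ eq Δ W S ⟩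
      s * (y * W)                   ∎
      where
      eq : ∀ d w s → w + (d * w + s * w) + d * (w * s) ≡ suc s * (suc d * w)
      eq = solve-∀
    P≤ : S * (suc (Δ * (W * S)) * suc (Δ * (W * S)) * suc (Δ * (W * S))) ≤ s * s * s * s * y ^ E
    P≤ = begin
      S * (suc (Δ * (W * S)) * suc (Δ * (W * S)) * suc (Δ * (W * S)))
        ≤⟨ *-mono-≤ (n≤1+n S) (*-mono-≤ (*-mono-≤ P+1≤ P+1≤) P+1≤) ⟩
      s * (s * (y * W) * (s * (y * W)) * (s * (y * W)))
        ≡⟨ eq s (y * W) ⟩
      s * s * s * s * ((y * W) * ((y * W) * (y * W)))
        ≡⟨ cong (s * s * s * s *_) cube ⟨
      s * s * s * s * y ^ E ∎
      where
      eq : ∀ s z → s * (s * z * (s * z) * (s * z)) ≡ s * s * s * s * (z * (z * z))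
      eq = solve-∀

-- The theorem over natural numbers, with all constants chosen

semidegree-theorem : ∀ m → 0 < m → ∀ c → Σ[ n₀ ∈ ℕ ] ∀ n → n₀ ≤ n → ∀ k →
  (D : Digraph n) → Oriented D → (∀ v → m * suc k + n ≤ 2 * m * outdeg D v) → (∀ v → m * suc k + n ≤ 2 * m * indeg D v) →
  (T : Digraph (suc (suc k))) → AntiTree (suc k) T → Balanced T → MaxDegLe T (⌈log₂ n ⌉ ^ c) → Contains D T
semidegree-theorem m m>0 c = with-regularity (regularity ξ (16 * m * (8 * dd)) (16 * m) ξ>0 (*-mono-≤ 16m>0 8dd>0))
  where
  ξ dd : ℕ
  -- Of the 512, a factor 8 is the loss allowed to a good vertex and 64 makes few vertices exceed it
  -- in either direction. The 5 in `dd` belongs to the error terms of the regularity lemma.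
  ξ  = 512 * (m * m)
  dd = 5 * ξ
  ξ>0 : 0 < ξ
  ξ>0 = ≤-trans (*-mono-≤ m>0 m>0) (m≤n*m (m * m) 512)
  dd>0 : 0 < dd
  dd>0 = ≤-trans ξ>0 (m≤n*m ξ 5)
  8dd>0 : 0 < 8 * dd
  8dd>0 = ≤-trans dd>0 (m≤n*m dd 8)
  16m>0 : 0 < 16 * m
  16m>0 = ≤-trans m>0 (m≤n*m m 16)
  with-regularity : (Σ[ S ∈ ℕ ] ∀ n → S ≤ n → (D : Digraph n) → Regular D dd (16 * m * (8 * dd)) ξ S (16 * m)) → _
  with-regularity (S , regular) with sizes-fit c S
  ... | n₁ , fit = suc (S + n₁) , contains
    where
    contains : ∀ n → suc (S + n₁) ≤ n → ∀ k →
      (D : Digraph n) → Oriented D → (∀ v → m * suc k + n ≤ 2 * m * outdeg D v) → (∀ v → m * suc k + n ≤ 2 * m * indeg D v) →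
      (T : Digraph (suc (suc k))) → AntiTree (suc k) T → Balanced T → MaxDegLe T (⌈log₂ n ⌉ ^ c) → Contains D T
    contains n n≥ k D oriented outs ins T tree bal deg =
      embed-antitree fr dd>0 16m>0 n>0 W P ≤-refl ≤-refl (to-h (proj₁ sizes)) (to-h (proj₂ sizes)) T tree bal deg
      where
      n>0 : 0 < n
      n>0 = ≤-trans (s≤s z≤n) n≥
      S≤n : S ≤ n
      S≤n = ≤-trans (≤-trans (m≤m+n S n₁) (n≤1+n _)) n≥
      Δ W P : ℕ
      Δ = ⌈log₂ n ⌉ ^ c
      W = suc Δ ^ suc (4 * S)
      P = Δ * (W * S)
      sizes : S * W ≤ n × S * (suc P * suc P * suc P) ≤ n
      sizes = fit n (≤-trans (≤-trans (m≤n+m n₁ S) (n≤1+n _)) n≥) Δ refl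
      fr : Frame D dd (16 * m) S (suc k)
      fr = frame D m (suc k) dd S m>0 n>0 dd>0 (proj₂ oriented) outs ins (regular n S≤n D)
      to-h : ∀ {x} → S * x ≤ n → x ≤ Frame.h fr
      to-h x≤ = *-cancelˡ-≤′ S (factor>0 S n>0 (Frame.n≤S*h fr)) (≤-trans x≤ (Frame.n≤S*h fr))

-- From rational to natural inequalities

toℚᵘ-toℚ : ∀ k → ℚ.toℚᵘ (toℚ k) ℚᵘ.≃ ℚᵘ.mkℚᵘ (ℤ.+ k) 0
toℚᵘ-toℚ k = ℚ.toℚᵘ-fromℚᵘ (ℚᵘ.mkℚᵘ (ℤ.+ k) 0)

module _ (p d : ℕ) (η : ℚ) (η≡ : ℚ.toℚᵘ η ≡ ℚᵘ.mkℚᵘ (ℤ.+ p) d) where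

  ηn≤k⇒ : ∀ n k → η ℚ.* toℚ n ℚ.≤ toℚ k → p * n ≤ suc d * k
  ηn≤k⇒ n k h = subst₂ _≤_ (*-identityʳ (p * n)) (trans (cong (λ x → k * suc x) (*-identityʳ d)) (*-comm k (suc d)))
    (ℤ.drop‿+≤+ (subst₂ ℤ._≤_ (trans (cong (ℤ._* ℤ.+ 1) (sym (ℤ.pos-* p n))) (sym (ℤ.pos-* (p * n) 1))) (sym (ℤ.pos-* k _)) (ℚᵘ.drop-*≤* bound)))
    where
    bound : ℚᵘ.mkℚᵘ (ℤ.+ p) d ℚᵘ.* ℚᵘ.mkℚᵘ (ℤ.+ n) 0 ℚᵘ.≤ ℚᵘ.mkℚᵘ (ℤ.+ k) 0
    bound = ℚᵘ.≤-respʳ-≃ (toℚᵘ-toℚ k) (ℚᵘ.≤-respˡ-≃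
      (ℚᵘ.≃-trans (ℚ.toℚᵘ-homo-* η (toℚ n)) (subst (λ x → x ℚᵘ.* ℚ.toℚᵘ (toℚ n) ℚᵘ.≃ _) (sym η≡) (ℚᵘ.*-congˡ {ℚᵘ.mkℚᵘ (ℤ.+ p) d} (toℚᵘ-toℚ n))))
      (ℚ.toℚᵘ-mono-≤ h))

  degree⇒ : ∀ k x → (1ℚ ℚ.+ η) ℚ.* toℚ k ℚ.* ½ ℚ.< toℚ x → (suc d + p) * k < 2 * suc d * x
  degree⇒ k x h = subst₂ _<_ (eq₁ d p k) (eq₂ d x) (ℤ.drop‿+<+ (subst₂ ℤ._<_ lhs rhs (ℚᵘ.drop-*<* bound)))
    where
    e : ℚᵘ.ℚᵘ
    e = ℚᵘ.mkℚᵘ (ℤ.+ p) d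
    bound : (ℚᵘ.1ℚᵘ ℚᵘ.+ e) ℚᵘ.* ℚᵘ.mkℚᵘ (ℤ.+ k) 0 ℚᵘ.* ℚᵘ.½ ℚᵘ.< ℚᵘ.mkℚᵘ (ℤ.+ x) 0
    bound = ℚᵘ.<-respʳ-≃ (toℚᵘ-toℚ x) (ℚᵘ.<-respˡ-≃
      (ℚᵘ.≃-trans (ℚ.toℚᵘ-homo-* ((1ℚ ℚ.+ η) ℚ.* toℚ k) ½) (ℚᵘ.*-congʳ {ℚᵘ.½}
        (ℚᵘ.≃-trans (ℚ.toℚᵘ-homo-* (1ℚ ℚ.+ η) (toℚ k)) (ℚᵘ.*-cong
          (ℚᵘ.≃-trans (ℚ.toℚᵘ-homo-+ 1ℚ η) (ℚᵘ.≃-reflexive (cong (ℚᵘ.1ℚᵘ ℚᵘ.+_) η≡)))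
          (toℚᵘ-toℚ k)))))
      (ℚ.toℚᵘ-mono-< h))
    -- Both numbers keep the exact shape in which unnormalised arithmetic presents the two cross
    -- products.
    A B : ℕ
    A = ((1 * suc d + p * 1) * k * 1) * 1
    B = x * ((suc d + 0) * 1 * 2)
    lhs : ((ℤ.+ 1 ℤ.* ℤ.+ suc d ℤ.+ ℤ.+ p ℤ.* ℤ.+ 1) ℤ.* ℤ.+ k ℤ.* ℤ.+ 1) ℤ.* ℤ.+ 1 ≡ ℤ.+ A
    lhs = begin
      ((ℤ.+ 1 ℤ.* ℤ.+ suc d ℤ.+ ℤ.+ p ℤ.* ℤ.+ 1) ℤ.* ℤ.+ k ℤ.* ℤ.+ 1) ℤ.* ℤ.+ 1
        ≡⟨ cong (λ y → (y ℤ.* ℤ.+ k ℤ.* ℤ.+ 1) ℤ.* ℤ.+ 1) (sym (trans (ℤ.pos-+ (1 * suc d) (p * 1)) (cong₂ ℤ._+_ (ℤ.pos-* 1 (suc d)) (ℤ.pos-* p 1)))) ⟩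
      ((ℤ.+ (1 * suc d + p * 1)) ℤ.* ℤ.+ k ℤ.* ℤ.+ 1) ℤ.* ℤ.+ 1
        ≡⟨ cong (λ y → (y ℤ.* ℤ.+ 1) ℤ.* ℤ.+ 1) (sym (ℤ.pos-* (1 * suc d + p * 1) k)) ⟩
      (ℤ.+ ((1 * suc d + p * 1) * k) ℤ.* ℤ.+ 1) ℤ.* ℤ.+ 1
        ≡⟨ cong (ℤ._* ℤ.+ 1) (sym (ℤ.pos-* ((1 * suc d + p * 1) * k) 1)) ⟩
      ℤ.+ ((1 * suc d + p * 1) * k * 1) ℤ.* ℤ.+ 1
        ≡⟨ sym (ℤ.pos-* ((1 * suc d + p * 1) * k * 1) 1) ⟩
      ℤ.+ A ∎
      where open ≡-Reasoning
    rhs : ℤ.+ x ℤ.* ℤ.+ ((suc d + 0) * 1 * 2) ≡ ℤ.+ B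
    rhs = sym (ℤ.pos-* x _)
    eq₁ : ∀ d p k → ((1 * suc d + p * 1) * k * 1) * 1 ≡ (suc d + p) * k
    eq₁ = solve-∀
    eq₂ : ∀ d x → x * ((suc d + 0) * 1 * 2) ≡ 2 * suc d * x
    eq₂ = solve-∀

  -- Multiplying the degree condition by the denominator and using k ≥ η n once more turns it into slack in n.
  slack : 0 < p → ∀ n k x → p * n ≤ suc d * k → (suc d + p) * k < 2 * suc d * x → suc d * suc d * k + n ≤ 2 * (suc d * suc d) * x
  slack p>0 n k x e₁ e₂ = begin
    suc d * suc d * k + n                     ≤⟨ +-monoʳ-≤ (suc d * suc d * k) (≤-trans (m≤n*m n p {{>-nonZero p>0}}) (m≤n*m (p * n) p {{>-nonZero p>0}})) ⟩
    suc d * suc d * k + p * (p * n)           ≤⟨ +-monoʳ-≤ (suc d * suc d * k) (*-monoʳ-≤ p e₁) ⟩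
    suc d * suc d * k + p * (suc d * k)       ≡⟨ eq₁ (suc d) p k ⟩
    suc d * ((suc d + p) * k)                 ≤⟨ *-monoʳ-≤ (suc d) (<⇒≤ e₂) ⟩
    suc d * (2 * suc d * x)                   ≡⟨ eq₂ (suc d) x ⟩
    2 * (suc d * suc d) * x                   ∎
    where
    open ≤-Reasoning
    eq₁ : ∀ d p k → d * d * k + p * (d * k) ≡ d * ((d + p) * k)
    eq₁ = solve-∀
    eq₂ : ∀ d x → d * (2 * d * x) ≡ 2 * (d * d) * x
    eq₂ = solve-∀

numerator : ∀ η → 0ℚ ℚ.< η → ∃ λ p → ∃ λ d → ℚ.toℚᵘ η ≡ ℚᵘ.mkℚᵘ (ℤ.+ suc p) d
numerator (ℚ.mkℚ (ℤ.+ suc p) d _)  _              = p , d , refl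
numerator (ℚ.mkℚ (ℤ.+ zero) d _)   (ℚ.*<* (ℤ.+<+ ()))
numerator (ℚ.mkℚ ℤ.-[1+ p ] d _)   (ℚ.*<* ())

theorem1 : (η : ℚ) → 0ℚ ℚ.< η → η ℚ.< 1ℚ → (c : ℕ) →
    Σ ℕ λ n₀ → (n : ℕ) → n₀ ≤ n → (k : ℕ) → η ℚ.* toℚ n ℚ.≤ toℚ k →
    (D : Digraph n) → Oriented D → SemidegreeAbove D ((1ℚ ℚ.+ η) ℚ.* toℚ k ℚ.* ½) →
    (T : Digraph (suc k)) → AntiTree k T → Balanced T → MaxDegLe T (⌈log₂ n ⌉ ^ c) →
    Contains D T
theorem1 η 0<η _ c = from (numerator η 0<η)
  where
  Goal : ℕ → Set
  Goal n₀ = (n : ℕ) → n₀ ≤ n → (k : ℕ) → η ℚ.* toℚ n ℚ.≤ toℚ k →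
    (D : Digraph n) → Oriented D → SemidegreeAbove D ((1ℚ ℚ.+ η) ℚ.* toℚ k ℚ.* ½) →
    (T : Digraph (suc k)) → AntiTree k T → Balanced T → MaxDegLe T (⌈log₂ n ⌉ ^ c) →
    Contains D T

  from : (∃ λ p → ∃ λ d → ℚ.toℚᵘ η ≡ ℚᵘ.mkℚᵘ (ℤ.+ suc p) d) → Σ ℕ Goal
  from (p , d , η≡) = conclude (semidegree-theorem (suc d * suc d) (s≤s z≤n) c)
    where
    conclude : (Σ[ n₀ ∈ ℕ ] ∀ n → n₀ ≤ n → ∀ k →
      (D : Digraph n) → Oriented D → (∀ v → suc d * suc d * suc k + n ≤ 2 * (suc d * suc d) * outdeg D v) →
      (∀ v → suc d * suc d * suc k + n ≤ 2 * (suc d * suc d) * indeg D v) →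
      (T : Digraph (suc (suc k))) → AntiTree (suc k) T → Balanced T → MaxDegLe T (⌈log₂ n ⌉ ^ c) → Contains D T) → Σ ℕ Goal
    conclude (n₀ , embeds) = suc n₀ , contains
      where
      contains : Goal (suc n₀)
      -- `k = 0` contradicts `η n ≤ k` because `n` is positive; the passage to `suc n₀` ensures
      -- that. The tree therefore has an arc, as the argument about sinks requires.
      contains n n≥ zero ηn≤k = ⊥-elim (<⇒≱ (≤-trans (≤-trans (s≤s z≤n) n≥) (m≤m+n n (p * n)))
        (≤-trans (ηn≤k⇒ (suc p) d η η≡ n 0 ηn≤k) (≤-reflexive (*-zeroʳ (suc d)))))
      contains n n≥ (suc k) ηn≤k D oriented semi =
        embeds n (≤-trans (n≤1+n n₀) n≥) k D oriented
          (λ v → degree (outdeg D v) (proj₁ (semi v))) (λ v → degree (indeg D v) (proj₂ (semi v)))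
        where
        degree : ∀ x → (1ℚ ℚ.+ η) ℚ.* toℚ (suc k) ℚ.* ½ ℚ.< toℚ x → suc d * suc d * suc k + n ≤ 2 * (suc d * suc d) * x
        degree x h = slack (suc p) d η η≡ (s≤s z≤n) n (suc k) x (ηn≤k⇒ (suc p) d η η≡ n (suc k) ηn≤k) (degree⇒ (suc p) d η η≡ (suc k) x h)
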